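{- For infinitely many positive integers $n$ there is a totally positive algebraic integer of degree $n$ and trace less than $$2n-\frac14\,\frac{\log\log n}{\log\log\log n}.$$
   Context: An algebraic integer is totally positive if all its conjugates over $\mathbb{Q}$ are real and positive. Its degree and trace are the degree of its minimal polynomial over $\mathbb{Q}$ and the sum of the zeros of that minimal polynomial, respectively. $\log$ is the natural logarithm. -}

module Defs where

open import Data.Integer as ℤ using (ℤ)
open import Data.Nat as ℕ using (ℕ; zero; suc; _!)
open import Data.Nat.Properties using (m≤m⊔n; m≤n⊔m; _!≢0)
  renaming (≤-refl to ≤-reflℕ; ≤-trans to ≤-transℕ)
open import Data.Product using (∃-syntax; _×_; _,_)
open import Data.Rational as ℚ using (ℚ; 0ℚ; 1ℚ; ½; 1/_; ∣_∣; Positive; positive)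
open import Data.Rational.Properties
open import Data.Rational.Solver using (module +-*-Solver)
open import Data.Vec using (Vec; []; _∷_; map; foldr′)
open import Relation.Binary.PropositionalEquality
  using (_≡_; refl; sym; trans; cong; cong₂)

Eventually : (ℕ → Set) → Set
Eventually P = ∃[ N ] (∀ n → N ℕ.≤ n → P n)

Cauchy : (ℕ → ℚ) → Set
Cauchy s = ∀ ε → 0ℚ ℚ.< ε →
  ∃[ N ] (∀ m n → N ℕ.≤ m → N ℕ.≤ n → ∣ s m ℚ.- s n ∣ ℚ.≤ ε)

-- Equality of reals is _≈_ below, not _≡_.
record ℝ : Set where
  constructor mkℝ
  field
    seq    : ℕ → ℚ
    cauchy : Cauchy seq

open ℝ public

infix 4 _≈_ _<_

_≈_ : ℝ → ℝ → Set
x ≈ y = ∀ ε → 0ℚ ℚ.< ε → Eventually λ n → ∣ seq x n ℚ.- seq y n ∣ ℚ.≤ ε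

_<_ : ℝ → ℝ → Set
x < y = ∃[ ε ] 0ℚ ℚ.< ε × Eventually λ n → seq x n ℚ.+ ε ℚ.≤ seq y n

module Lemmas where
  module Identities where
    open +-*-Solver

    telescope : ∀ a b → a ≡ (a ℚ.- b) ℚ.+ b
    telescope = solve 2 (λ a b → a := (a :- b) :+ b) refl

    +-interchange : ∀ a b c d →
      (a ℚ.+ b) ℚ.- (c ℚ.+ d) ≡ (a ℚ.- c) ℚ.+ (b ℚ.- d)
    +-interchange = solve 4 (λ a b c d →
      (a :+ b) :- (c :+ d) := (a :- c) :+ (b :- d)) refl

    neg-diff : ∀ a b → ℚ.- a ℚ.- ℚ.- b ≡ ℚ.- (a ℚ.- b)
    neg-diff = solve 2 (λ a b → :- a :- :- b := :- (a :- b)) refl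

    *-diff : ∀ a b c d →
      a ℚ.* b ℚ.- c ℚ.* d ≡ a ℚ.* (b ℚ.- d) ℚ.+ d ℚ.* (a ℚ.- c)
    *-diff = solve 4 (λ a b c d →
      a :* b :- c :* d := a :* (b :- d) :+ d :* (a :- c)) refl

    *-swap : ∀ p q r → q ℚ.* (p ℚ.* r) ≡ p ℚ.* (q ℚ.* r)
    *-swap = solve 3 (λ p q r → q :* (p :* r) := p :* (q :* r)) refl

    cross-diff : ∀ r s a b →
      (r ℚ.- s) ℚ.* (a ℚ.* b) ≡ (a ℚ.* r) ℚ.* b ℚ.- (b ℚ.* s) ℚ.* a
    cross-diff = solve 4 (λ r s a b →
      (r :- s) :* (a :* b) := (a :* r) :* b :- (b :* s) :* a) refl

  open Identities public

  half-pos : ∀ ε → 0ℚ ℚ.< ε → 0ℚ ℚ.< ½ ℚ.* ε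
  half-pos ε ε>0 =
    positive⁻¹ (½ ℚ.* ε) {{pos*pos⇒pos ½ ε {{positive ε>0}}}}

  halves : ∀ ε → ½ ℚ.* ε ℚ.+ ½ ℚ.* ε ≡ ε
  halves ε = trans (sym (*-distribʳ-+ ε ½ ½)) (*-identityˡ ε)

  product-diff : ∀ a b c d {B δ} → 0ℚ ℚ.≤ B →
    ∣ a ∣ ℚ.≤ B → ∣ d ∣ ℚ.≤ B →
    ∣ b ℚ.- d ∣ ℚ.≤ δ → ∣ a ℚ.- c ∣ ℚ.≤ δ →
    ∣ a ℚ.* b ℚ.- c ℚ.* d ∣ ℚ.≤ B ℚ.* δ ℚ.+ B ℚ.* δ
  product-diff a b c d {B} {δ} 0≤B a≤B d≤B b-d≤δ a-c≤δ = begin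
    ∣ a ℚ.* b ℚ.- c ℚ.* d ∣
      ≡⟨ cong ∣_∣ (*-diff a b c d) ⟩
    ∣ a ℚ.* (b ℚ.- d) ℚ.+ d ℚ.* (a ℚ.- c) ∣
      ≤⟨ ∣p+q∣≤∣p∣+∣q∣ (a ℚ.* (b ℚ.- d)) (d ℚ.* (a ℚ.- c)) ⟩
    ∣ a ℚ.* (b ℚ.- d) ∣ ℚ.+ ∣ d ℚ.* (a ℚ.- c) ∣
      ≤⟨ +-mono-≤ (bound a (b ℚ.- d) a≤B b-d≤δ) (bound d (a ℚ.- c) d≤B a-c≤δ) ⟩
    B ℚ.* δ ℚ.+ B ℚ.* δ ∎
    where
    open ≤-Reasoning
    bound : ∀ p q → ∣ p ∣ ℚ.≤ B → ∣ q ∣ ℚ.≤ δ → ∣ p ℚ.* q ∣ ℚ.≤ B ℚ.* δ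
    bound p q p≤B q≤δ = begin
      ∣ p ℚ.* q ∣     ≡⟨ ∣p*q∣≡∣p∣*∣q∣ p q ⟩
      ∣ p ∣ ℚ.* ∣ q ∣ ≤⟨ *-monoʳ-≤-nonNeg ∣ q ∣ {{∣-∣-nonNeg q}} p≤B ⟩
      B ℚ.* ∣ q ∣     ≤⟨ *-monoˡ-≤-nonNeg B {{ℚ.nonNegative 0≤B}} q≤δ ⟩
      B ℚ.* δ         ∎

  bounded : ∀ s → Cauchy s → ∃[ B ] Eventually λ n → ∣ s n ∣ ℚ.≤ B
  bounded s c with c 1ℚ (positive⁻¹ 1ℚ)
  ... | N , near = 1ℚ ℚ.+ ∣ s N ∣ , N , λ n N≤n → begin
    ∣ s n ∣                     ≡⟨ cong ∣_∣ (telescope (s n) (s N)) ⟩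
    ∣ (s n ℚ.- s N) ℚ.+ s N ∣   ≤⟨ ∣p+q∣≤∣p∣+∣q∣ (s n ℚ.- s N) (s N) ⟩
    ∣ s n ℚ.- s N ∣ ℚ.+ ∣ s N ∣ ≤⟨ +-monoˡ-≤ ∣ s N ∣ (near n N N≤n ≤-reflℕ) ⟩
    1ℚ ℚ.+ ∣ s N ∣              ∎
    where open ≤-Reasoning

  infixl 7 _÷⁺_

  _÷⁺_ : ℚ → (q : ℚ) → .{{Positive q}} → ℚ
  (p ÷⁺ q) = p ℚ.* (1/ q) {{pos⇒nonZero q}}

  ÷⁺-pos : ∀ p q .{{_ : Positive p}} .{{_ : Positive q}} → 0ℚ ℚ.< p ÷⁺ q
  ÷⁺-pos p q = positive⁻¹ (p ÷⁺ q)
    {{pos*pos⇒pos p ((1/ q) {{pos⇒nonZero q}}) {{1/pos⇒pos q}}}}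

  *-÷⁺ : ∀ p q .{{_ : Positive q}} → q ℚ.* (p ÷⁺ q) ≡ p
  *-÷⁺ p q = begin
    q ℚ.* (p ℚ.* q⁻¹) ≡⟨ *-swap p q q⁻¹ ⟩
    p ℚ.* (q ℚ.* q⁻¹) ≡⟨ cong (p ℚ.*_) (*-inverseʳ q {{pos⇒nonZero q}}) ⟩
    p ℚ.* 1ℚ          ≡⟨ *-identityʳ p ⟩
    p                 ∎
    where
    open Relation.Binary.PropositionalEquality.≡-Reasoning
    q⁻¹ = (1/ q) {{pos⇒nonZero q}}

  split : ∀ B ε → 0ℚ ℚ.< B → 0ℚ ℚ.< ε → ∃[ δ ] 0ℚ ℚ.< δ × B ℚ.* δ ℚ.+ B ℚ.* δ ≡ ε
  split B ε B>0 ε>0 = (½ ℚ.* ε) ÷⁺ B , ÷⁺-pos (½ ℚ.* ε) B ,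
    trans (cong₂ ℚ._+_ (*-÷⁺ (½ ℚ.* ε) B) (*-÷⁺ (½ ℚ.* ε) B)) (halves ε)
    where
    instance
      B-pos : Positive B
      B-pos = positive B>0
      ½ε-pos : Positive (½ ℚ.* ε)
      ½ε-pos = positive (half-pos ε ε>0)

  *-cauchy-bounded : ∀ s t B → 0ℚ ℚ.< B →
    (Eventually λ n → ∣ s n ∣ ℚ.≤ B) → (Eventually λ n → ∣ t n ∣ ℚ.≤ B) →
    Cauchy s → Cauchy t → Cauchy λ n → s n ℚ.* t n
  *-cauchy-bounded s t B B>0 (K , boundˢ) (L , boundᵗ) cˢ cᵗ ε ε>0 =
    let δ , δ>0 , Bδ+Bδ≡ε = split B ε B>0 ε>0
        M , nearˢ = cˢ δ δ>0
        N , nearᵗ = cᵗ δ δ>0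
        left  = λ {k} → ≤-transℕ {k = k} (m≤m⊔n (K ℕ.⊔ L) (M ℕ.⊔ N))
        right = λ {k} → ≤-transℕ {k = k} (m≤n⊔m (K ℕ.⊔ L) (M ℕ.⊔ N))
    in (K ℕ.⊔ L) ℕ.⊔ (M ℕ.⊔ N) , λ m n m≥ n≥ →
      ≤-trans
        (product-diff (s m) (t m) (s n) (t n) (<⇒≤ B>0)
          (boundˢ m (≤-transℕ (m≤m⊔n K L) (left m≥)))
          (boundᵗ n (≤-transℕ (m≤n⊔m K L) (left n≥)))
          (nearᵗ m n (≤-transℕ (m≤n⊔m M N) (right m≥))
                   (≤-transℕ (m≤n⊔m M N) (right n≥)))
          (nearˢ m n (≤-transℕ (m≤m⊔n M N) (right m≥))
                   (≤-transℕ (m≤m⊔n M N) (right n≥))))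
        (≤-reflexive Bδ+Bδ≡ε)

  *-cauchy : ∀ s t → Cauchy s → Cauchy t → Cauchy λ n → s n ℚ.* t n
  *-cauchy s t cˢ cᵗ =
    let Bˢ , K , boundˢ = bounded s cˢ
        Bᵗ , L , boundᵗ = bounded t cᵗ
    in *-cauchy-bounded s t (1ℚ ℚ.⊔ (Bˢ ℚ.⊔ Bᵗ))
      (<-≤-trans (positive⁻¹ 1ℚ) (p≤p⊔q 1ℚ (Bˢ ℚ.⊔ Bᵗ)))
      (K , λ n n≥ → ≤-trans (boundˢ n n≥) (≤-trans (p≤p⊔q Bˢ Bᵗ) (p≤q⊔p 1ℚ (Bˢ ℚ.⊔ Bᵗ))))
      (L , λ n n≥ → ≤-trans (boundᵗ n n≥) (≤-trans (p≤q⊔p Bˢ Bᵗ) (p≤q⊔p 1ℚ (Bˢ ℚ.⊔ Bᵗ))))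
      cˢ cᵗ

  inverse-near : ∀ a b r s ε η → 0ℚ ℚ.< ε → ε ℚ.≤ a → ε ℚ.≤ b →
    a ℚ.* r ≡ 1ℚ → b ℚ.* s ≡ 1ℚ →
    ∣ b ℚ.- a ∣ ℚ.≤ η ℚ.* (ε ℚ.* ε) → ∣ r ℚ.- s ∣ ℚ.≤ η
  inverse-near a b r s ε η ε>0 ε≤a ε≤b ar≡1 bs≡1 near =
    *-cancelʳ-≤-pos (ε ℚ.* ε) {{pos*pos⇒pos ε ε}} (begin
      ∣ r ℚ.- s ∣ ℚ.* (ε ℚ.* ε)
        ≤⟨ *-monoˡ-≤-nonNeg ∣ r ℚ.- s ∣ {{∣-∣-nonNeg (r ℚ.- s)}} εε≤ab ⟩
      ∣ r ℚ.- s ∣ ℚ.* (a ℚ.* b)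
        ≡⟨ cong (∣ r ℚ.- s ∣ ℚ.*_) (sym (0≤p⇒∣p∣≡p 0≤ab)) ⟩
      ∣ r ℚ.- s ∣ ℚ.* ∣ a ℚ.* b ∣
        ≡⟨ sym (∣p*q∣≡∣p∣*∣q∣ (r ℚ.- s) (a ℚ.* b)) ⟩
      ∣ (r ℚ.- s) ℚ.* (a ℚ.* b) ∣
        ≡⟨ cong ∣_∣ (cross-diff r s a b) ⟩
      ∣ (a ℚ.* r) ℚ.* b ℚ.- (b ℚ.* s) ℚ.* a ∣
        ≡⟨ cong₂ (λ u v → ∣ u ℚ.* b ℚ.- v ℚ.* a ∣) ar≡1 bs≡1 ⟩
      ∣ 1ℚ ℚ.* b ℚ.- 1ℚ ℚ.* a ∣
        ≡⟨ cong₂ (λ u v → ∣ u ℚ.- v ∣) (*-identityˡ b) (*-identityˡ a) ⟩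
      ∣ b ℚ.- a ∣
        ≤⟨ near ⟩
      η ℚ.* (ε ℚ.* ε) ∎)
    where
    open ≤-Reasoning
    instance
      ε-pos : Positive ε
      ε-pos = positive ε>0
    εε≤ab : ε ℚ.* ε ℚ.≤ a ℚ.* b
    εε≤ab = ≤-trans
      (*-monoʳ-≤-nonNeg ε {{pos⇒nonNeg ε}} ε≤a)
      (*-monoˡ-≤-nonNeg a {{ℚ.nonNegative (≤-trans (<⇒≤ ε>0) ε≤a)}} ε≤b)
    0≤ab : 0ℚ ℚ.≤ a ℚ.* b
    0≤ab = ≤-trans (<⇒≤ (positive⁻¹ (ε ℚ.* ε) {{pos*pos⇒pos ε ε}})) εε≤ab

open Lemmas

fromℚ : ℚ → ℝ
fromℚ q = mkℝ (λ _ → q) λ ε ε>0 → 0 , λ _ _ _ _ →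
  ≤-trans (≤-reflexive (cong ∣_∣ (+-inverseʳ q))) (<⇒≤ ε>0)

fromℤ : ℤ → ℝ
fromℤ i = fromℚ (i ℚ./ 1)

fromℕ : ℕ → ℝ
fromℕ n = fromℤ (ℤ.+ n)

0ℝ 1ℝ : ℝ
0ℝ = fromℚ 0ℚ
1ℝ = fromℚ 1ℚ

infix  8 -_
infixl 7 _*_
infixl 6 _+_ _-_

_+_ : ℝ → ℝ → ℝ
seq (x + y) n = seq x n ℚ.+ seq y n
cauchy (x + y) ε ε>0
  with cauchy x (½ ℚ.* ε) (half-pos ε ε>0) | cauchy y (½ ℚ.* ε) (half-pos ε ε>0)
... | M , nearˣ | N , nearʸ = M ℕ.⊔ N , λ m n m≥ n≥ →
  let a = seq x m; b = seq y m; c = seq x n; d = seq y n in begin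
    ∣ (a ℚ.+ b) ℚ.- (c ℚ.+ d) ∣
      ≡⟨ cong ∣_∣ (+-interchange a b c d) ⟩
    ∣ (a ℚ.- c) ℚ.+ (b ℚ.- d) ∣
      ≤⟨ ∣p+q∣≤∣p∣+∣q∣ (a ℚ.- c) (b ℚ.- d) ⟩
    ∣ a ℚ.- c ∣ ℚ.+ ∣ b ℚ.- d ∣
      ≤⟨ +-mono-≤ (nearˣ m n (≤-transℕ (m≤m⊔n M N) m≥) (≤-transℕ (m≤m⊔n M N) n≥))
                  (nearʸ m n (≤-transℕ (m≤n⊔m M N) m≥) (≤-transℕ (m≤n⊔m M N) n≥)) ⟩
    ½ ℚ.* ε ℚ.+ ½ ℚ.* ε
      ≡⟨ halves ε ⟩
    ε ∎
  where
  open ≤-Reasoning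

-_ : ℝ → ℝ
seq (- x) n = ℚ.- seq x n
cauchy (- x) ε ε>0 with cauchy x ε ε>0
... | N , near = N , λ m n m≥ n≥ → begin
    ∣ ℚ.- seq x m ℚ.- ℚ.- seq x n ∣
      ≡⟨ cong ∣_∣ (neg-diff (seq x m) (seq x n)) ⟩
    ∣ ℚ.- (seq x m ℚ.- seq x n) ∣
      ≡⟨ ∣-p∣≡∣p∣ (seq x m ℚ.- seq x n) ⟩
    ∣ seq x m ℚ.- seq x n ∣
      ≤⟨ near m n m≥ n≥ ⟩
    ε ∎
  where
  open ≤-Reasoning

_-_ : ℝ → ℝ → ℝ
x - y = x + - y

_*_ : ℝ → ℝ → ℝ
seq (x * y) n = seq x n ℚ.* seq y n
cauchy (x * y) = *-cauchy (seq x) (seq y) (cauchy x) (cauchy y)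

infixr 8 _^_

_^_ : ℝ → ℕ → ℝ
x ^ zero  = 1ℝ
x ^ suc k = x * x ^ k

-- If ε > 0 is an eventual lower bound of the terms of x, the terms of the
-- inverse are 1 / max(ε, xₙ), so the finitely many terms below ε do no harm.
inv : ∀ x → 0ℝ < x → ℝ
inv x (ε , ε>0 , N₀ , ε≤x) = mkℝ r r-cauchy
  where
  open ≤-Reasoning
  instance
    ε-pos : Positive ε
    ε-pos = positive ε>0
  a : ℕ → ℚ
  a n = ε ℚ.⊔ seq x n
  instance
    a-pos : ∀ {n} → Positive (a n)
    a-pos {n} = positive (<-≤-trans ε>0 (p≤p⊔q ε (seq x n)))
  r : ℕ → ℚ
  r n = 1ℚ ÷⁺ a n
  ε≤a : ∀ n → ε ℚ.≤ a n
  ε≤a n = p≤p⊔q ε (seq x n)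
  a≡x : ∀ n → N₀ ℕ.≤ n → a n ≡ seq x n
  a≡x n n≥ = p≤q⇒p⊔q≡q (≤-trans (≤-reflexive (sym (+-identityˡ ε))) (ε≤x n n≥))
  r-cauchy : Cauchy r
  r-cauchy η η>0 =
    let N , near = cauchy x (η ℚ.* (ε ℚ.* ε))
          (positive⁻¹ (η ℚ.* (ε ℚ.* ε))
            {{pos*pos⇒pos η {{positive η>0}} (ε ℚ.* ε) {{pos*pos⇒pos ε ε}}}})
    in N₀ ℕ.⊔ N , λ m n m≥ n≥ →
      inverse-near (a m) (a n) (r m) (r n) ε η ε>0 (ε≤a m) (ε≤a n)
        (*-÷⁺ 1ℚ (a m)) (*-÷⁺ 1ℚ (a n))
        (≤-trans
          (≤-reflexive (cong₂ (λ u v → ∣ u ℚ.- v ∣)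
            (a≡x n (≤-transℕ (m≤m⊔n N₀ N) n≥)) (a≡x m (≤-transℕ (m≤m⊔n N₀ N) m≥))))
          (near n m (≤-transℕ (m≤n⊔m N₀ N) n≥) (≤-transℕ (m≤n⊔m N₀ N) m≥)))

infix 4 _⟶_

_⟶_ : (ℕ → ℝ) → ℝ → Set
s ⟶ x = ∀ ε → 0ℚ ℚ.< ε →
  Eventually λ i → s i < x + fromℚ ε × x < s i + fromℚ ε

-- expSum y m = Σ_{k<m} yᵏ / k!
expSum : ℝ → ℕ → ℝ
expSum y zero    = 0ℝ
expSum y (suc k) = expSum y k + fromℚ ((ℤ.+ 1 ℚ./ (k !)) {{k !≢0}}) * y ^ k

-- IsLog x y: y = log x, i.e. exp y = Σₖ yᵏ / k! converges to x.
IsLog : ℝ → ℝ → Set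
IsLog x y = expSum y ⟶ x

infix  4 _≈ᶜ_
infixl 7 _*ᶜ_
infixl 6 _+ᶜ_ _-ᶜ_
infix  5 _+i_

record ℂ : Set where
  constructor _+i_
  field
    re im : ℝ

open ℂ public

_≈ᶜ_ : ℂ → ℂ → Set
w ≈ᶜ z = re w ≈ re z × im w ≈ im z

_+ᶜ_ _-ᶜ_ _*ᶜ_ : ℂ → ℂ → ℂ
w +ᶜ z = (re w + re z) +i (im w + im z)
w -ᶜ z = (re w - re z) +i (im w - im z)
w *ᶜ z = (re w * re z - im w * im z) +i (re w * im z + im w * re z)

ℝ→ℂ : ℝ → ℂ
ℝ→ℂ x = x +i 0ℝ

0ᶜ 1ᶜ : ℂ
0ᶜ = ℝ→ℂ 0ℝ
1ᶜ = ℝ→ℂ 1ℝ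

Σᶜ Πᶜ : ∀ {n} → Vec ℂ n → ℂ
Σᶜ = foldr′ _+ᶜ_ 0ᶜ
Πᶜ = foldr′ _*ᶜ_ 1ᶜ

-- The vector a₀ ∷ … ∷ aₙ₋₁ ∷ [] stands for the monic polynomial
-- Xⁿ + aₙ₋₁ Xⁿ⁻¹ + … + a₀ of degree n.
Monic : Set → ℕ → Set
Monic A n = Vec A n

eval : ∀ {n} → Monic ℂ n → ℂ → ℂ
eval []       z = 1ᶜ
eval (a ∷ as) z = a +ᶜ z *ᶜ eval as z

evalℤ : ∀ {n} → Monic ℤ n → ℂ → ℂ
evalℤ p = eval (map (λ a → ℝ→ℂ (fromℤ a)) p)

evalℚ : ∀ {n} → Monic ℚ n → ℂ → ℂ
evalℚ p = eval (map (λ a → ℝ→ℂ (fromℚ a)) p)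

IsAlgebraicInteger : ℂ → Set
IsAlgebraicInteger α = ∃[ n ] ∃[ p ] evalℤ {n} p α ≈ᶜ 0ᶜ

IsMinimalPolynomial : ∀ {n} → ℂ → Monic ℚ n → Set
IsMinimalPolynomial {n} α p =
  evalℚ p α ≈ᶜ 0ᶜ × (∀ {m} (q : Monic ℚ m) → evalℚ q α ≈ᶜ 0ᶜ → n ℕ.≤ m)

IsConjugate : ℂ → ℂ → Set
IsConjugate α β =
  ∃[ n ] ∃[ p ] IsMinimalPolynomial {n} α p × evalℚ p β ≈ᶜ 0ᶜ

IsTotallyPositive : ℂ → Set
IsTotallyPositive α = ∀ β → IsConjugate α β → im β ≈ 0ℝ × 0ℝ < re β

HasDegree : ℂ → ℕ → Set
HasDegree α n = ∃[ p ] IsMinimalPolynomial {n} α p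

-- zs lists the zeros of p with multiplicity: p = Π (X - zᵢ).
AreZerosOf : ∀ {n} → Vec ℂ n → Monic ℚ n → Set
AreZerosOf zs p = ∀ x → evalℚ p x ≈ᶜ Πᶜ (map (x -ᶜ_) zs)

HasTrace : ℂ → ℝ → Set
HasTrace α t =
  ∃[ n ] ∃[ p ] ∃[ zs ]
    IsMinimalPolynomial {n} α p × AreZerosOf zs p × ℝ→ℂ t ≈ᶜ Σᶜ zs

InfinitelyMany : (ℕ → Set) → Set
InfinitelyMany P = ∀ N → ∃[ n ] N ℕ.< n × P n

-- Let w(t) = t³ - 4t. If t runs from ≤ -9/4 to ≥ 9/4 (or back) on an interval, the
-- interval splits into three on which w ∘ t does the same. Bernstein coefficients
-- certify 30 such intervals on the positive half-line for t = φ / f, where φ and f are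
-- integral of degrees 30 and 29. Hence the numerator H of wᵉ(φ / f) + 2, which is monic
-- of degree n = 30 · 3ᵉ, has n positive zeros. Passing to w(t) multiplies degree and
-- trace by 3, and φ has trace 59, so the trace of H is 59 · 3ᵉ = 2n - n / 30. It is
-- irreducible by Schönemann's criterion: φ is irreducible modulo 2, and modulo 4 H is
-- φᵏ + 2D with k = 3ᵉ and D = fᵏ not divisible by φ modulo 2. Finally n / 30 exceeds
-- log log n / (4 log log log n) as soon as log log log n ≥ 4.
module Submission where

-- The constant 9/4 is tied to w: w(9/4) ≥ 9/4 holds because 9/4 > √5, and the local extrema ± 16 /
-- (3√3) of w lie beyond ± 9/4, so one crossing yields three. The summand 2 serves both halves of
-- the argument: -2 lies strictly between ± 9/4, so every interval carries a zero of H, and 2D is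
-- the term that Schönemann's criterion asks for, while the 4 in w disappears modulo 4. The
-- criterion excludes factorisations over the integers. Passing to rational coefficients leads to
-- factorisations of integer multiples c H; instead of Gauss's lemma, factors 2 are cancelled until
-- c is odd. Reals are Cauchy sequences without a decidable order, and this shapes the analysis.
-- Signs are only decided at rational points, continuity is replaced by Lipschitz bounds, and zeros
-- come with explicit rational gaps. A conjugate is shown to be real and positive by bounding the
-- product of its distances to the known zeros from below, without asking which zero it is.

open import Algebra using (CommutativeRing)

-- Univariate polynomials over a commutative ring

module Polynomials {c ℓ} (R : CommutativeRing c ℓ) where

  open import Data.List using (List; []; _∷_; length)
  open import Data.Nat as ℕ using (ℕ; zero; suc; z≤n; s≤s)
  import Data.Nat.Properties as ℕₚ
  open import Data.Sum using (_⊎_; inj₁; inj₂)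
  import Relation.Binary.PropositionalEquality as ≡
  open import Data.Product using (_×_; _,_; ∃-syntax)
  open CommutativeRing R
  open import Algebra.Properties.Ring ring using (-0#≈0#)
  import Relation.Binary.Reasoning.Setoid
  open import Relation.Binary.Bundles using (Setoid)
  module ≈-Reasoning = Relation.Binary.Reasoning.Setoid setoid
  open import Algebra.Solver.Ring.NaturalCoefficients.Default commutativeSemiring
    using (solve; _:=_; _:+_; _:*_; con)

  Poly : Set c
  Poly = List Carrier

  infixl 9 _!_
  _!_ : Poly → ℕ → Carrier
  []      ! i     = 0#
  (a ∷ p) ! zero  = a
  (a ∷ p) ! suc i = p ! i

  infix 4 _≋_
  -- Lists that differ in trailing zeros denote the same polynomial, so coefficients are compared at
  -- every index, with 0 read past the end. The record lets p and q be inferred from a proof.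
  record _≋_ (p q : Poly) : Set ℓ where
    constructor coeffs
    field at : ∀ i → p ! i ≈ q ! i
  open _≋_ public

  infixl 6 _⊕_
  infixl 7 _⊗_ _·_
  infixr 8 _↑_
  infix  8 ⊖_

  _⊕_ : Poly → Poly → Poly
  []      ⊕ q       = q
  (a ∷ p) ⊕ []      = a ∷ p
  (a ∷ p) ⊕ (b ∷ q) = a + b ∷ p ⊕ q

  _·_ : Carrier → Poly → Poly
  a · []      = []
  a · (b ∷ p) = a * b ∷ a · p

  ⊖_ : Poly → Poly
  ⊖ []      = []
  ⊖ (a ∷ p) = - a ∷ ⊖ p

  _⊗_ : Poly → Poly → Poly
  []      ⊗ q = []
  (a ∷ p) ⊗ q = a · q ⊕ (0# ∷ p ⊗ q)

  1ₚ : Poly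
  1ₚ = 1# ∷ []

  _↑_ : Poly → ℕ → Poly
  p ↑ zero  = 1ₚ
  p ↑ suc k = p ⊗ p ↑ k

  ⊕-! : ∀ p q i → (p ⊕ q) ! i ≈ p ! i + q ! i
  ⊕-! []      q       i       = sym (+-identityˡ _)
  ⊕-! (a ∷ p) []      i       = sym (+-identityʳ _)
  ⊕-! (a ∷ p) (b ∷ q) zero    = refl
  ⊕-! (a ∷ p) (b ∷ q) (suc i) = ⊕-! p q i

  ·-! : ∀ a p i → (a · p) ! i ≈ a * p ! i
  ·-! a []      i       = sym (zeroʳ a)
  ·-! a (b ∷ p) zero    = refl
  ·-! a (b ∷ p) (suc i) = ·-! a p i

  ⊖-! : ∀ p i → (⊖ p) ! i ≈ - (p ! i)
  ⊖-! []      i       = sym -0#≈0#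
  ⊖-! (a ∷ p) zero    = refl
  ⊖-! (a ∷ p) (suc i) = ⊖-! p i

  ≋-refl : ∀ {p} → p ≋ p
  ≋-refl = coeffs λ i → refl

  ≋-sym : ∀ {p q} → p ≋ q → q ≋ p
  ≋-sym e = coeffs λ i → sym (at e i)

  ≋-trans : ∀ {p q r} → p ≋ q → q ≋ r → p ≋ r
  ≋-trans e f = coeffs λ i → trans (at e i) (at f i)

  polySetoid : Setoid c ℓ
  polySetoid = record
    { Carrier = Poly ; _≈_ = _≋_
    ; isEquivalence = record { refl = ≋-refl ; sym = ≋-sym ; trans = ≋-trans } }

  module ≋-Reasoning = Relation.Binary.Reasoning.Setoid polySetoid

  ∷-cong : ∀ {a b p q} → a ≈ b → p ≋ q → a ∷ p ≋ b ∷ q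
  ∷-cong e f = coeffs λ { zero → e ; (suc i) → at f i }

  tail-cong : ∀ {a b p q} → a ∷ p ≋ b ∷ q → p ≋ q
  tail-cong e = coeffs λ i → at e (suc i)

  0∷[] : 0# ∷ [] ≋ []
  0∷[] = coeffs λ { zero → refl ; (suc i) → refl }

  ⊕-cong : ∀ {p p′ q q′} → p ≋ p′ → q ≋ q′ → p ⊕ q ≋ p′ ⊕ q′
  ⊕-cong {p} {p′} {q} {q′} e f = coeffs λ i →
    trans (⊕-! p q i) (trans (+-cong (at e i) (at f i)) (sym (⊕-! p′ q′ i)))

  ⊕-congˡ : ∀ {p q q′} → q ≋ q′ → p ⊕ q ≋ p ⊕ q′
  ⊕-congˡ = ⊕-cong ≋-refl

  ⊕-congʳ : ∀ {p p′ q} → p ≋ p′ → p ⊕ q ≋ p′ ⊕ q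
  ⊕-congʳ e = ⊕-cong e ≋-refl

  ·-cong : ∀ {a b p q} → a ≈ b → p ≋ q → a · p ≋ b · q
  ·-cong {a} {b} {p} {q} e f = coeffs λ i →
    trans (·-! a p i) (trans (*-cong e (at f i)) (sym (·-! b q i)))

  ⊖-cong : ∀ {p q} → p ≋ q → ⊖ p ≋ ⊖ q
  ⊖-cong {p} {q} e = coeffs λ i →
    trans (⊖-! p i) (trans (-‿cong (at e i)) (sym (⊖-! q i)))

  ⊕-assoc : ∀ p q r → (p ⊕ q) ⊕ r ≋ p ⊕ (q ⊕ r)
  ⊕-assoc p q r = coeffs λ i → begin
    ((p ⊕ q) ⊕ r) ! i         ≈⟨ trans (⊕-! (p ⊕ q) r i) (+-congʳ (⊕-! p q i)) ⟩
    p ! i + q ! i + r ! i     ≈⟨ +-assoc _ _ _ ⟩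
    p ! i + (q ! i + r ! i)   ≈⟨ trans (⊕-! p (q ⊕ r) i) (+-congˡ (⊕-! q r i)) ⟨
    (p ⊕ (q ⊕ r)) ! i         ∎
    where open ≈-Reasoning

  ⊕-comm : ∀ p q → p ⊕ q ≋ q ⊕ p
  ⊕-comm p q = coeffs λ i → trans (⊕-! p q i) (trans (+-comm _ _) (sym (⊕-! q p i)))

  ⊕-identityʳ : ∀ p → p ⊕ [] ≋ p
  ⊕-identityʳ p = coeffs λ i → trans (⊕-! p [] i) (+-identityʳ _)

  ⊖-inverseˡ : ∀ p → ⊖ p ⊕ p ≋ []
  ⊖-inverseˡ p = coeffs λ i →
    trans (⊕-! (⊖ p) p i) (trans (+-congʳ (⊖-! p i)) (-‿inverseˡ _))

  ⊖-inverseʳ : ∀ p → p ⊕ ⊖ p ≋ []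
  ⊖-inverseʳ p = ≋-trans (⊕-comm p (⊖ p)) (⊖-inverseˡ p)

  0·≋ : ∀ p → 0# · p ≋ []
  0·≋ p = coeffs λ i → trans (·-! 0# p i) (zeroˡ _)

  1·≋ : ∀ p → 1# · p ≋ p
  1·≋ p = coeffs λ i → trans (·-! 1# p i) (*-identityˡ _)

  ·-distribˡ : ∀ a p q → a · (p ⊕ q) ≋ a · p ⊕ a · q
  ·-distribˡ a p q = coeffs λ i → begin
    (a · (p ⊕ q)) ! i         ≈⟨ trans (·-! a (p ⊕ q) i) (*-congˡ (⊕-! p q i)) ⟩
    a * (p ! i + q ! i)       ≈⟨ distribˡ _ _ _ ⟩
    a * p ! i + a * q ! i     ≈⟨ trans (⊕-! (a · p) (a · q) i) (+-cong (·-! a p i) (·-! a q i)) ⟨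
    (a · p ⊕ a · q) ! i       ∎
    where open ≈-Reasoning

  ·-distribʳ : ∀ a b p → (a + b) · p ≋ a · p ⊕ b · p
  ·-distribʳ a b p = coeffs λ i → begin
    ((a + b) · p) ! i         ≈⟨ ·-! (a + b) p i ⟩
    (a + b) * p ! i           ≈⟨ distribʳ _ _ _ ⟩
    a * p ! i + b * p ! i     ≈⟨ trans (⊕-! (a · p) (b · p) i) (+-cong (·-! a p i) (·-! b p i)) ⟨
    (a · p ⊕ b · p) ! i       ∎
    where open ≈-Reasoning

  ·-assoc : ∀ a b p → (a * b) · p ≋ a · (b · p)
  ·-assoc a b p = coeffs λ i → begin
    ((a * b) · p) ! i         ≈⟨ ·-! (a * b) p i ⟩
    a * b * p ! i             ≈⟨ *-assoc _ _ _ ⟩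
    a * (b * p ! i)           ≈⟨ trans (·-! a (b · p) i) (*-congˡ (·-! b p i)) ⟨
    (a · (b · p)) ! i         ∎
    where open ≈-Reasoning

  ⊕-interchange : ∀ p q r s → (p ⊕ q) ⊕ (r ⊕ s) ≋ (p ⊕ r) ⊕ (q ⊕ s)
  ⊕-interchange p q r s = coeffs λ i → begin
    ((p ⊕ q) ⊕ (r ⊕ s)) ! i
      ≈⟨ trans (⊕-! (p ⊕ q) (r ⊕ s) i) (+-cong (⊕-! p q i) (⊕-! r s i)) ⟩
    (p ! i + q ! i) + (r ! i + s ! i)
      ≈⟨ solve 4 (λ a b c d → (a :+ b) :+ (c :+ d) := (a :+ c) :+ (b :+ d)) refl _ _ _ _ ⟩
    (p ! i + r ! i) + (q ! i + s ! i)
      ≈⟨ trans (⊕-! (p ⊕ r) (q ⊕ s) i) (+-cong (⊕-! p r i) (⊕-! q s i)) ⟨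
    ((p ⊕ r) ⊕ (q ⊕ s)) ! i ∎
    where open ≈-Reasoning

  0∷-⊕ : ∀ p q → 0# ∷ p ⊕ q ≋ (0# ∷ p) ⊕ (0# ∷ q)
  0∷-⊕ p q = coeffs λ { zero → sym (+-identityˡ 0#) ; (suc i) → refl }

  ·-0∷ : ∀ a p → a · (0# ∷ p) ≋ 0# ∷ a · p
  ·-0∷ a p = coeffs λ { zero → zeroʳ a ; (suc i) → refl }

  ⊗-zeroʳ : ∀ p → p ⊗ [] ≋ []
  ⊗-zeroʳ []      = ≋-refl
  ⊗-zeroʳ (a ∷ p) = ≋-trans (∷-cong refl (⊗-zeroʳ p)) 0∷[]

  ⊗-congˡ : ∀ {p q q′} → q ≋ q′ → p ⊗ q ≋ p ⊗ q′
  ⊗-congˡ {[]}    e = ≋-refl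
  ⊗-congˡ {a ∷ p} e = ⊕-cong (·-cong refl e) (∷-cong refl (⊗-congˡ {p} e))

  ⊗-∷ʳ : ∀ p b q → p ⊗ (b ∷ q) ≋ b · p ⊕ (0# ∷ p ⊗ q)
  ⊗-∷ʳ []      b q = ≋-sym 0∷[]
  ⊗-∷ʳ (a ∷ p) b q = ∷-cong (+-congʳ (*-comm a b)) (begin
    a · q ⊕ p ⊗ (b ∷ q)             ≈⟨ ⊕-congˡ (⊗-∷ʳ p b q) ⟩
    a · q ⊕ (b · p ⊕ (0# ∷ p ⊗ q))  ≈⟨ ⊕-assoc (a · q) (b · p) _ ⟨
    (a · q ⊕ b · p) ⊕ (0# ∷ p ⊗ q)  ≈⟨ ⊕-congʳ (⊕-comm (a · q) (b · p)) ⟩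
    (b · p ⊕ a · q) ⊕ (0# ∷ p ⊗ q)  ≈⟨ ⊕-assoc (b · p) (a · q) _ ⟩
    b · p ⊕ (a · q ⊕ (0# ∷ p ⊗ q))  ∎)
    where open ≋-Reasoning

  ⊗-comm : ∀ p q → p ⊗ q ≋ q ⊗ p
  ⊗-comm []      q = ≋-sym (⊗-zeroʳ q)
  ⊗-comm (a ∷ p) q =
    ≋-trans (⊕-congˡ (∷-cong refl (⊗-comm p q))) (≋-sym (⊗-∷ʳ q a p))

  ⊗-congʳ : ∀ {p p′ q} → p ≋ p′ → p ⊗ q ≋ p′ ⊗ q
  ⊗-congʳ {p} {p′} {q} e =
    ≋-trans (⊗-comm p q) (≋-trans (⊗-congˡ {q} e) (⊗-comm q p′))

  ⊗-cong : ∀ {p p′ q q′} → p ≋ p′ → q ≋ q′ → p ⊗ q ≋ p′ ⊗ q′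
  ⊗-cong {p} e f = ≋-trans (⊗-congˡ {p} f) (⊗-congʳ e)

  ·-⊗ : ∀ a p q → (a · p) ⊗ q ≋ a · (p ⊗ q)
  ·-⊗ a []      q = ≋-refl
  ·-⊗ a (b ∷ p) q = begin
    (a * b) · q ⊕ (0# ∷ (a · p) ⊗ q)   ≈⟨ ⊕-cong (·-assoc a b q) (∷-cong refl (·-⊗ a p q)) ⟩
    a · (b · q) ⊕ (0# ∷ a · (p ⊗ q))   ≈⟨ ⊕-congˡ (·-0∷ a (p ⊗ q)) ⟨
    a · (b · q) ⊕ a · (0# ∷ p ⊗ q)     ≈⟨ ·-distribˡ a (b · q) (0# ∷ p ⊗ q) ⟨
    a · (b · q ⊕ (0# ∷ p ⊗ q))         ∎
    where open ≋-Reasoning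

  0∷-⊗ : ∀ p q → (0# ∷ p) ⊗ q ≋ 0# ∷ p ⊗ q
  0∷-⊗ p q = ⊕-congʳ (0·≋ q)

  ⊗-distribʳ : ∀ r p q → (p ⊕ q) ⊗ r ≋ p ⊗ r ⊕ q ⊗ r
  ⊗-distribʳ r []      q       = ≋-refl
  ⊗-distribʳ r (a ∷ p) []      = ≋-sym (⊕-identityʳ ((a ∷ p) ⊗ r))
  ⊗-distribʳ r (a ∷ p) (b ∷ q) = begin
    (a + b) · r ⊕ (0# ∷ (p ⊕ q) ⊗ r)
      ≈⟨ ⊕-cong (·-distribʳ a b r) (∷-cong refl (⊗-distribʳ r p q)) ⟩
    (a · r ⊕ b · r) ⊕ (0# ∷ p ⊗ r ⊕ q ⊗ r)
      ≈⟨ ⊕-congˡ (0∷-⊕ (p ⊗ r) (q ⊗ r)) ⟩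
    (a · r ⊕ b · r) ⊕ ((0# ∷ p ⊗ r) ⊕ (0# ∷ q ⊗ r))
      ≈⟨ ⊕-interchange (a · r) (b · r) (0# ∷ p ⊗ r) (0# ∷ q ⊗ r) ⟩
    (a ∷ p) ⊗ r ⊕ (b ∷ q) ⊗ r ∎
    where open ≋-Reasoning

  ⊗-distribˡ : ∀ r p q → r ⊗ (p ⊕ q) ≋ r ⊗ p ⊕ r ⊗ q
  ⊗-distribˡ r p q =
    ≋-trans (⊗-comm r (p ⊕ q))
      (≋-trans (⊗-distribʳ r p q) (⊕-cong (⊗-comm p r) (⊗-comm q r)))

  ⊗-assoc : ∀ p q r → (p ⊗ q) ⊗ r ≋ p ⊗ (q ⊗ r)
  ⊗-assoc []      q r = ≋-refl
  ⊗-assoc (a ∷ p) q r =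
    ≋-trans (⊗-distribʳ r (a · q) (0# ∷ p ⊗ q))
      (⊕-cong (·-⊗ a q r) (≋-trans (0∷-⊗ (p ⊗ q) r) (∷-cong refl (⊗-assoc p q r))))

  ⊗-identityˡ : ∀ p → 1ₚ ⊗ p ≋ p
  ⊗-identityˡ p = ≋-trans (⊕-cong (1·≋ p) 0∷[]) (⊕-identityʳ p)

  ⊗-identityʳ : ∀ p → p ⊗ 1ₚ ≋ p
  ⊗-identityʳ p = ≋-trans (⊗-comm p 1ₚ) (⊗-identityˡ p)

  polyRing : CommutativeRing c ℓ
  polyRing = record
    { Carrier = Poly ; _≈_ = _≋_ ; _+_ = _⊕_ ; _*_ = _⊗_ ; -_ = ⊖_ ; 0# = [] ; 1# = 1ₚ
    ; isCommutativeRing = record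
      { isRing = record
        { +-isAbelianGroup = record
          { isGroup = record
            { isMonoid = record
              { isSemigroup = record
                { isMagma = record
                  { isEquivalence = Setoid.isEquivalence polySetoid
                  ; ∙-cong = ⊕-cong }
                ; assoc = ⊕-assoc }
              ; identity = (λ _ → ≋-refl) , ⊕-identityʳ }
            ; inverse = ⊖-inverseˡ , ⊖-inverseʳ
            ; ⁻¹-cong = ⊖-cong }
          ; comm = ⊕-comm }
        ; *-cong = ⊗-cong
        ; *-assoc = ⊗-assoc
        ; *-identity = ⊗-identityˡ , ⊗-identityʳ
        ; distrib = ⊗-distribˡ , ⊗-distribʳ }
      ; *-comm = ⊗-comm } }

  -- Only upper bounds for degrees are available: over a general ring it is undecidable which
  -- coefficient is the last nonzero one.
  record Deg< (p : Poly) (n : ℕ) : Set ℓ where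
    constructor vanish
    field beyond : ∀ i → n ℕ.≤ i → p ! i ≈ 0#
  open Deg< public

  Deg≤ : Poly → ℕ → Set ℓ
  Deg≤ p n = Deg< p (suc n)

  Deg≤⇒< : ∀ {p n} → Deg≤ p n → p ! n ≈ 0# → Deg< p n
  Deg≤⇒< {p} {n} d e = vanish λ i n≤i → case i (ℕₚ.m≤n⇒m<n∨m≡n n≤i)
    where
    case : ∀ i → n ℕ.< i ⊎ n ≡.≡ i → p ! i ≈ 0#
    case i (inj₁ n<i)    = beyond d i n<i
    case i (inj₂ ≡.refl) = e

  Deg<-0⇒≋[] : ∀ {p} → Deg< p 0 → p ≋ []
  Deg<-0⇒≋[] d = coeffs λ i → beyond d i z≤n

  Deg<-length : ∀ p → Deg< p (length p)
  Deg<-length []      = vanish λ _ _ → refl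
  Deg<-length (a ∷ p) = vanish λ { (suc i) (s≤s len) → beyond (Deg<-length p) i len }

  Deg<-≋ : ∀ {p q n} → p ≋ q → Deg< p n → Deg< q n
  Deg<-≋ e d = vanish λ i n≤i → trans (sym (at e i)) (beyond d i n≤i)

  Deg<-mono : ∀ {p m n} → m ℕ.≤ n → Deg< p m → Deg< p n
  Deg<-mono m≤n d = vanish λ i n≤i → beyond d i (ℕₚ.≤-trans m≤n n≤i)

  Deg<-⊕ : ∀ {p q n} → Deg< p n → Deg< q n → Deg< (p ⊕ q) n
  Deg<-⊕ {p} {q} d e = vanish λ i n≤i →
    trans (⊕-! p q i) (trans (+-cong (beyond d i n≤i) (beyond e i n≤i)) (+-identityˡ 0#))

  Deg<-· : ∀ {a p n} → Deg< p n → Deg< (a · p) n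
  Deg<-· {a} {p} d = vanish λ i n≤i →
    trans (·-! a p i) (trans (*-congˡ (beyond d i n≤i)) (zeroʳ a))

  Deg<-⊖ : ∀ {p n} → Deg< p n → Deg< (⊖ p) n
  Deg<-⊖ {p} d = vanish λ i n≤i →
    trans (⊖-! p i) (trans (-‿cong (beyond d i n≤i)) -0#≈0#)

  Deg<-tail : ∀ {a p n} → Deg< (a ∷ p) (suc n) → Deg< p n
  Deg<-tail d = vanish λ i n≤i → beyond d (suc i) (s≤s n≤i)

  Deg<-∷ : ∀ {a p n} → Deg< p n → Deg< (a ∷ p) (suc n)
  Deg<-∷ d = vanish λ { (suc i) (s≤s n≤i) → beyond d i n≤i }

  const-⊗ : ∀ {a p} q → p ≋ [] → (a ∷ p) ⊗ q ≋ a · q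
  const-⊗ {a} q e =
    ≋-trans (⊕-congˡ (≋-trans (∷-cong refl (⊗-congʳ {q = q} e)) 0∷[])) (⊕-identityʳ (a · q))

  tail≋[] : ∀ {a p} → Deg≤ (a ∷ p) 0 → p ≋ []
  tail≋[] d = Deg<-0⇒≋[] (Deg<-tail d)

  Deg≤-⊗ : ∀ p {q m n} → Deg≤ p m → Deg≤ q n → Deg≤ (p ⊗ q) (m ℕ.+ n)
  Deg≤-⊗ []      d e = vanish λ i _ → refl
  Deg≤-⊗ (a ∷ p) {q} {zero}      d e = Deg<-≋ (≋-sym (const-⊗ q (tail≋[] d))) (Deg<-· e)
  Deg≤-⊗ (a ∷ p) {q} {suc m} {n} d e =
    Deg<-⊕ (Deg<-mono (s≤s (ℕₚ.m≤n+m n (suc m))) (Deg<-· e))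
      (Deg<-∷ (Deg≤-⊗ p (Deg<-tail d) e))

  leading-⊗ : ∀ p {q} m {n} → Deg≤ p m → Deg≤ q n → (p ⊗ q) ! (m ℕ.+ n) ≈ p ! m * q ! n
  leading-⊗ []      {q} m {n} d e = sym (zeroˡ (q ! n))
  leading-⊗ (a ∷ p) {q} zero {n} d e =
    trans (at (const-⊗ q (tail≋[] d)) n) (·-! a q n)
  leading-⊗ (a ∷ p) {q} (suc m) {n} d e = begin
    (a · q ⊕ (0# ∷ p ⊗ q)) ! suc (m ℕ.+ n)
      ≈⟨ ⊕-! (a · q) (0# ∷ p ⊗ q) (suc (m ℕ.+ n)) ⟩
    (a · q) ! suc (m ℕ.+ n) + (p ⊗ q) ! (m ℕ.+ n)
      ≈⟨ +-cong (beyond (Deg<-· {a} {q} e) _ (s≤s (ℕₚ.m≤n+m n m))) (leading-⊗ p m (Deg<-tail d) e) ⟩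
    0# + p ! m * q ! n
      ≈⟨ +-identityˡ _ ⟩
    p ! m * q ! n ∎
    where open ≈-Reasoning

  -- (0# ∷ p) ! n is the coefficient below the n-th, read as 0 when n = 0.
  subleading-⊗ : ∀ p {q} m {n} → Deg≤ p m → Deg≤ q n →
    (0# ∷ p ⊗ q) ! (m ℕ.+ n) ≈ p ! m * (0# ∷ q) ! n + (0# ∷ p) ! m * q ! n
  subleading-⊗ [] {q} m {n} d e = begin
    (0# ∷ []) ! (m ℕ.+ n)             ≈⟨ at 0∷[] (m ℕ.+ n) ⟩
    0#                                ≈⟨ +-identityˡ 0# ⟨
    0# + 0#                           ≈⟨ +-cong (zeroˡ _) (trans (*-congʳ (at 0∷[] m)) (zeroˡ _)) ⟨
    0# * (0# ∷ q) ! n + (0# ∷ []) ! m * q ! n ∎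
    where open ≈-Reasoning
  subleading-⊗ (a ∷ p) {q} zero {n} d e = begin
    (0# ∷ (a ∷ p) ⊗ q) ! n            ≈⟨ at (∷-cong refl (const-⊗ q (tail≋[] d))) n ⟩
    (0# ∷ a · q) ! n                  ≈⟨ at (·-0∷ a q) n ⟨
    (a · (0# ∷ q)) ! n                ≈⟨ ·-! a (0# ∷ q) n ⟩
    a * (0# ∷ q) ! n                  ≈⟨ +-identityʳ _ ⟨
    a * (0# ∷ q) ! n + 0#             ≈⟨ +-congˡ (zeroˡ _) ⟨
    a * (0# ∷ q) ! n + 0# * q ! n     ∎
    where open ≈-Reasoning
  subleading-⊗ (a ∷ p) {q} (suc m) {n} d e = begin
    (a · q ⊕ (0# ∷ p ⊗ q)) ! (m ℕ.+ n)
      ≈⟨ ⊕-! (a · q) (0# ∷ p ⊗ q) (m ℕ.+ n) ⟩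
    (a · q) ! (m ℕ.+ n) + (0# ∷ p ⊗ q) ! (m ℕ.+ n)
      ≈⟨ +-congˡ (subleading-⊗ p m (Deg<-tail d) e) ⟩
    (a · q) ! (m ℕ.+ n) + (p ! m * (0# ∷ q) ! n + (0# ∷ p) ! m * q ! n)
      ≈⟨ solve 3 (λ x y z → x :+ (y :+ z) := y :+ (x :+ z)) refl _ _ _ ⟩
    p ! m * (0# ∷ q) ! n + ((a · q) ! (m ℕ.+ n) + (0# ∷ p) ! m * q ! n)
      ≈⟨ +-congˡ (head-term m) ⟩
    p ! m * (0# ∷ q) ! n + (a ∷ p) ! m * q ! n ∎
    where
    open ≈-Reasoning
    head-term : ∀ m → (a · q) ! (m ℕ.+ n) + (0# ∷ p) ! m * q ! n ≈ (a ∷ p) ! m * q ! n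
    head-term zero    = trans (+-cong (·-! a q n) (zeroˡ _)) (+-identityʳ _)
    head-term (suc m) =
      trans (+-congʳ (beyond (Deg<-· {a} {q} e) _ (s≤s (ℕₚ.m≤n+m n m)))) (+-identityˡ _)

  -- C collects the powers of the leading coefficient by which p gets multiplied.
  pseudo-division : ∀ {c′} (C : Carrier → Set c′) q m → C 1# → (∀ {x} → C x → C (q ! m * x)) →
    Deg≤ q m → ∀ p → ∃[ x ] ∃[ s ] ∃[ r ] C x × (x · p ≋ q ⊗ s ⊕ r) × Deg< r m
  pseudo-division C q m C1 C* d [] =
    1# , [] , [] , C1 , ≋-sym (≋-trans (⊕-identityʳ _) (⊗-zeroʳ q)) , vanish λ _ _ → refl
  pseudo-division C q m C1 C* d (a ∷ p) with pseudo-division C q m C1 C* d p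
  ... | x , s , r , Cx , eq , d′ = l * x , t ∷ l · s , r′ , C* Cx , eq′ , d″
    where
    open ≋-Reasoning
    l  = q ! m
    -- Modulo q, the polynomial x (a + X p) is x a + X r, which is `u`, of degree at most m.
    -- Subtracting t q from l u removes the coefficient of Xᵐ.
    u  = x * a ∷ r
    t  = u ! m
    r′ = l · u ⊕ ⊖ (t · q)
    du : Deg≤ u m
    du = Deg<-∷ d′
    d″ : Deg< r′ m
    d″ = Deg≤⇒< (Deg<-⊕ (Deg<-· du) (Deg<-⊖ (Deg<-· d)))
      (trans (⊕-! (l · u) (⊖ (t · q)) m)
        (trans (+-cong (·-! l u m)
          (trans (⊖-! (t · q) m) (-‿cong (trans (·-! t q m) (*-comm t l)))))
          (-‿inverseʳ (l * t))))
    eq′ : (l * x) · (a ∷ p) ≋ q ⊗ (t ∷ l · s) ⊕ r′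
    eq′ = begin
      (l * x) · (a ∷ p)
        ≈⟨ ·-assoc l x (a ∷ p) ⟩
      l · (x * a ∷ x · p)
        ≈⟨ ·-cong refl (∷-cong (sym (+-identityʳ _)) (≋-trans eq (⊕-comm (q ⊗ s) r))) ⟩
      l · (u ⊕ (0# ∷ q ⊗ s))
        ≈⟨ ·-distribˡ l u (0# ∷ q ⊗ s) ⟩
      l · u ⊕ l · (0# ∷ q ⊗ s)
        ≈⟨ ⊕-cong {l · u ⊕ []} {l · u} (⊕-identityʳ (l · u)) (≋-trans (∷-cong refl (scale-⊗ l s)) (≋-sym (·-0∷ l (q ⊗ s)))) ⟨
      (l · u ⊕ []) ⊕ (0# ∷ q ⊗ (l · s))
        ≈⟨ ⊕-congʳ (⊕-congˡ {l · u} (⊖-inverseˡ (t · q))) ⟨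
      (l · u ⊕ (⊖ (t · q) ⊕ t · q)) ⊕ (0# ∷ q ⊗ (l · s))
        ≈⟨ ⊕-congʳ (⊕-assoc (l · u) (⊖ (t · q)) (t · q)) ⟨
      (r′ ⊕ t · q) ⊕ (0# ∷ q ⊗ (l · s))
        ≈⟨ ⊕-assoc r′ (t · q) _ ⟩
      r′ ⊕ (t · q ⊕ (0# ∷ q ⊗ (l · s)))
        ≈⟨ ⊕-congˡ (⊗-∷ʳ q t (l · s)) ⟨
      r′ ⊕ q ⊗ (t ∷ l · s)
        ≈⟨ ⊕-comm r′ _ ⟩
      q ⊗ (t ∷ l · s) ⊕ r′ ∎
      where
      scale-⊗ : ∀ l s → q ⊗ (l · s) ≋ l · (q ⊗ s)
      scale-⊗ l s = ≋-trans (⊗-comm q (l · s)) (≋-trans (·-⊗ l s q) (·-cong refl (⊗-comm s q)))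

  -- Cofactors have the expected degree when the leading coefficient is regular.
  cofactor-Deg≤ : ∀ {q s m n} → (∀ x → q ! m * x ≈ 0# → x ≈ 0#) → Deg≤ q m →
    Deg≤ (q ⊗ s) (m ℕ.+ n) → Deg≤ s n
  cofactor-Deg≤ {q} {s} {m} {n} reg d e =
    descend (length s) (Deg<-mono (ℕₚ.≤-trans (ℕₚ.m≤n+m _ n) (ℕₚ.n≤1+n _)) (Deg<-length s))
    where
    descend : ∀ k → Deg≤ s (n ℕ.+ k) → Deg≤ s n
    descend zero    f = Deg<-mono (s≤s (ℕₚ.≤-reflexive (ℕₚ.+-identityʳ n))) f
    descend (suc k) f = descend k (Deg<-mono (ℕₚ.≤-reflexive (ℕₚ.+-suc n k))
      (Deg≤⇒< f (reg _ (trans (sym (leading-⊗ q m d f))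
        (beyond e _ (ℕₚ.+-monoʳ-< m (ℕₚ.m<m+n n (s≤s z≤n))))))))

-- Monic polynomials with known zeros: factorisation and Viète

module Factorisations where

  open import Algebra using (CommutativeRing; IsCommutativeRing; Op₁; Op₂)
  open import Data.Vec using (Vec; []; _∷_; map; last; foldr′)
  open import Relation.Binary.Core using (Rel)
  open import Relation.Binary.PropositionalEquality using (_≡_)

  -- The operations and the evaluation are separate parameters, so that instances
  -- mention the given ones syntactically: conversion checks that unfold complex
  -- arithmetic are infeasible.
  module Factorisation {a ℓ} {Carrier : Set a} {_≋_ : Rel Carrier ℓ} {add mul : Op₂ Carrier} {neg : Op₁ Carrier}
    {0# 1# : Carrier} (isCommutativeRing : IsCommutativeRing _≋_ add mul neg 0# 1#)
    (sub : Op₂ Carrier) (sub≋ : ∀ x y → sub x y ≋ add x (neg y))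
    (eval : ∀ {n} → Vec Carrier n → Carrier → Carrier)
    (eval-[] : ∀ z → eval [] z ≡ 1#)
    (eval-∷ : ∀ {n} a (as : Vec Carrier n) z → eval (a ∷ as) z ≡ add a (mul z (eval as z))) where

    open import Data.Product using (_×_; _,_)
    open import Data.Unit.Polymorphic using (⊤)
    open import Data.Nat using (suc)
    open import Data.Vec.Relation.Unary.All using (All; []; _∷_)
    open import Level using (_⊔_)
    private
      R : CommutativeRing a ℓ
      R = record { isCommutativeRing = isCommutativeRing }
    open CommutativeRing R hiding (Carrier; isCommutativeRing; 0#; 1#)
    open import Relation.Binary.Reasoning.Setoid setoid
    open import Algebra.Solver.Ring.NaturalCoefficients.Default commutativeSemiring
      using (solve; _:=_; _:+_; _:*_)

    eval-[_] : ∀ a z → eval (a ∷ []) z ≈ a + z * 1#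
    eval-[ a ] z = trans (reflexive (eval-∷ a [] z)) (+-congˡ (*-congˡ (reflexive (eval-[] z))))

    -- Takes the place of "u is nonzero" in a ring without decidable equality: what splitting off
    -- zeros uses is that a factor can be cancelled.
    Regular : Carrier → Set (a ⊔ ℓ)
    Regular u = ∀ v → mul u v ≈ 0# → v ≈ 0#

    -- Synthetic division by X - z: the coefficients are the values at z of the successive tails.
    -- The empty tail gives the leading 1, which stays implicit.
    quotient : ∀ {n} → Vec Carrier (suc n) → Carrier → Vec Carrier n
    quotient (a ∷ [])         z = []
    quotient (a ∷ as@(_ ∷ _)) z = eval as z ∷ quotient as z

    regroup : ∀ x z → x ≈ (x - z) + z
    regroup x z = sym (trans (+-assoc x (- z) z) (trans (+-congˡ (-‿inverseˡ z)) (+-identityʳ x)))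

    remainder : ∀ {n} (as : Vec Carrier (suc n)) z x →
      eval as x ≈ (x - z) * eval (quotient as z) x + eval as z
    remainder (a ∷ []) z x = begin
      eval (a ∷ []) x                      ≈⟨ eval-[ a ] x ⟩
      a + x * 1#                            ≈⟨ +-congˡ (*-congʳ (regroup x z)) ⟩
      a + ((x - z) + z) * 1#              ≈⟨ solve 4 (λ a d z u → a :+ (d :+ z) :* u := d :* u :+ (a :+ z :* u)) refl a (x - z) z 1# ⟩
      (x - z) * 1# + (a + z * 1#)        ≈⟨ +-cong (*-congˡ (reflexive (eval-[] x))) (eval-[ a ] z) ⟨
      (x - z) * eval [] x + eval (a ∷ []) z ∎
    remainder (a ∷ as@(_ ∷ _)) z x = begin
      eval (a ∷ as) x
        ≈⟨ reflexive (eval-∷ a as x) ⟩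
      a + x * eval as x
        ≈⟨ +-congˡ (*-congˡ (remainder as z x)) ⟩
      a + x * (d * q + c)
        ≈⟨ solve 5 (λ a x d q c → a :+ x :* (d :* q :+ c) := a :+ (x :* c :+ d :* (x :* q))) refl a x d q c ⟩
      a + (x * c + d * (x * q))
        ≈⟨ +-congˡ (+-congʳ (*-congʳ (regroup x z))) ⟩
      a + ((d + z) * c + d * (x * q))
        ≈⟨ solve 5 (λ a z d r c → a :+ ((d :+ z) :* c :+ d :* r) := d :* (c :+ r) :+ (a :+ z :* c)) refl a z d (x * q) c ⟩
      d * (c + x * q) + (a + z * c)
        ≈⟨ +-cong (*-congˡ (reflexive (eval-∷ c (quotient as z) x))) (reflexive (eval-∷ a as z)) ⟨
      d * eval (c ∷ quotient as z) x + eval (a ∷ as) z ∎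
      where
      d = x - z
      q = eval (quotient as z) x
      c = eval as z

    quotient-zero : ∀ {n} (as : Vec Carrier (suc n)) z x → Regular (sub x z) →
      eval as z ≈ 0# → eval as x ≈ 0# → eval (quotient as z) x ≈ 0#
    quotient-zero as z x reg az≈0 ax≈0 = reg (eval (quotient as z) x) (begin
      sub x z * q                  ≈⟨ *-congʳ (sub≋ x z) ⟩
      (x - z) * q                  ≈⟨ +-identityʳ _ ⟨
      (x - z) * q + 0#            ≈⟨ +-congˡ az≈0 ⟨
      (x - z) * q + eval as z     ≈⟨ remainder as z x ⟨
      eval as x                      ≈⟨ ax≈0 ⟩
      0#                             ∎)
      where q = eval (quotient as z) x

    last-quotient : ∀ {n} (as : Vec Carrier (suc (suc n))) z → last (quotient as z) ≈ last as + z
    last-quotient (a ∷ b ∷ [])         z = trans (eval-[ b ] z) (+-congˡ (*-identityʳ z))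
    last-quotient (a ∷ as@(_ ∷ _ ∷ _)) z = last-quotient as z

    Distinct : ∀ {n} → Vec Carrier n → Set (a ⊔ ℓ)
    Distinct []       = ⊤
    Distinct (z ∷ zs) = All (λ w → Regular (sub w z)) zs × Distinct zs

    Zeros : ∀ {m n} → Vec Carrier m → Vec Carrier n → Set (a ⊔ ℓ)
    Zeros as = All (λ z → eval as z ≈ 0#)

    quotient-zeros : ∀ {m n} (as : Vec Carrier (suc m)) z (zs : Vec Carrier n) → eval as z ≈ 0# →
      All (λ w → Regular (sub w z)) zs → Zeros as zs → Zeros (quotient as z) zs
    quotient-zeros as z []       e []       []       = []
    quotient-zeros as z (w ∷ zs) e (r ∷ rs) (f ∷ fs) =
      quotient-zero as z w r e f ∷ quotient-zeros as z zs e rs fs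

    -- Zeros are split off one at a time; since the differences are regular, the remaining ones stay
    -- zeros of the quotient.
    factorisation : ∀ {n} (as zs : Vec Carrier n) → Zeros as zs → Distinct zs →
      ∀ x → eval as x ≈ foldr′ mul 1# (map (sub x) zs)
    factorisation []       []       []       _        x = reflexive (eval-[] x)
    factorisation (a ∷ as) (z ∷ zs) (e ∷ es) (r , d) x = begin
      eval (a ∷ as) x                               ≈⟨ remainder (a ∷ as) z x ⟩
      (x - z) * eval q x + eval (a ∷ as) z       ≈⟨ +-congˡ e ⟩
      (x - z) * eval q x + 0#                    ≈⟨ +-identityʳ _ ⟩
      (x - z) * eval q x                          ≈⟨ *-cong (sym (sub≋ x z)) (factorisation q zs (quotient-zeros (a ∷ as) z zs e r es) d x) ⟩
      sub x z * foldr′ mul 1# (map (sub x) zs)      ∎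
      where q = quotient (a ∷ as) z

    -- Dividing by X - z adds z to the second highest coefficient and takes z off the list, so the
    -- sum of the two is invariant.
    sum-of-zeros : ∀ {n} (as zs : Vec Carrier (suc n)) → Zeros as zs → Distinct zs → add (last as) (foldr′ add 0# zs) ≈ 0#
    sum-of-zeros (a ∷ [])         (z ∷ [])           (e ∷ [])       _       = trans
      (+-congˡ (trans (+-identityʳ z) (sym (*-identityʳ z)))) (trans (sym (eval-[ a ] z)) e)
    sum-of-zeros (a ∷ as@(_ ∷ _)) (z ∷ zs@(_ ∷ _)) (e ∷ es) (r , d) = begin
      last as + (z + foldr′ add 0# zs)     ≈⟨ +-assoc (last as) z (foldr′ add 0# zs) ⟨
      (last as + z) + foldr′ add 0# zs     ≈⟨ +-congʳ (last-quotient (a ∷ as) z) ⟨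
      last q + foldr′ add 0# zs             ≈⟨ sum-of-zeros q zs (quotient-zeros (a ∷ as) z zs e r es) d ⟩
      0#                          ∎
      where q = quotient (a ∷ as) z

-- Arithmetic over the field with two elements, and irreducibility by trial division

module BinaryPolynomials where

  open import Data.Bool using (Bool; true; false; not; _∧_; _∨_)
  open import Data.Bool.Properties using (xor-∧-commutativeRing; xor-same; xor-identityʳ)
  open import Data.Empty using (⊥-elim)
  open import Data.Integer using (+_)
  open import Data.List using ([]; _∷_; length)
  open import Data.Nat as ℕ using (ℕ; zero; suc; s≤s; _≤_; _<_)
  import Data.Nat.Properties as ℕₚ
  open import Data.Nat.Induction using (<-rec)
  open import Data.Product using (_×_; _,_; proj₁; proj₂; ∃-syntax)
  open import Data.Sum using (_⊎_; inj₁; inj₂)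
  open import Relation.Binary.PropositionalEquality using (_≡_; refl; sym; trans; cong; cong₂; subst)
  open import Relation.Nullary using (¬_; yes; no)

  module 𝔽₂ where
    open Polynomials xor-∧-commutativeRing public

    -- n steps of the division of p by 1 ∷ d, from the constant coefficient upwards.
    eliminate : ℕ → Poly → Poly → Poly
    eliminate zero    d p           = p
    eliminate (suc n) d []          = []
    eliminate (suc n) d (true ∷ p)  = eliminate n d (p ⊕ d)
    eliminate (suc n) d (false ∷ p) = eliminate n d p

    isZero : Poly → Bool
    isZero []          = true
    isZero (true ∷ p)  = false
    isZero (false ∷ p) = isZero p

    allOfLength : ℕ → (Poly → Bool) → Bool
    allOfLength zero    P = P []
    allOfLength (suc n) P = allOfLength n (λ d → P (false ∷ d)) ∧ allOfLength n (λ d → P (true ∷ d))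

    ∧-true : ∀ {a b} → a ∧ b ≡ true → a ≡ true × b ≡ true
    ∧-true {true} {true} _ = refl , refl

    allOfLength-sound : ∀ n P → allOfLength n P ≡ true → ∀ d → length d ≡ n → P d ≡ true
    allOfLength-sound zero    P h []          _ = h
    allOfLength-sound (suc n) P h (false ∷ d) l =
      allOfLength-sound n _ (proj₁ (∧-true h)) d (ℕₚ.suc-injective l)
    allOfLength-sound (suc n) P h (true ∷ d)  l =
      allOfLength-sound n _ (proj₂ (∧-true {allOfLength n _} h)) d (ℕₚ.suc-injective l)

    isZero-complete : ∀ {p} → p ≋ [] → isZero p ≡ true
    isZero-complete {[]}        e = refl
    isZero-complete {true ∷ p}  e with () ← at e 0
    isZero-complete {false ∷ p} e = isZero-complete {p} (coeffs λ i → at e (suc i))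

    isZero-sound : ∀ p → isZero p ≡ true → p ≋ []
    isZero-sound []          h = ≋-refl
    isZero-sound (false ∷ p) h = ≋-trans (∷-cong refl (isZero-sound p h)) 0∷[]

    ⊕-self : ∀ p → p ⊕ p ≋ []
    ⊕-self p = coeffs λ i → trans (⊕-! p p i) (xor-same (p ! i))

    ⊕-cancel : ∀ p q → (p ⊕ q) ⊕ q ≋ p
    ⊕-cancel p q = ≋-trans (⊕-assoc p q q) (≋-trans (⊕-congˡ {p} (⊕-self q)) (⊕-identityʳ p))

    eliminate-zero : ∀ n d {p} → p ≋ [] → eliminate n d p ≋ []
    eliminate-zero zero    d               e = e
    eliminate-zero (suc n) d {[]}          e = ≋-refl
    eliminate-zero (suc n) d {false ∷ p}   e = eliminate-zero n d (coeffs λ i → at e (suc i))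
    eliminate-zero (suc n) d {true ∷ p}    e with () ← at e 0

    ⊗-true : ∀ d b s → (true ∷ d) ⊗ (b ∷ s) ≋ b ∷ (b · d ⊕ (true ∷ d) ⊗ s)
    ⊗-true d b s =
      ≋-trans (⊗-∷ʳ (true ∷ d) b s) (∷-cong (trans (xor-identityʳ _) (∧-true′ b)) ≋-refl)
      where
      ∧-true′ : ∀ b → b ∧ true ≡ b
      ∧-true′ true  = refl
      ∧-true′ false = refl

    -- Since the divisor has constant term 1, p and s have the same constant term. One step
    -- subtracts the divisor when that term is 1 and then divides by X, which leaves the divisor
    -- times the tail of s.
    eliminate-multiple : ∀ n d s {p} → length s ≤ n → (true ∷ d) ⊗ s ≋ p → eliminate n d p ≋ []
    eliminate-multiple n d [] _ e = eliminate-zero n d (≋-trans (≋-sym e) (⊗-zeroʳ (true ∷ d)))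
    eliminate-multiple (suc n) d (b ∷ s) {[]} _ e = ≋-refl
    eliminate-multiple (suc n) d (false ∷ s) {false ∷ p} (s≤s l) e =
      eliminate-multiple n d s l
        (≋-trans (≋-sym (⊕-congʳ (0·≋ d))) (tail-cong (≋-trans (≋-sym (⊗-true d false s)) e)))
    eliminate-multiple (suc n) d (true ∷ s) {true ∷ p} (s≤s l) e =
      eliminate-multiple n d s l (≋-sym (begin
        p ⊕ d                                   ≈⟨ ⊕-congʳ (tail-cong (≋-trans (≋-sym e) (⊗-true d true s))) ⟩
        (true · d ⊕ (true ∷ d) ⊗ s) ⊕ d         ≈⟨ ⊕-congʳ (≋-trans (⊕-congʳ (1·≋ d)) (⊕-comm d _)) ⟩
        ((true ∷ d) ⊗ s ⊕ d) ⊕ d                ≈⟨ ⊕-cancel _ d ⟩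
        (true ∷ d) ⊗ s                          ∎))
      where open ≋-Reasoning
    eliminate-multiple (suc n) d (true ∷ s) {false ∷ p} l e
      with () ← at (≋-trans (≋-sym (⊗-true d true s)) e) 0
    eliminate-multiple (suc n) d (false ∷ s) {true ∷ p} l e
      with () ← at (≋-trans (≋-sym (⊗-true d false s)) e) 0

    -- Pads or cuts to exactly n coefficients, the shape over which `allOfLength` searches.
    truncate : ℕ → Poly → Poly
    truncate zero    p       = []
    truncate (suc n) []      = false ∷ truncate n []
    truncate (suc n) (a ∷ p) = a ∷ truncate n p

    truncate-length : ∀ n p → length (truncate n p) ≡ n
    truncate-length zero    p       = refl
    truncate-length (suc n) []      = cong suc (truncate-length n [])
    truncate-length (suc n) (a ∷ p) = cong suc (truncate-length n p)

    truncate-≋ : ∀ n p → Deg< p n → truncate n p ≋ p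
    truncate-≋ zero    p       d = ≋-sym (Deg<-0⇒≋[] d)
    truncate-≋ (suc n) []      d = ≋-trans (∷-cong refl (truncate-≋ n [] (vanish λ _ _ → refl))) 0∷[]
    truncate-≋ (suc n) (a ∷ p) d = ∷-cong refl (truncate-≋ n p (Deg<-tail d))

    record Degree (p : Poly) (n : ℕ) : Set where
      constructor degree
      field
        bound   : Deg≤ p n
        leading : p ! n ≡ true
    open Degree public

    findDegree : ∀ n p → Deg< p n → p ≋ [] ⊎ ∃[ m ] m < n × Degree p m
    findDegree zero    p d = inj₁ (Deg<-0⇒≋[] d)
    findDegree (suc n) p d with p ! n in eq
    ... | true  = inj₂ (n , ℕₚ.≤-refl , degree d eq)
    ... | false with findDegree n p (Deg≤⇒< d eq)
    ...   | inj₁ z             = inj₁ z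
    ...   | inj₂ (m , m<n , h) = inj₂ (m , ℕₚ.m<n⇒m<1+n m<n , h)

    findDegree′ : ∀ p → p ≋ [] ⊎ ∃[ m ] Degree p m
    findDegree′ p with findDegree (length p) p (Deg<-length p)
    ... | inj₁ z           = inj₁ z
    ... | inj₂ (m , _ , h) = inj₂ (m , h)

    Degree-⊗ : ∀ {p q m n} → Degree p m → Degree q n → Degree (p ⊗ q) (m ℕ.+ n)
    Degree-⊗ {p} {m = m} (degree b l) (degree b′ l′) =
      degree (Deg≤-⊗ p b b′) (trans (leading-⊗ p m b b′) (cong₂ _∧_ l l′))

    Degree-≋ : ∀ {p q m} → p ≋ q → Degree p m → Degree q m
    Degree-≋ {m = m} e (degree b l) = degree (Deg<-≋ e b) (trans (sym (at e m)) l)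

    Degree-≤ : ∀ {p m n} → Degree p m → Deg≤ p n → m ≤ n
    Degree-≤ {p} {m} {n} (degree _ l) b with m ℕ.≤? n
    ... | yes m≤n = m≤n
    ... | no  m≰n with () ← trans (sym l) (beyond b m (ℕₚ.≰⇒> m≰n))

    Degree-≢ : ∀ {p m} → Degree p m → ¬ p ≋ []
    Degree-≢ {m = m} (degree _ l) e with () ← trans (sym l) (at e m)

    regular : ∀ {a} → a ≡ true → ∀ x → a ∧ x ≡ false → x ≡ false
    regular refl x e = e

    domain : ∀ p q → p ⊗ q ≋ [] → p ≋ [] ⊎ q ≋ []
    domain p q e with findDegree′ p | findDegree′ q
    ... | inj₁ z       | _            = inj₁ z
    ... | inj₂ _       | inj₁ z       = inj₂ z
    ... | inj₂ (_ , d) | inj₂ (_ , d′) = ⊥-elim (Degree-≢ (Degree-⊗ d d′) e)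

    1ₚ-Degree : Degree 1ₚ 0
    1ₚ-Degree = degree (vanish λ { (suc i) _ → refl }) refl

    Degree-0 : ∀ {p} → Degree p 0 → p ≋ 1ₚ
    Degree-0 {[]}    (degree _ ())
    Degree-0 {a ∷ p} (degree b l) = ∷-cong l (tail≋[] b)

    infix 4 _∣_
    _∣_ : Poly → Poly → Set
    p ∣ q = ∃[ s ] q ≋ p ⊗ s

    ∣-⊕ : ∀ p {q r} → p ∣ q → p ∣ r → p ∣ q ⊕ r
    ∣-⊕ p (s , e) (t , e′) = s ⊕ t , ≋-trans (⊕-cong e e′) (≋-sym (⊗-distribˡ p s t))

    ∣-⊗ : ∀ p {q} r → p ∣ q → p ∣ q ⊗ r
    ∣-⊗ p r (s , e) = s ⊗ r , ≋-trans (⊗-congʳ e) (⊗-assoc p s r)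

    ∣-≋ : ∀ p {q r} → q ≋ r → p ∣ q → p ∣ r
    ∣-≋ p e (s , e′) = s , ≋-trans (≋-sym e) e′

    -- The multiplier of the pseudo-division is built from leading coefficients equal to 1, hence is
    -- 1 itself.
    divide : ∀ q {m} → Degree q m → ∀ p → ∃[ s ] ∃[ r ] (p ≋ q ⊗ s ⊕ r) × Deg< r m
    divide q {m} (degree b l) p
      with pseudo-division (_≡ true) q m refl (λ {x} e → trans (cong (_∧ x) l) e) b p
    ... | true , s , r , refl , e , d = s , r , ≋-trans (≋-sym (1·≋ p)) e , d

    ∤-smaller-degree : ∀ {p q m n} → Degree p n → Degree q m → m < n → ¬ p ∣ q
    ∤-smaller-degree {p} {n = n} dp dq m<n (s , e) with findDegree′ s
    ... | inj₁ z       = Degree-≢ dq (≋-trans e (≋-trans (⊗-congˡ {p} z) (⊗-zeroʳ p)))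
    ... | inj₂ (k , h) = ℕₚ.<⇒≱ m<n (ℕₚ.≤-trans (ℕₚ.m≤m+n n k) (Degree-≤ (Degree-≋ (≋-sym e) (Degree-⊗ dp h)) (bound dq)))

    -- An irreducible polynomial of degree n with a nonzero constant term.
    module Prime (π : Poly) (n : ℕ) (π-degree : Degree π n) (0<n : 0 < n)
      (irreducible : ∀ d s → d ⊗ s ≋ π → d ≋ 1ₚ ⊎ s ≋ 1ₚ) where

      -- Euclid's descent on the degree of d. Write π = d s + r; then r e = π e + d e s is again
      -- divisible by π, and r has smaller degree. If r = 0, irreducibility gives d = 1, since s = 1
      -- would make d equal to π, whose degree is too large.
      low-degree : ∀ m d e → m < n → Degree d m → π ∣ d ⊗ e → π ∣ e
      low-degree = <-rec _ step
        where
        step : ∀ m → (∀ {k} → k < m → ∀ d e → k < n → Degree d k → π ∣ d ⊗ e → π ∣ e) →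
          ∀ d e → m < n → Degree d m → π ∣ d ⊗ e → π ∣ e
        step m rec d e m<n deg π∣de with divide d deg π
        ... | s , r , eq , dr with findDegree m r dr
        ...   | inj₂ (k , k<m , deg-r) = rec k<m r e (ℕₚ.<-trans k<m m<n) deg-r
          (∣-≋ π r⊗e (∣-⊕ π (e , ≋-refl) (∣-⊗ π s π∣de)))
          where
          open ≋-Reasoning
          r⊗e : π ⊗ e ⊕ (d ⊗ e) ⊗ s ≋ r ⊗ e
          r⊗e = begin
            π ⊗ e ⊕ (d ⊗ e) ⊗ s
              ≈⟨ ⊕-cong (≋-trans (⊗-congʳ eq) (⊗-distribʳ e (d ⊗ s) r))
                   (≋-trans (⊗-assoc d e s) (≋-trans (⊗-congˡ {d} (⊗-comm e s)) (≋-sym (⊗-assoc d s e)))) ⟩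
            ((d ⊗ s) ⊗ e ⊕ r ⊗ e) ⊕ (d ⊗ s) ⊗ e
              ≈⟨ ⊕-congʳ (⊕-comm ((d ⊗ s) ⊗ e) (r ⊗ e)) ⟩
            (r ⊗ e ⊕ (d ⊗ s) ⊗ e) ⊕ (d ⊗ s) ⊗ e
              ≈⟨ ⊕-cancel (r ⊗ e) _ ⟩
            r ⊗ e ∎
        ...   | inj₁ r≋[] with irreducible d s (≋-sym (≋-trans eq (≋-trans (⊕-congˡ {d ⊗ s} r≋[]) (⊕-identityʳ _))))
        ...     | inj₁ d≋1 = ∣-≋ π (≋-trans (⊗-congʳ d≋1) (⊗-identityˡ e)) π∣de
        ...     | inj₂ s≋1 = ⊥-elim (ℕₚ.<⇒≱ m<n (Degree-≤ π-degree (Deg<-≋ d≋π (bound deg))))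
          where
          d≋π : d ≋ π
          d≋π = ≋-sym (≋-trans eq (≋-trans (⊕-cong (≋-trans (⊗-congˡ {d} s≋1) (⊗-identityʳ d)) r≋[]) (⊕-identityʳ d)))

      prime : ∀ d e → π ∣ d ⊗ e → π ∣ d ⊎ π ∣ e
      prime d e (t , eq) with divide π π-degree d
      ... | s , r , eq′ , dr with findDegree n r dr
      ...   | inj₁ r≋[] = inj₁ (s , ≋-trans eq′ (≋-trans (⊕-congˡ {π ⊗ s} r≋[]) (⊕-identityʳ _)))
      ...   | inj₂ (k , k<n , deg) = inj₂ (low-degree k r e k<n deg
          (∣-≋ π r⊗e (∣-⊕ π (t , eq) (∣-⊗ π e (s , ≋-refl)))))
        where
        open ≋-Reasoning
        r⊗e : d ⊗ e ⊕ (π ⊗ s) ⊗ e ≋ r ⊗ e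
        r⊗e = begin
          d ⊗ e ⊕ (π ⊗ s) ⊗ e
            ≈⟨ ⊕-congʳ (≋-trans (⊗-congʳ (≋-trans eq′ (⊕-comm (π ⊗ s) r))) (⊗-distribʳ e r (π ⊗ s))) ⟩
          (r ⊗ e ⊕ (π ⊗ s) ⊗ e) ⊕ (π ⊗ s) ⊗ e
            ≈⟨ ⊕-cancel (r ⊗ e) _ ⟩
          r ⊗ e ∎

      cancel : ∀ p q → π ⊗ p ≋ π ⊗ q → p ≋ q
      cancel p q e with domain π (p ⊕ q) (≋-trans (⊗-distribˡ π p q) (≋-trans (⊕-congʳ e) (⊕-self (π ⊗ q))))
      ... | inj₁ z = ⊥-elim (Degree-≢ π-degree z)
      ... | inj₂ z = ≋-trans (≋-sym (⊕-cancel p q)) (⊕-congʳ z)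

      -- Primality moves the factors π one by one to d or to e. What remains at the end is a unit,
      -- and 1 is the only one, so the factors are powers of π on the nose.
      factors-of-power : ∀ k d e → d ⊗ e ≋ π ↑ k → ∃[ i ] ∃[ j ] i ℕ.+ j ≡ k × d ≋ π ↑ i × e ≋ π ↑ j
      factors-of-power zero d e eq with findDegree′ d | findDegree′ e
      ... | inj₁ z | _ with () ← trans (sym (at eq 0)) (at (⊗-congʳ {q = e} z) 0)
      factors-of-power zero d e eq | inj₂ _ | inj₁ z
        with () ← trans (sym (at eq 0)) (at (≋-trans (⊗-congˡ {d} z) (⊗-zeroʳ d)) 0)
      factors-of-power zero d e eq | inj₂ (i , h) | inj₂ (j , h′) =
        0 , 0 , refl
          , Degree-0 (subst (Degree d) (ℕₚ.m+n≡0⇒m≡0 i i+j≡0) h)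
          , Degree-0 (subst (Degree e) (ℕₚ.m+n≡0⇒n≡0 i i+j≡0) h′)
        where
        i+j≡0 : i ℕ.+ j ≡ 0
        i+j≡0 = ℕₚ.n≤0⇒n≡0 (Degree-≤ (Degree-≋ eq (Degree-⊗ h h′)) (bound 1ₚ-Degree))
      factors-of-power (suc k) d e eq with prime d e (π ↑ k , eq)
      ... | inj₁ (d′ , d≋) with factors-of-power k d′ e
              (cancel _ _ (≋-trans (≋-sym (⊗-assoc π d′ e)) (≋-trans (⊗-congʳ (≋-sym d≋)) eq)))
      ...   | i , j , i+j≡k , h , h′ = suc i , j , cong suc i+j≡k , ≋-trans d≋ (⊗-congˡ {π} h) , h′
      factors-of-power (suc k) d e eq | inj₂ (e′ , e≋) with factors-of-power k d e′
              (cancel _ _ (≋-trans swap (≋-trans (⊗-congˡ {d} (≋-sym e≋)) eq)))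
        where
        swap : π ⊗ (d ⊗ e′) ≋ d ⊗ (π ⊗ e′)
        swap = ≋-trans (≋-sym (⊗-assoc π d e′)) (≋-trans (⊗-congʳ (⊗-comm π d)) (⊗-assoc d π e′))
      ...   | i , j , i+j≡k , h , h′ =
        i , suc j , trans (ℕₚ.+-suc i j) (cong suc i+j≡k) , h , ≋-trans e≋ (⊗-congˡ {π} h′)

      ↑-Degree : ∀ k → Degree (π ↑ k) (k ℕ.* n)
      ↑-Degree zero    = 1ₚ-Degree
      ↑-Degree (suc k) = Degree-⊗ π-degree (↑-Degree k)

    -- The divisor tested is 1 + X d, of degree at most h. A constant term 1 is forced on it when π
    -- has one, and `isZero d` excepts the trivial divisor 1.
    no-small-factor : ℕ → ℕ → Poly → Bool
    no-small-factor h n π = allOfLength h λ d → isZero d ∨ not (isZero (eliminate n d π))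

    small-factor : ∀ {h n π} → no-small-factor h n π ≡ true → π ! 0 ≡ true →
      ∀ d s → d ⊗ s ≋ π → Deg≤ d h → Deg< s n → d ≋ 1ₚ
    small-factor {h} {n} {π} check π₀ d s eq dd ds = by-constant-term d eq dd
      where
      s′ = truncate n s
      by-constant-term : ∀ d → d ⊗ s ≋ π → Deg≤ d h → d ≋ 1ₚ
      by-constant-term [] eq _ with () ← trans (at eq 0) π₀
      by-constant-term (false ∷ d) eq _ with () ← trans (sym (at (0∷-⊗ d s) 0)) (trans (at eq 0) π₀)
      by-constant-term (true ∷ d) eq dd = ∷-cong refl (≋-trans (≋-sym d′≋) (isZero-sound d′ zero?))
        where
        d′   = truncate h d
        d′≋ : d′ ≋ d
        d′≋  = truncate-≋ h d (Deg<-tail dd)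
        eq′ : (true ∷ d′) ⊗ s′ ≋ π
        eq′ = ≋-trans (⊗-cong (∷-cong refl d′≋) (truncate-≋ n s ds)) eq
        elim : isZero (eliminate n d′ π) ≡ true
        elim = isZero-complete (eliminate-multiple n d′ s′ (ℕₚ.≤-reflexive (truncate-length n s)) eq′)
        split : ∀ a {b} → b ≡ true → a ∨ not b ≡ true → a ≡ true
        split true  _    _  = refl
        split false refl ()
        zero? : isZero d′ ≡ true
        zero? = split (isZero d′) elim (allOfLength-sound h _ check d′ (truncate-length h d))

    -- Of two factors of a polynomial of degree 2h, one has degree at most h.
    irreducible-by-check : ∀ {h π} → Degree π (h ℕ.+ h) → π ! 0 ≡ true →
      no-small-factor h (suc (h ℕ.+ h)) π ≡ true → ∀ d s → d ⊗ s ≋ π → d ≋ 1ₚ ⊎ s ≋ 1ₚ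
    irreducible-by-check {h} {π} deg π₀ check d s eq with findDegree′ d | findDegree′ s
    ... | inj₁ z | _ = ⊥-elim (Degree-≢ deg (≋-trans (≋-sym eq) (⊗-congʳ {q = s} z)))
    ... | inj₂ _ | inj₁ z = ⊥-elim (Degree-≢ deg (≋-trans (≋-sym eq) (≋-trans (⊗-congˡ {d} z) (⊗-zeroʳ d))))
    ... | inj₂ (m , hd) | inj₂ (n , hs) = cases
      where
      m+n≤2h : m ℕ.+ n ≤ h ℕ.+ h
      m+n≤2h = Degree-≤ (Degree-⊗ hd hs) (Deg<-≋ (≋-sym eq) (bound deg))
      cases : d ≋ 1ₚ ⊎ s ≋ 1ₚ
      cases with m ℕ.≤? h
      ... | yes m≤h = inj₁ (small-factor check π₀ d s eq (Deg<-mono (s≤s m≤h) (bound hd))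
                        (Deg<-mono (s≤s (ℕₚ.≤-trans (ℕₚ.m≤n+m n m) m+n≤2h)) (bound hs)))
      ... | no  m≰h = inj₂ (small-factor check π₀ s d (≋-trans (⊗-comm s d) eq)
                        (Deg<-mono (s≤s n≤h) (bound hs))
                        (Deg<-mono (s≤s (ℕₚ.≤-trans (ℕₚ.m≤m+n m n) m+n≤2h)) (bound hd)))
        where
        n≤h : n ≤ h
        n≤h = ℕₚ.+-cancelˡ-≤ h n h (ℕₚ.≤-trans (ℕₚ.+-monoˡ-≤ n (ℕₚ.<⇒≤ (ℕₚ.≰⇒> m≰h))) m+n≤2h)

-- Reduction modulo 2 and Schönemann's criterion

module Irreducibility where

  open BinaryPolynomials
  open import Algebra using (CommutativeRing)
  open import Data.Bool using (Bool; true; false; not; _∧_; _xor_)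
  open import Data.Bool.Properties using (not-involutive; xor-comm; xor-same; not-distribˡ-xor; xor-identityʳ)
  open import Data.Empty using (⊥; ⊥-elim)
  open import Data.Integer as ℤ using (ℤ; +_; -[1+_]; 0ℤ; 1ℤ; ∣_∣; _⊖_)
  import Data.Integer.Properties as ℤₚ
  open import Data.Integer.Solver using (module +-*-Solver)
  open import Data.List using ([]; _∷_; map)
  open import Data.Nat as ℕ using (ℕ; zero; suc; z≤n; s≤s; _≤_; _<_; _∸_; _%_; _≡ᵇ_)
  import Data.Nat.Properties as ℕₚ
  open import Data.Nat.DivMod using ([m+n]%n≡m%n)
  open import Data.Nat.Induction using (<-rec)
  open import Data.Product using (_,_; ∃-syntax)
  open import Data.Sum using (_⊎_; inj₁; inj₂)
  open import Relation.Binary.PropositionalEquality using (_≡_; _≢_; refl; sym; trans; cong; cong₂; subst; module ≡-Reasoning)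
  open import Relation.Nullary using (¬_; yes; no)

  module ℤ[x] = Polynomials ℤₚ.+-*-commutativeRing

  -- Through the built-in remainder, so that large literals reduce quickly.
  oddℕ : ℕ → Bool
  oddℕ n = n % 2 ≡ᵇ 1

  oddℕ-suc : ∀ n → oddℕ (suc n) ≡ not (oddℕ n)
  oddℕ-suc zero          = refl
  oddℕ-suc (suc zero)    = refl
  oddℕ-suc (suc (suc n)) = trans (two (suc n)) (trans (oddℕ-suc n) (cong not (sym (two n))))
    where
    two : ∀ n → oddℕ (suc (suc n)) ≡ oddℕ n
    two n = cong (_≡ᵇ 1) (trans (cong (_% 2) (ℕₚ.+-comm 2 n)) ([m+n]%n≡m%n n 2))

  odd : ℤ → Bool
  odd i = oddℕ ∣ i ∣

  oddℕ-+ : ∀ m n → oddℕ (m ℕ.+ n) ≡ oddℕ m xor oddℕ n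
  oddℕ-+ zero    n = refl
  oddℕ-+ (suc m) n = trans (oddℕ-suc (m ℕ.+ n)) (trans (cong not (oddℕ-+ m n))
    (trans (not-distribˡ-xor (oddℕ m) (oddℕ n)) (cong (_xor oddℕ n) (sym (oddℕ-suc m)))))

  oddℕ-* : ∀ m n → oddℕ (m ℕ.* n) ≡ oddℕ m ∧ oddℕ n
  oddℕ-* zero    n = refl
  oddℕ-* (suc m) n = trans (oddℕ-+ n (m ℕ.* n)) (trans (cong (oddℕ n xor_) (oddℕ-* m n))
    (trans (lemma (oddℕ m) (oddℕ n)) (cong (_∧ oddℕ n) (sym (oddℕ-suc m)))))
    where
    lemma : ∀ a b → b xor (a ∧ b) ≡ not a ∧ b
    lemma true  b = xor-same b
    lemma false b = xor-identityʳ b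

  odd-⊖ : ∀ m n → odd (m ⊖ n) ≡ oddℕ m xor oddℕ n
  odd-⊖ zero    zero    = refl
  odd-⊖ zero    (suc n) = refl
  odd-⊖ (suc m) zero    = sym (xor-identityʳ _)
  odd-⊖ (suc m) (suc n) = trans (cong odd (ℤₚ.[1+m]⊖[1+n]≡m⊖n m n)) (trans (odd-⊖ m n)
    (trans (lemma (oddℕ m) (oddℕ n)) (sym (cong₂ _xor_ (oddℕ-suc m) (oddℕ-suc n)))))
    where
    lemma : ∀ a b → a xor b ≡ not a xor not b
    lemma true  true  = refl
    lemma true  false = refl
    lemma false true  = refl
    lemma false false = refl

  odd-+ : ∀ i j → odd (i ℤ.+ j) ≡ odd i xor odd j
  odd-+ (+ m)    (+ n)    = oddℕ-+ m n
  odd-+ (+ m)    -[1+ n ] = odd-⊖ m (suc n)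
  odd-+ -[1+ m ] (+ n)    = trans (odd-⊖ n (suc m)) (xor-comm (oddℕ n) (oddℕ (suc m)))
  odd-+ -[1+ m ] -[1+ n ] = trans (cong (λ k → oddℕ (suc k)) (sym (ℕₚ.+-suc m n))) (oddℕ-+ (suc m) (suc n))

  odd-* : ∀ i j → odd (i ℤ.* j) ≡ odd i ∧ odd j
  odd-* i j = trans (cong oddℕ (ℤₚ.abs-* i j)) (oddℕ-* ∣ i ∣ ∣ j ∣)

  halveℕ : ∀ n → oddℕ n ≡ false → ∃[ k ] n ≡ k ℕ.+ k
  halveℕ zero          _ = 0 , refl
  halveℕ (suc zero)    ()
  halveℕ (suc (suc n)) e with halveℕ n (trans (sym (not-involutive (oddℕ n)))
    (trans (cong not (sym (oddℕ-suc n))) (trans (sym (oddℕ-suc (suc n))) e)))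
  ... | k , refl = suc k , cong suc (sym (ℕₚ.+-suc k k))

  halve : ∀ i → odd i ≡ false → ∃[ j ] i ≡ j ℤ.+ j
  halve (+ n)    e with halveℕ n e
  ... | k , refl = + k , refl
  halve -[1+ n ] e with halveℕ (suc n) e
  ... | k , eq = ℤ.- (+ k) , trans (cong (λ m → ℤ.- (+ m)) eq) (ℤₚ.neg-distrib-+ (+ k) (+ k))

  double-injective : ∀ i j → i ℤ.+ i ≡ j ℤ.+ j → i ≡ j
  double-injective i j e = ℤₚ.*-cancelˡ-≡ (+ 2) i j
    (trans (two i) (trans e (sym (two j))))
    where
    two : ∀ i → + 2 ℤ.* i ≡ i ℤ.+ i
    two = solve 1 (λ i → con (+ 2) :* i := i :+ i) refl
      where open +-*-Solver

  mod2 : ℤ[x].Poly → 𝔽₂.Poly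
  mod2 = map odd

  mod2-! : ∀ p i → mod2 p 𝔽₂.! i ≡ odd (p ℤ[x].! i)
  mod2-! []      i       = refl
  mod2-! (a ∷ p) zero    = refl
  mod2-! (a ∷ p) (suc i) = mod2-! p i

  mod2-≋ : ∀ {p q} → p ℤ[x].≋ q → mod2 p 𝔽₂.≋ mod2 q
  mod2-≋ {p} {q} e = 𝔽₂.coeffs λ i → trans (mod2-! p i) (trans (cong odd (ℤ[x].at e i)) (sym (mod2-! q i)))

  mod2-⊕ : ∀ p q → mod2 (p ℤ[x].⊕ q) ≡ mod2 p 𝔽₂.⊕ mod2 q
  mod2-⊕ []      q       = refl
  mod2-⊕ (a ∷ p) []      = refl
  mod2-⊕ (a ∷ p) (b ∷ q) = cong₂ _∷_ (odd-+ a b) (mod2-⊕ p q)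

  mod2-· : ∀ a p → mod2 (a ℤ[x].· p) ≡ odd a 𝔽₂.· mod2 p
  mod2-· a []      = refl
  mod2-· a (b ∷ p) = cong₂ _∷_ (odd-* a b) (mod2-· a p)

  mod2-⊗ : ∀ p q → mod2 (p ℤ[x].⊗ q) ≡ mod2 p 𝔽₂.⊗ mod2 q
  mod2-⊗ []      q = refl
  mod2-⊗ (a ∷ p) q = trans (mod2-⊕ (a ℤ[x].· q) (0ℤ ∷ p ℤ[x].⊗ q))
    (cong₂ 𝔽₂._⊕_ (mod2-· a q) (cong (false ∷_) (mod2-⊗ p q)))

  mod2-↑ : ∀ p k → mod2 (p ℤ[x].↑ k) ≡ mod2 p 𝔽₂.↑ k
  mod2-↑ p zero    = refl
  mod2-↑ p (suc k) = trans (mod2-⊗ p (p ℤ[x].↑ k)) (cong (mod2 p 𝔽₂.⊗_) (mod2-↑ p k))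

  mod2-Deg< : ∀ {p n} → ℤ[x].Deg< p n → 𝔽₂.Deg< (mod2 p) n
  mod2-Deg< {p} d = 𝔽₂.vanish λ i n≤i → trans (mod2-! p i) (cong odd (ℤ[x].beyond d i n≤i))

  open ℤ[x]

  halvePoly : ∀ p → mod2 p 𝔽₂.≋ [] → ∃[ q ] p ≋ q ⊕ q
  halvePoly []      e = [] , ≋-refl
  halvePoly (a ∷ p) e with halve a (𝔽₂.at e 0) | halvePoly p (𝔽₂.coeffs λ i → 𝔽₂.at e (suc i))
  ... | b , refl | q , p≋ = b ∷ q , ∷-cong refl p≋

  -- Twice r is written `r ⊕ r`, here and below, which brings congruences within reach of the solver
  -- for commutative semirings.
  congruent : ∀ p q → mod2 p 𝔽₂.≋ mod2 q → ∃[ r ] p ≋ q ⊕ (r ⊕ r)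
  congruent p q e with halvePoly (p ⊕ ⊖ q) even
    where
    odd-neg : ∀ i → odd (ℤ.- i) ≡ odd i
    odd-neg i = cong oddℕ (ℤₚ.∣-i∣≡∣i∣ i)
    even : mod2 (p ⊕ ⊖ q) 𝔽₂.≋ []
    even = 𝔽₂.coeffs λ i → begin
      mod2 (p ⊕ ⊖ q) 𝔽₂.! i            ≡⟨ mod2-! (p ⊕ ⊖ q) i ⟩
      odd ((p ⊕ ⊖ q) ! i)              ≡⟨ cong odd (trans (⊕-! p (⊖ q) i) (cong (λ z → p ! i ℤ.+ z) (⊖-! q i))) ⟩
      odd (p ! i ℤ.+ ℤ.- (q ! i))      ≡⟨ trans (odd-+ (p ! i) _) (cong (odd (p ! i) xor_) (odd-neg (q ! i))) ⟩
      odd (p ! i) xor odd (q ! i)      ≡⟨ cong₂ _xor_ (trans (sym (mod2-! p i)) (𝔽₂.at e i)) (sym (mod2-! q i)) ⟩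
      (mod2 q 𝔽₂.! i) xor (mod2 q 𝔽₂.! i) ≡⟨ xor-same (mod2 q 𝔽₂.! i) ⟩
      false ∎
      where open ≡-Reasoning
  ... | r , eq = r , (begin
    p                   ≈⟨ ⊕-identityʳ p ⟨
    p ⊕ []              ≈⟨ ⊕-congˡ (⊖-inverseˡ q) ⟨
    p ⊕ (⊖ q ⊕ q)       ≈⟨ ⊕-assoc p (⊖ q) q ⟨
    (p ⊕ ⊖ q) ⊕ q       ≈⟨ ⊕-congʳ eq ⟩
    (r ⊕ r) ⊕ q         ≈⟨ ⊕-comm (r ⊕ r) q ⟩
    q ⊕ (r ⊕ r)         ∎)
    where open ≋-Reasoning

  double-cancel : ∀ {p q} → p ⊕ p ≋ q ⊕ q → p ≋ q
  double-cancel {p} {q} e = coeffs λ i →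
    double-injective _ _ (trans (sym (⊕-! p p i)) (trans (at e i) (⊕-! q q i)))

  ⊕-cancelˡ : ∀ p {q r} → p ⊕ q ≋ p ⊕ r → q ≋ r
  ⊕-cancelˡ p {q} {r} = ∙-cancelˡ p q r
    where open import Algebra.Properties.AbelianGroup (CommutativeRing.+-abelianGroup polyRing)

  Deg<-halve : ∀ {p q n} → p ≋ q ⊕ q → Deg< p n → Deg< q n
  Deg<-halve {p} {q} e d = vanish λ i n≤i → double-injective _ 0ℤ
    (trans (sym (⊕-! q q i)) (trans (sym (at e i)) (beyond d i n≤i)))

  ↑-+ : ∀ p i j → p ↑ i ⊗ p ↑ j ≋ p ↑ (i ℕ.+ j)
  ↑-+ p zero    j = ⊗-identityˡ (p ↑ j)
  ↑-+ p (suc i) j = ≋-trans (⊗-assoc p (p ↑ i) (p ↑ j)) (⊗-congˡ {p} (↑-+ p i j))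

  double-mod2 : ∀ p → mod2 (p ⊕ p) 𝔽₂.≋ []
  double-mod2 p = 𝔽₂.≋-trans (≡⇒≋ (mod2-⊕ p p)) (𝔽₂.⊕-self (mod2 p))
    where
    ≡⇒≋ : ∀ {p q} → p ≡ q → p 𝔽₂.≋ q
    ≡⇒≋ refl = 𝔽₂.≋-refl

  -- Schönemann's criterion: π is irreducible of degree n modulo 2, and h ≡ πᵏ + 2g
  -- modulo 4 where g is not divisible by π modulo 2.
  module Schönemann (π : Poly) (n : ℕ) (0<n : 0 < n)
    (π-degree : 𝔽₂.Degree (mod2 π) n)
    (π-irreducible : ∀ d s → d 𝔽₂.⊗ s 𝔽₂.≋ mod2 π → d 𝔽₂.≋ 𝔽₂.1ₚ ⊎ s 𝔽₂.≋ 𝔽₂.1ₚ)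
    (k : ℕ) (h g y : Poly) (h≋ : h ≋ π ↑ k ⊕ ((g ⊕ (y ⊕ y)) ⊕ (g ⊕ (y ⊕ y))))
    (π∤g : ¬ mod2 π 𝔽₂.∣ mod2 g) where

    open 𝔽₂.Prime (mod2 π) n π-degree 0<n π-irreducible

    G : Poly
    G = g ⊕ (y ⊕ y)

    ≡⇒≋₂ : ∀ {p q} → p ≡ q → p 𝔽₂.≋ q
    ≡⇒≋₂ refl = 𝔽₂.≋-refl

    mod2-h : mod2 h 𝔽₂.≋ mod2 π 𝔽₂.↑ k
    mod2-h = begin
      mod2 h                                 ≈⟨ mod2-≋ h≋ ⟩
      mod2 (π ↑ k ⊕ (G ⊕ G))                 ≡⟨ mod2-⊕ (π ↑ k) (G ⊕ G) ⟩
      mod2 (π ↑ k) 𝔽₂.⊕ mod2 (G ⊕ G)         ≈⟨ 𝔽₂.⊕-congˡ (double-mod2 G) ⟩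
      mod2 (π ↑ k) 𝔽₂.⊕ []                   ≈⟨ 𝔽₂.⊕-identityʳ _ ⟩
      mod2 (π ↑ k)                           ≡⟨ mod2-↑ π k ⟩
      mod2 π 𝔽₂.↑ k                          ∎
      where open 𝔽₂.≋-Reasoning

    mod2-G : mod2 G 𝔽₂.≋ mod2 g
    mod2-G = 𝔽₂.≋-trans (≡⇒≋₂ (mod2-⊕ g (y ⊕ y)))
      (𝔽₂.≋-trans (𝔽₂.⊕-congˡ (double-mod2 y)) (𝔽₂.⊕-identityʳ _))

    open import Algebra.Solver.Ring.NaturalCoefficients.Default (CommutativeRing.commutativeSemiring polyRing)
      using (solve; _:=_; _:+_; _:*_)

    -- Otherwise d would reduce to πᵏ, whose degree k n is excluded by the bound on d.
    proper : ∀ {d} i j → i ℕ.+ j ≡ k → Deg< d (k ℕ.* n) → mod2 d 𝔽₂.≋ mod2 π 𝔽₂.↑ i → 0 < j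
    proper {d} i (suc j) _     _  _ = s≤s z≤n
    proper {d} i zero    i+0≡k dd e with () ← trans (sym (𝔽₂.leading (↑-Degree k)))
      (trans (sym (𝔽₂.at (subst (λ i → mod2 d 𝔽₂.≋ mod2 π 𝔽₂.↑ i) (trans (sym (ℕₚ.+-identityʳ i)) i+0≡k) e) (k ℕ.* n)))
        (𝔽₂.beyond (mod2-Deg< dd) (k ℕ.* n) ℕₚ.≤-refl))

    -- Modulo 2 the factors are πⁱ and πʲ with positive exponents (`suc i` and `suc j` in the code).
    -- Put d = πⁱ + 2d′, e = πʲ + 2e′ and c = 1 + 2c′. In d e = c h the terms πᵏ cancel, and halving
    -- leaves πⁱe′ + πʲd′ + 2d′e′ = G + c′h. Modulo 2 all terms except G, which reduces to g, are
    -- multiples of π; hence so is g.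
    no-odd-factorisation : ∀ c d e → odd c ≡ true → d ⊗ e ≋ c · h →
      Deg< d (k ℕ.* n) → Deg< e (k ℕ.* n) → ⊥
    no-odd-factorisation c d e oc eq dd de with factors-of-power k (mod2 d) (mod2 e) eq₂
      where
      eq₂ : mod2 d 𝔽₂.⊗ mod2 e 𝔽₂.≋ mod2 π 𝔽₂.↑ k
      eq₂ = begin
        mod2 d 𝔽₂.⊗ mod2 e    ≡⟨ mod2-⊗ d e ⟨
        mod2 (d ⊗ e)          ≈⟨ mod2-≋ eq ⟩
        mod2 (c · h)          ≡⟨ mod2-· c h ⟩
        odd c 𝔽₂.· mod2 h     ≡⟨ cong (𝔽₂._· mod2 h) oc ⟩
        true 𝔽₂.· mod2 h      ≈⟨ 𝔽₂.1·≋ (mod2 h) ⟩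
        mod2 h                ≈⟨ mod2-h ⟩
        mod2 π 𝔽₂.↑ k         ∎
        where open 𝔽₂.≋-Reasoning
    ... | i , j , i+j≡k , d≋ , e≋
      with proper {d} i j i+j≡k dd d≋ | proper {e} j i (trans (ℕₚ.+-comm j i) i+j≡k) de e≋
    no-odd-factorisation c d e oc eq dd de | suc i , suc j , i+j≡k , d≋ , e≋ | _ | _
      with congruent d (π ↑ suc i) (𝔽₂.≋-trans d≋ (≡⇒≋₂ (sym (mod2-↑ π (suc i)))))
         | congruent e (π ↑ suc j) (𝔽₂.≋-trans e≋ (≡⇒≋₂ (sym (mod2-↑ π (suc j)))))
         | halve (c ℤ.+ ℤ.- 1ℤ) (trans (odd-+ c (ℤ.- 1ℤ)) (cong (_xor true) oc))
    ... | d′ , d-eq | e′ , e-eq | c′ , c-eq = π∤g divides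
      where
      P = π ↑ suc i
      Q = π ↑ suc j
      X = (P ⊗ e′ ⊕ Q ⊗ d′) ⊕ (d′ ⊗ e′ ⊕ d′ ⊗ e′)
      c≡ : c ≡ 1ℤ ℤ.+ (c′ ℤ.+ c′)
      c≡ = trans (S.solve 1 (λ c → c S.:= S.con 1ℤ S.:+ (c S.:+ S.:- S.con 1ℤ)) refl c) (cong (λ z → 1ℤ ℤ.+ z) c-eq)
        where module S = +-*-Solver
      X≋ : X ≋ G ⊕ c′ · h
      X≋ = double-cancel (⊕-cancelˡ (π ↑ k) (begin
        π ↑ k ⊕ (X ⊕ X)
          ≈⟨ ⊕-congʳ (≋-trans (↑-+ π (suc i) (suc j)) (≡⇒≋ (cong (π ↑_) i+j≡k))) ⟨
        P ⊗ Q ⊕ (X ⊕ X)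
          ≈⟨ solve 4 (λ p q d e →
               (p :+ (d :+ d)) :* (q :+ (e :+ e)) :=
               p :* q :+ (((p :* e :+ q :* d) :+ (d :* e :+ d :* e)) :+ ((p :* e :+ q :* d) :+ (d :* e :+ d :* e))))
               ≋-refl P Q d′ e′ ⟨
        (P ⊕ (d′ ⊕ d′)) ⊗ (Q ⊕ (e′ ⊕ e′))
          ≈⟨ ⊗-cong d-eq e-eq ⟨
        d ⊗ e
          ≈⟨ eq ⟩
        c · h
          ≈⟨ ·-cong c≡ ≋-refl ⟩
        (1ℤ ℤ.+ (c′ ℤ.+ c′)) · h
          ≈⟨ ≋-trans (·-distribʳ 1ℤ (c′ ℤ.+ c′) h) (⊕-cong (1·≋ h) (·-distribʳ c′ c′ h)) ⟩
        h ⊕ (c′ · h ⊕ c′ · h)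
          ≈⟨ ⊕-congʳ h≋ ⟩
        (π ↑ k ⊕ (G ⊕ G)) ⊕ (c′ · h ⊕ c′ · h)
          ≈⟨ ⊕-assoc (π ↑ k) (G ⊕ G) _ ⟩
        π ↑ k ⊕ ((G ⊕ G) ⊕ (c′ · h ⊕ c′ · h))
          ≈⟨ ⊕-congˡ {π ↑ k} (⊕-interchange G G (c′ · h) (c′ · h)) ⟩
        π ↑ k ⊕ ((G ⊕ c′ · h) ⊕ (G ⊕ c′ · h)) ∎))
        where
        open ≋-Reasoning
        ≡⇒≋ : ∀ {p q} → p ≡ q → p ≋ q
        ≡⇒≋ refl = ≋-refl
      π̄ = mod2 π
      π∣power : ∀ m p → π̄ 𝔽₂.∣ mod2 ((π ↑ suc m) ⊗ p)
      π∣power m p = (mod2 (π ↑ m) 𝔽₂.⊗ mod2 p) ,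
        𝔽₂.≋-trans (≡⇒≋₂ (trans (mod2-⊗ (π ↑ suc m) p) (cong (𝔽₂._⊗ mod2 p) (mod2-⊗ π (π ↑ m)))))
          (𝔽₂.⊗-assoc π̄ (mod2 (π ↑ m)) (mod2 p))
      π∣X : π̄ 𝔽₂.∣ mod2 X
      π∣X = 𝔽₂.∣-≋ π̄ (𝔽₂.≋-sym (begin
          mod2 X
            ≡⟨ mod2-⊕ (P ⊗ e′ ⊕ Q ⊗ d′) (d′ ⊗ e′ ⊕ d′ ⊗ e′) ⟩
          mod2 (P ⊗ e′ ⊕ Q ⊗ d′) 𝔽₂.⊕ mod2 (d′ ⊗ e′ ⊕ d′ ⊗ e′)
            ≈⟨ 𝔽₂.⊕-congˡ (double-mod2 (d′ ⊗ e′)) ⟩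
          mod2 (P ⊗ e′ ⊕ Q ⊗ d′) 𝔽₂.⊕ []
            ≈⟨ 𝔽₂.⊕-identityʳ _ ⟩
          mod2 (P ⊗ e′ ⊕ Q ⊗ d′)
            ≡⟨ mod2-⊕ (P ⊗ e′) (Q ⊗ d′) ⟩
          mod2 (P ⊗ e′) 𝔽₂.⊕ mod2 (Q ⊗ d′) ∎))
        (𝔽₂.∣-⊕ π̄ (π∣power i e′) (π∣power j d′))
        where open 𝔽₂.≋-Reasoning
      π∣ch : π̄ 𝔽₂.∣ mod2 (c′ · h)
      π∣ch = 𝔽₂.∣-≋ π̄ (𝔽₂.≋-sym (begin
          mod2 (c′ · h)                    ≡⟨ mod2-· c′ h ⟩
          odd c′ 𝔽₂.· mod2 h               ≈⟨ 𝔽₂.·-cong refl (𝔽₂.≋-trans mod2-h (≡⇒≋₂ (cong (π̄ 𝔽₂.↑_) (sym i+j≡k)))) ⟩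
          odd c′ 𝔽₂.· (π̄ 𝔽₂.⊗ R)           ≈⟨ 𝔽₂.·-cong refl (𝔽₂.⊗-comm π̄ R) ⟩
          odd c′ 𝔽₂.· (R 𝔽₂.⊗ π̄)           ≈⟨ 𝔽₂.·-⊗ (odd c′) R π̄ ⟨
          (odd c′ 𝔽₂.· R) 𝔽₂.⊗ π̄           ≈⟨ 𝔽₂.⊗-comm _ π̄ ⟩
          π̄ 𝔽₂.⊗ (odd c′ 𝔽₂.· R)           ∎))
        (odd c′ 𝔽₂.· R , 𝔽₂.≋-refl)
        where
        open 𝔽₂.≋-Reasoning
        R = π̄ 𝔽₂.↑ (i ℕ.+ suc j)
      divides : π̄ 𝔽₂.∣ mod2 g
      divides = 𝔽₂.∣-≋ π̄ (begin
          mod2 X 𝔽₂.⊕ mod2 (c′ · h)                         ≈⟨ 𝔽₂.⊕-congʳ (mod2-≋ X≋) ⟩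
          mod2 (G ⊕ c′ · h) 𝔽₂.⊕ mod2 (c′ · h)              ≡⟨ cong (𝔽₂._⊕ mod2 (c′ · h)) (mod2-⊕ G (c′ · h)) ⟩
          (mod2 G 𝔽₂.⊕ mod2 (c′ · h)) 𝔽₂.⊕ mod2 (c′ · h)    ≈⟨ 𝔽₂.⊕-cancel _ _ ⟩
          mod2 G                                            ≈⟨ mod2-G ⟩
          mod2 g                                            ∎)
        (𝔽₂.∣-⊕ π̄ π∣X π∣ch)
        where open 𝔽₂.≋-Reasoning

    -- If c is even, d e vanishes modulo 2, so d or e does, and a factor 2 cancels on both sides.
    -- Induction on the absolute value of c ends at an odd multiple. This does the work of Gauss's
    -- lemma at the prime 2.
    no-factorisation : ∀ c d e → c ≢ 0ℤ → d ⊗ e ≋ c · h →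
      Deg< d (k ℕ.* n) → Deg< e (k ℕ.* n) → ⊥
    no-factorisation c = by-size ∣ c ∣ c refl
      where
      by-size : ∀ m c → ∣ c ∣ ≡ m → ∀ d e → c ≢ 0ℤ → d ⊗ e ≋ c · h →
        Deg< d (k ℕ.* n) → Deg< e (k ℕ.* n) → ⊥
      by-size = <-rec _ step
        where
        step : ∀ m → (∀ {l} → l < m → ∀ c → ∣ c ∣ ≡ l → ∀ d e → c ≢ 0ℤ → d ⊗ e ≋ c · h →
            Deg< d (k ℕ.* n) → Deg< e (k ℕ.* n) → ⊥) →
          ∀ c → ∣ c ∣ ≡ m → ∀ d e → c ≢ 0ℤ → d ⊗ e ≋ c · h →
          Deg< d (k ℕ.* n) → Deg< e (k ℕ.* n) → ⊥
        step m rec c refl d e c≢0 eq dd de with odd c in oc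
        ... | true  = no-odd-factorisation c d e oc eq dd de
        ... | false with halve c oc
        ...   | c′ , refl = cases (𝔽₂.domain (mod2 d) (mod2 e) zero₂)
          where
          c′≢0 : c′ ≢ 0ℤ
          c′≢0 refl = c≢0 refl
          smaller : ∀ i → i ≢ 0ℤ → ∣ i ∣ < ∣ i ℤ.+ i ∣
          smaller (+ zero)  i≢0 = ⊥-elim (i≢0 refl)
          smaller (+ suc n) _   = s≤s (ℕₚ.m<m+n n (s≤s z≤n))
          smaller -[1+ n ]  _   = s≤s (s≤s (ℕₚ.m≤m+n n n))
          zero₂ : mod2 d 𝔽₂.⊗ mod2 e 𝔽₂.≋ []
          zero₂ = 𝔽₂.≋-trans (≡⇒≋₂ (sym (mod2-⊗ d e)))
            (𝔽₂.≋-trans (mod2-≋ eq) (𝔽₂.≋-trans (≡⇒≋₂ (trans (mod2-· (c′ ℤ.+ c′) h) (cong (𝔽₂._· mod2 h) oc)))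
              (𝔽₂.0·≋ (mod2 h))))
          cases : mod2 d 𝔽₂.≋ [] ⊎ mod2 e 𝔽₂.≋ [] → ⊥
          cases (inj₁ z) with halvePoly d z
          ... | d′ , d≋ = rec (smaller c′ c′≢0) c′ refl d′ e c′≢0
            (double-cancel (≋-trans (≋-sym (⊗-distribʳ e d′ d′)) (≋-trans (⊗-congʳ (≋-sym d≋)) (≋-trans eq (·-distribʳ c′ c′ h)))))
            (Deg<-halve d≋ dd) de
          cases (inj₂ z) with halvePoly e z
          ... | e′ , e≋ = rec (smaller c′ c′≢0) c′ refl d e′ c′≢0
            (double-cancel (≋-trans (≋-sym (⊗-distribˡ d e′ e′)) (≋-trans (⊗-congˡ {d} (≋-sym e≋)) (≋-trans eq (·-distribʳ c′ c′ h)))))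
            dd (Deg<-halve e≋ de)

    -- V is the set of polynomials vanishing at a zero of h.
    module _ (V : Poly → Set) (V-≋ : ∀ {p q} → p ≋ q → V p → V q)
      (V-⊕ : ∀ {p q} → V p → V q → V (p ⊕ q)) (V-⊗ : ∀ {p} q → V p → V (p ⊗ q))
      (V-const : ∀ a → V (a ∷ []) → a ≡ 0ℤ) (Vh : V h) (h-Deg : Deg≤ h (k ℕ.* n)) where

      -- Pseudo-division gives x h = q s + r. As r lies in V and has degree below m, the induction
      -- hypothesis makes it 0, and then q s = x h is a factorisation of the kind already excluded.
      lower-degree-step : ∀ m → suc m ≤ k ℕ.* n → (∀ q → Deg< q m → V q → q ≋ []) →
        ∀ q → Deg< q (suc m) → V q → q ≋ []
      lower-degree-step m m<N ih q dq Vq with q ! m ℤ.≟ 0ℤ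
      ... | yes l≡0 = ih q (Deg≤⇒< dq l≡0) Vq
      -- A constant q is treated apart, because its cofactor would have the full degree k n.
      lower-degree-step zero m<N ih q dq Vq | no l≢0 = ⊥-elim (l≢0 (V-const (q ! 0) (V-≋ constant Vq)))
        where
        constant : q ≋ q ! 0 ∷ []
        constant = coeffs λ { zero → refl ; (suc i) → beyond dq (suc i) (s≤s z≤n) }
      lower-degree-step m@(suc m′) m<N ih q dq Vq | no l≢0
        with pseudo-division (_≢ 0ℤ) q m (λ ()) (λ x≢0 e → [ l≢0 , x≢0 ]′ (ℤₚ.i*j≡0⇒i≡0∨j≡0 (q ! m) e)) dq h
        where open import Data.Sum using ([_,_]′)
      ... | x , s , r , x≢0 , eq , dr = ⊥-elim (no-factorisation x q s x≢0 q⊗s≋ (Deg<-mono m<N dq)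
            (Deg<-mono (ℕₚ.≤-trans (ℕₚ.≤-reflexive (sym (ℕₚ.+-∸-assoc 1 (ℕₚ.<⇒≤ m<N)))) (ℕₚ.m∸n≤m (k ℕ.* n) m′)) s-Deg))
        where
        minus : ∀ q s → q ⊗ (⊖ s) ≋ ⊖ (q ⊗ s)
        minus q s = ≋-sym (-‿distribʳ-* q s)
          where open import Algebra.Properties.Ring (CommutativeRing.ring polyRing)
        scale : ∀ x p → p ⊗ (x ∷ []) ≋ x · p
        scale x p = ≋-trans (⊗-comm p (x ∷ [])) (const-⊗ p ≋-refl)
        r≋ : (h ⊗ (x ∷ [])) ⊕ q ⊗ (⊖ s) ≋ r
        r≋ = begin
          (h ⊗ (x ∷ [])) ⊕ q ⊗ (⊖ s)         ≈⟨ ⊕-cong (≋-trans (scale x h) eq) (minus q s) ⟩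
          (q ⊗ s ⊕ r) ⊕ ⊖ (q ⊗ s)            ≈⟨ ⊕-congʳ (⊕-comm (q ⊗ s) r) ⟩
          (r ⊕ q ⊗ s) ⊕ ⊖ (q ⊗ s)            ≈⟨ ⊕-assoc r (q ⊗ s) _ ⟩
          r ⊕ (q ⊗ s ⊕ ⊖ (q ⊗ s))            ≈⟨ ⊕-congˡ {r} (⊖-inverseʳ (q ⊗ s)) ⟩
          r ⊕ []                             ≈⟨ ⊕-identityʳ r ⟩
          r                                  ∎
          where open ≋-Reasoning
        r≋[] : r ≋ []
        r≋[] = ih r dr (V-≋ r≋ (V-⊕ (V-⊗ (x ∷ []) Vh) (V-⊗ (⊖ s) Vq)))
        q⊗s≋ : q ⊗ s ≋ x · h
        q⊗s≋ = ≋-sym (≋-trans eq (≋-trans (⊕-congˡ {q ⊗ s} r≋[]) (⊕-identityʳ _)))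
        reg : ∀ y → q ! m ℤ.* y ≡ 0ℤ → y ≡ 0ℤ
        reg y e with ℤₚ.i*j≡0⇒i≡0∨j≡0 (q ! m) e
        ... | inj₁ l≡0 = ⊥-elim (l≢0 l≡0)
        ... | inj₂ y≡0 = y≡0
        s-Deg : Deg≤ s (k ℕ.* n ∸ m)
        s-Deg = cofactor-Deg≤ reg dq (Deg<-≋ (≋-sym q⊗s≋)
          (Deg<-mono (s≤s (ℕₚ.≤-reflexive (sym (ℕₚ.m+[n∸m]≡n (ℕₚ.<⇒≤ m<N))))) (Deg<-· h-Deg)))

      lower-degree-zero : ∀ m → m ≤ k ℕ.* n → ∀ q → Deg< q m → V q → q ≋ []
      lower-degree-zero zero    _   q dq _ = Deg<-0⇒≋[] dq
      lower-degree-zero (suc m) m<N = lower-degree-step m m<N (lower-degree-zero m (ℕₚ.<⇒≤ m<N))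

-- The base pair of polynomials

module BasePolynomials where

  open import Data.Integer using (ℤ; +_; -[1+_])
  open import Data.List using (List; []; _∷_)

  -- In terms of x = z + 1/z + 2 let Vⱼ = zʲ + z⁻ʲ and Aₘ = 1 + V₁ + … + Vⱼ with m = 2j + 1.
  -- Then f = (x - 4) ∏ Aₘ and φ / f = x - 5 - (Σ Vⱼ / Aₘ - 1) / (x - 4), where m runs
  -- over 5, 7, 9, 11, 13, 17. All the poles and zeros of φ / f are simple and interlace.
  opaque
    φ : List ℤ
    φ =
        + 9 ∷ -[1+ 855 ] ∷ + 33776 ∷ -[1+ 740820 ] ∷ + 10223175 ∷ -[1+ 95443934 ] ∷
        + 633830348 ∷ -[1+ 3108731669 ] ∷ + 11596242865 ∷ -[1+ 33676477607 ] ∷ + 77587796223 ∷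
        -[1+ 143994510946 ] ∷ + 217947498095 ∷ -[1+ 271725068000 ] ∷ + 281256076906 ∷
        -[1+ 243166901719 ] ∷ + 176384632280 ∷ -[1+ 107652771164 ] ∷ + 55360297719 ∷
        -[1+ 23983491782 ] ∷ + 8737396180 ∷ -[1+ 2666935658 ] ∷ + 678026311 ∷ -[1+ 142337432 ] ∷
        + 24370479 ∷ -[1+ 3343948 ] ∷ + 358491 ∷ -[1+ 28898 ] ∷ + 1646 ∷ -[1+ 58 ] ∷ + 1 ∷ []

    f : List ℤ
    f =
        -[1+ 3 ] ∷ + 365 ∷ -[1+ 13782 ] ∷ + 288723 ∷ -[1+ 3798948 ] ∷ + 33772226 ∷
        -[1+ 213330191 ] ∷ + 994307324 ∷ -[1+ 3521365507 ] ∷ + 9699453831 ∷ -[1+ 21171770866 ] ∷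
        + 37178734624 ∷ -[1+ 53165984697 ] ∷ + 62514378771 ∷ -[1+ 60900082979 ] ∷
        + 49432927827 ∷ -[1+ 33565480304 ] ∷ + 19109352037 ∷ -[1+ 9127535928 ] ∷ + 3653715786 ∷
        -[1+ 1221985655 ] ∷ + 339652990 ∷ -[1+ 77822124 ] ∷ + 14524905 ∷ -[1+ 2170924 ] ∷
        + 253434 ∷ -[1+ 22249 ] ∷ + 1381 ∷ -[1+ 53 ] ∷ + 1 ∷ []

-- The iterated polynomials: leading coefficients and irreducibility

module Family where

  open BasePolynomials
  open BinaryPolynomials
  open Irreducibility
  open import Algebra using (CommutativeRing)
  open import Data.Integer as ℤ using (ℤ; +_; -[1+_]; 0ℤ; 1ℤ)
  import Data.Integer.Properties as ℤₚ
  open import Data.Integer.Solver using (module +-*-Solver)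
  open import Data.List using ([]; _∷_)
  open import Data.Nat as ℕ using (ℕ; zero; suc; z≤n; s≤s; _≤_)
  import Data.Nat.Properties as ℕₚ
  import Data.Nat.Solver as ℕS
  open import Data.Product using (_,_; proj₁; proj₂; ∃-syntax)
  open import Data.Sum using (_⊎_; inj₁; inj₂)
  open import Relation.Binary.PropositionalEquality using (_≡_; refl; sym; trans; cong; cong₂; subst; subst₂; module ≡-Reasoning)
  open import Relation.Nullary using (¬_)
  open ℤ[x]

  -- The data that the trace needs: τ is minus the sum of the zeros. Prepending 0 shifts the index
  -- to n - 1.
  record Top (p : Poly) (n : ℕ) (τ : ℤ) : Set where
    constructor top
    field
      degree-bound : Deg≤ p n
      monic        : p ! n ≡ 1ℤ
      subleading   : (0ℤ ∷ p) ! n ≡ τ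
  open Top public

  opaque
    unfolding φ f

    φ-top : Top φ 30 -[1+ 58 ]
    φ-top = top (Deg<-length φ) refl refl

    f-Deg : Deg≤ f 29
    f-Deg = Deg<-length f

    φ-degree : 𝔽₂.Degree (mod2 φ) 30
    φ-degree = 𝔽₂.degree (𝔽₂.Deg<-length (mod2 φ)) refl

    f-degree : 𝔽₂.Degree (mod2 f) 29
    f-degree = 𝔽₂.degree (𝔽₂.Deg<-length (mod2 f)) refl

    -- Degree 30 leaves 2¹⁵ candidates 1 + X d of degree at most 15, the trivial one included; type
    -- checking runs through them.
    φ-irreducible : ∀ d s → d 𝔽₂.⊗ s 𝔽₂.≋ mod2 φ → d 𝔽₂.≋ 𝔽₂.1ₚ ⊎ s 𝔽₂.≋ 𝔽₂.1ₚ
    φ-irreducible = 𝔽₂.irreducible-by-check {15} φ-degree refl refl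

  open 𝔽₂.Prime (mod2 φ) 30 φ-degree (s≤s z≤n) φ-irreducible using (prime)

  φ∤f : ¬ mod2 φ 𝔽₂.∣ mod2 f
  φ∤f = 𝔽₂.∤-smaller-degree φ-degree f-degree ℕₚ.≤-refl

  -- N e / D e is the e-th iterate of w ↦ w³ - 4w applied to φ / f.
  N D H : ℕ → Poly
  N zero    = φ
  N (suc e) = N e ⊗ (N e ⊗ N e) ⊕ (-[1+ 3 ]) · (N e ⊗ (D e ⊗ D e))
  D zero    = f
  D (suc e) = D e ⊗ (D e ⊗ D e)
  H e = N e ⊕ (D e ⊕ D e)

  3^_ : ℕ → ℕ
  3^ zero  = 1
  3^ suc e = 3^ e ℕ.* 3

  four : Poly → Poly
  four y = (y ⊕ y) ⊕ (y ⊕ y)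

  private
    module Sol where
      open import Algebra.Solver.Ring.NaturalCoefficients.Default
        (CommutativeRing.commutativeSemiring polyRing) public

    ↑-3 : ∀ k → φ ↑ k ⊗ (φ ↑ k ⊗ φ ↑ k) ≋ φ ↑ (k ℕ.* 3)
    ↑-3 k = ≋-trans (⊗-congˡ {φ ↑ k} (↑-+ φ k k)) (≋-trans (↑-+ φ k (k ℕ.+ k))
      (subst (λ m → φ ↑ m ≋ φ ↑ (k ℕ.* 3)) eq ≋-refl))
      where
      eq : k ℕ.* 3 ≡ k ℕ.+ (k ℕ.+ k)
      eq = ℕS.+-*-Solver.solve 1 (λ k → k ℕS.+-*-Solver.:* ℕS.+-*-Solver.con 3 ℕS.+-*-Solver.:= k ℕS.+-*-Solver.:+ (k ℕS.+-*-Solver.:+ k)) refl k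

    minus-four : ∀ p → -[1+ 3 ] · p ≋ four (⊖ p)
    minus-four p = coeffs λ i → begin
      (-[1+ 3 ] · p) ! i
        ≡⟨ ·-! -[1+ 3 ] p i ⟩
      -[1+ 3 ] ℤ.* p ! i
        ≡⟨ solve 1 (λ x → con -[1+ 3 ] :* x := ((:- x) :+ (:- x)) :+ ((:- x) :+ (:- x))) refl (p ! i) ⟩
      (ℤ.- (p ! i) ℤ.+ ℤ.- (p ! i)) ℤ.+ (ℤ.- (p ! i) ℤ.+ ℤ.- (p ! i))
        ≡⟨ cong₂ ℤ._+_ q q ⟨
      (⊖ p ⊕ ⊖ p) ! i ℤ.+ (⊖ p ⊕ ⊖ p) ! i
        ≡⟨ ⊕-! (⊖ p ⊕ ⊖ p) (⊖ p ⊕ ⊖ p) i ⟨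
      four (⊖ p) ! i ∎
      where
      open ≡-Reasoning
      open +-*-Solver
      q : ∀ {i} → (⊖ p ⊕ ⊖ p) ! i ≡ ℤ.- (p ! i) ℤ.+ ℤ.- (p ! i)
      q {i} = trans (⊕-! (⊖ p) (⊖ p) i) (cong₂ ℤ._+_ (⊖-! p i) (⊖-! p i))

  -- Modulo 4 the step N³ - 4ND² is cubing, and (a + 4y)³ agrees with a³.
  N-mod-4 : ∀ e → ∃[ y ] N e ≋ φ ↑ (3^ e) ⊕ four y
  N-mod-4 zero = [] , ≋-trans (≋-sym (⊗-identityʳ φ)) (≋-sym (⊕-identityʳ _))
  N-mod-4 (suc e) with N-mod-4 e
  ... | y , eq = z ⊕ ⊖ (N e ⊗ (D e ⊗ D e)) , (begin
    N e ⊗ (N e ⊗ N e) ⊕ -[1+ 3 ] · M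
      ≈⟨ ⊕-cong (⊗-cong eq (⊗-cong eq eq)) (minus-four M) ⟩
    (a ⊕ four y) ⊗ ((a ⊕ four y) ⊗ (a ⊕ four y)) ⊕ four (⊖ M)
      ≈⟨ Sol.solve 3 (λ a y m →
           let 4y = (y Sol.:+ y) Sol.:+ (y Sol.:+ y)
               z = a Sol.:* (a Sol.:* y) Sol.:+ a Sol.:* (y Sol.:* (a Sol.:+ 4y)) Sol.:+ y Sol.:* ((a Sol.:+ 4y) Sol.:* (a Sol.:+ 4y))
               w = z Sol.:+ m in
           (a Sol.:+ 4y) Sol.:* ((a Sol.:+ 4y) Sol.:* (a Sol.:+ 4y)) Sol.:+ ((m Sol.:+ m) Sol.:+ (m Sol.:+ m)) Sol.:=
           a Sol.:* (a Sol.:* a) Sol.:+ ((w Sol.:+ w) Sol.:+ (w Sol.:+ w))) ≋-refl a y (⊖ M) ⟩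
    a ⊗ (a ⊗ a) ⊕ four (z ⊕ ⊖ M)
      ≈⟨ ⊕-congʳ (↑-3 (3^ e)) ⟩
    φ ↑ (3^ suc e) ⊕ four (z ⊕ ⊖ M) ∎)
    where
    open ≋-Reasoning
    a = φ ↑ (3^ e)
    M = N e ⊗ (D e ⊗ D e)
    z = a ⊗ (a ⊗ y) ⊕ a ⊗ (y ⊗ (a ⊕ four y)) ⊕ y ⊗ ((a ⊕ four y) ⊗ (a ⊕ four y))

  H-mod-4 : ∀ e → ∃[ y ] H e ≋ φ ↑ (3^ e) ⊕ ((D e ⊕ (y ⊕ y)) ⊕ (D e ⊕ (y ⊕ y)))
  H-mod-4 e with N-mod-4 e
  ... | y , eq = y , (begin
    N e ⊕ (D e ⊕ D e)                            ≈⟨ ⊕-congʳ eq ⟩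
    (φ ↑ (3^ e) ⊕ four y) ⊕ (D e ⊕ D e)          ≈⟨ ⊕-assoc (φ ↑ (3^ e)) (four y) (D e ⊕ D e) ⟩
    φ ↑ (3^ e) ⊕ (four y ⊕ (D e ⊕ D e))          ≈⟨ ⊕-congˡ {φ ↑ (3^ e)} (⊕-comm (four y) (D e ⊕ D e)) ⟩
    φ ↑ (3^ e) ⊕ ((D e ⊕ D e) ⊕ four y)          ≈⟨ ⊕-congˡ {φ ↑ (3^ e)} (⊕-interchange (D e) (D e) (y ⊕ y) (y ⊕ y)) ⟩
    φ ↑ (3^ e) ⊕ ((D e ⊕ (y ⊕ y)) ⊕ (D e ⊕ (y ⊕ y))) ∎)
    where open ≋-Reasoning

  φ∤D : ∀ e → ¬ mod2 φ 𝔽₂.∣ mod2 (D e)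
  φ∤D zero    = φ∤f
  φ∤D (suc e) d with prime (mod2 (D e)) (mod2 (D e ⊗ D e)) (subst (mod2 φ 𝔽₂.∣_) (mod2-⊗ (D e) (D e ⊗ D e)) d)
  ... | inj₁ d₁ = φ∤D e d₁
  ... | inj₂ d₂ with prime (mod2 (D e)) (mod2 (D e)) (subst (mod2 φ 𝔽₂.∣_) (mod2-⊗ (D e) (D e)) d₂)
  ...   | inj₁ d₁ = φ∤D e d₁
  ...   | inj₂ d₁ = φ∤D e d₁

  Top-⊗ : ∀ {p q m n σ τ} → Top p m σ → Top q n τ → Top (p ⊗ q) (m ℕ.+ n) (σ ℤ.+ τ)
  Top-⊗ {p} {q} {m} {n} {σ} {τ} (top d a s) (top e b t) = top (Deg≤-⊗ p d e)
    (trans (leading-⊗ p m d e) (cong₂ ℤ._*_ a b))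
    (begin
      (0ℤ ∷ p ⊗ q) ! (m ℕ.+ n)                           ≡⟨ subleading-⊗ p m d e ⟩
      p ! m ℤ.* (0ℤ ∷ q) ! n ℤ.+ (0ℤ ∷ p) ! m ℤ.* q ! n  ≡⟨ cong₂ ℤ._+_ (cong₂ ℤ._*_ a t) (cong₂ ℤ._*_ s b) ⟩
      1ℤ ℤ.* τ ℤ.+ σ ℤ.* 1ℤ                              ≡⟨ solve 2 (λ s t → con 1ℤ :* t :+ s :* con 1ℤ := s :+ t) refl σ τ ⟩
      σ ℤ.+ τ                                            ∎)
    where
    open ≡-Reasoning
    open +-*-Solver

  -- The degree of r is at most n - 2, so neither of the two leading coefficients is touched.
  Top-⊕ : ∀ {p r n m τ} → Top p n τ → Deg< r m → suc m ≤ n → Top (p ⊕ r) n τ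
  Top-⊕ {p} {r} {suc n} {m} {τ} (top d a s) e (s≤s m≤n) = top
    (Deg<-⊕ d (Deg<-mono (ℕₚ.m≤n⇒m≤1+n (ℕₚ.m≤n⇒m≤1+n m≤n)) e))
    (trans (⊕-! p r (suc n)) (trans (cong₂ ℤ._+_ a (beyond e (suc n) (ℕₚ.m≤n⇒m≤1+n m≤n))) refl))
    (trans (⊕-! p r n) (trans (cong₂ ℤ._+_ s (beyond e n m≤n)) (ℤₚ.+-identityʳ τ)))

  degH : ℕ → ℕ
  degH e = 3^ e ℕ.* 30

  module _ where
    open ℕS.+-*-Solver
    D-Deg : ∀ e → Deg≤ (D e) (3^ e ℕ.* 29)
    D-Deg zero    = f-Deg
    D-Deg (suc e) = subst (Deg≤ (D (suc e)))
      (solve 1 (λ k → k :* con 29 :+ (k :* con 29 :+ k :* con 29) := k :* con 3 :* con 29) refl (3^ e))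
      (Deg≤-⊗ (D e) (D-Deg e) (Deg≤-⊗ (D e) (D-Deg e) (D-Deg e)))

    1≤3^ : ∀ e → 1 ≤ 3^ e
    1≤3^ zero    = s≤s z≤n
    1≤3^ (suc e) = ℕₚ.≤-trans (1≤3^ e) (ℕₚ.m≤m*n (3^ e) 3)

    -- With k = 3ᵉ, the term 4ND² has degree at most 88k, which is at least two below the degree 90k
    -- of N³. The two leading coefficients are therefore those of a cube.
    N-Top : ∀ e → Top (N e) (degH e) (ℤ.- (+ (3^ e ℕ.* 59)))
    N-Top zero    = φ-top
    N-Top (suc e) = subst₂ (Top (N (suc e)))
      (solve 1 (λ k → k :* con 30 :+ (k :* con 30 :+ k :* con 30) := k :* con 3 :* con 30) refl (3^ e))
      trace
      (Top-⊕ (Top-⊗ (N-Top e) (Top-⊗ (N-Top e) (N-Top e)))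
        (Deg<-· (Deg≤-⊗ (N e) (degree-bound (N-Top e)) (Deg≤-⊗ (D e) (D-Deg e) (D-Deg e))))
        small)
      where
      k = 3^ e
      trace : ℤ.- (+ (k ℕ.* 59)) ℤ.+ (ℤ.- (+ (k ℕ.* 59)) ℤ.+ ℤ.- (+ (k ℕ.* 59))) ≡ ℤ.- (+ (k ℕ.* 3 ℕ.* 59))
      trace = trans (cong (λ z → ℤ.- (+ (k ℕ.* 59)) ℤ.+ z) (sym (ℤₚ.neg-distrib-+ (+ (k ℕ.* 59)) (+ (k ℕ.* 59)))))
        (trans (sym (ℤₚ.neg-distrib-+ (+ (k ℕ.* 59)) _))
          (cong (λ m → ℤ.- (+ m)) (solve 1 (λ k → k :* con 59 :+ (k :* con 59 :+ k :* con 59) := k :* con 3 :* con 59) refl k)))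
      small : suc (suc (degH e ℕ.+ (k ℕ.* 29 ℕ.+ k ℕ.* 29))) ≤ degH e ℕ.+ (degH e ℕ.+ degH e)
      small = ℕₚ.≤-trans (ℕₚ.+-monoˡ-≤ (degH e ℕ.+ (k ℕ.* 29 ℕ.+ k ℕ.* 29)) (ℕₚ.*-monoˡ-≤ 2 (1≤3^ e)))
        (ℕₚ.≤-reflexive (solve 1 (λ k → k :* con 2 :+ (k :* con 30 :+ (k :* con 29 :+ k :* con 29)) :=
          k :* con 30 :+ (k :* con 30 :+ k :* con 30)) refl k))

    -- The degrees of N and D differ by k, so 2D leaves the trace alone once k ≥ 3. At exponent 0 it
    -- would change it by 2, hence the shift to `suc e`.
    H-Top : ∀ e → Top (H (suc e)) (degH (suc e)) (ℤ.- (+ (3^ suc e ℕ.* 59)))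
    H-Top e = Top-⊕ (N-Top (suc e)) (Deg<-⊕ (D-Deg (suc e)) (D-Deg (suc e)))
      (ℕₚ.≤-trans (ℕₚ.+-monoˡ-≤ (k ℕ.* 29) (ℕₚ.≤-trans (s≤s (s≤s (z≤n {1}))) (ℕₚ.*-monoˡ-≤ 3 (1≤3^ e))))
        (ℕₚ.≤-reflexive (solve 1 (λ k → k :+ k :* con 29 := k :* con 30) refl k)))
      where k = 3^ suc e

  module H-Schönemann (e : ℕ) = Schönemann φ 30 (s≤s z≤n) φ-degree φ-irreducible
    (3^ e) (H e) (D e) (proj₁ (H-mod-4 e)) (proj₂ (H-mod-4 e)) (φ∤D e)

-- Rational inequalities and null sequences

module RationalSequences where

  open import Defs using (Eventually)
  open import Data.Nat as ℕ using (ℕ)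
  import Data.Nat.Properties as ℕₚ
  open import Data.Product using (_×_; _,_; ∃-syntax)
  open import Data.Rational as ℚ hiding (_÷_)
  open import Data.Rational.Properties
  open import Data.Rational.Solver using (module +-*-Solver)
  open import Data.Sum using (inj₁; inj₂)
  open import Relation.Binary.PropositionalEquality using (_≡_; refl; sym; trans; cong)
  open import Relation.Nullary using (¬_)

  open +-*-Solver using (solve; _:=_; _:+_; _:*_; _:-_; :-_; con)

  ≤⇒0≤- : ∀ {p q} → p ≤ q → 0ℚ ≤ q - p
  ≤⇒0≤- {p} {q} p≤q = ≤-trans (≤-reflexive (sym (+-inverseʳ p))) (+-monoˡ-≤ (- p) p≤q)

  -- Inequalities are proved by exhibiting q - p as a sum of products of nonnegative terms.
  ≤-by : ∀ {p q} e → q - p ≡ e → 0ℚ ≤ e → p ≤ q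
  ≤-by {p} {q} e eq 0≤e = begin
    p            ≡⟨ +-identityˡ p ⟨
    0ℚ + p       ≤⟨ +-monoˡ-≤ p 0≤e ⟩
    e + p        ≡⟨ cong (_+ p) eq ⟨
    q - p + p    ≡⟨ solve 2 (λ p q → q :- p :+ p := q) refl p q ⟩
    q            ∎
    where open ≤-Reasoning

  <⇒0<- : ∀ {p q} → p < q → 0ℚ < q - p
  <⇒0<- {p} {q} p<q = ≤-<-trans (≤-reflexive (sym (+-inverseʳ p))) (+-monoˡ-< (- p) p<q)

  <-by : ∀ {p q} e → q - p ≡ e → 0ℚ < e → p < q
  <-by {p} {q} e eq 0<e = begin-strict
    p            ≡⟨ +-identityˡ p ⟨
    0ℚ + p       <⟨ +-monoˡ-< p 0<e ⟩
    e + p        ≡⟨ cong (_+ p) eq ⟨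
    q - p + p    ≡⟨ solve 2 (λ p q → q :- p :+ p := q) refl p q ⟩
    q            ∎
    where open ≤-Reasoning

  0≤+ : ∀ {p q} → 0ℚ ≤ p → 0ℚ ≤ q → 0ℚ ≤ p + q
  0≤+ a b = +-mono-≤ a b

  0≤* : ∀ {p q} → 0ℚ ≤ p → 0ℚ ≤ q → 0ℚ ≤ p * q
  0≤* {p} {q} a b = ≤-trans (≤-reflexive (sym (*-zeroʳ p))) (*-monoˡ-≤-nonNeg p {{nonNegative a}} b)

  0<* : ∀ {p q} → 0ℚ < p → 0ℚ < q → 0ℚ < p * q
  0<* {p} {q} a b = positive⁻¹ (p * q) {{pos*pos⇒pos p {{positive a}} q {{positive b}}}}

  *-mono-≤-0≤ : ∀ {a b c d} → 0ℚ ≤ a → 0ℚ ≤ d → a ≤ b → c ≤ d → a * c ≤ b * d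
  *-mono-≤-0≤ {a} {b} {c} {d} 0≤a 0≤d a≤b c≤d =
    ≤-trans (*-monoˡ-≤-nonNeg a {{nonNegative 0≤a}} c≤d) (*-monoʳ-≤-nonNeg d {{nonNegative 0≤d}} a≤b)

  0≤-square : ∀ p → 0ℚ ≤ p * p
  0≤-square p with ≤-total 0ℚ p
  ... | inj₁ 0≤p = 0≤* 0≤p 0≤p
  ... | inj₂ p≤0 = ≤-trans (0≤* 0≤-p 0≤-p) (≤-reflexive (solve 1 (λ p → (:- p) :* (:- p) := p :* p) refl p))
    where
    0≤-p : 0ℚ ≤ - p
    0≤-p = neg-antimono-≤ p≤0

  ∣∣≤ : ∀ {p b} → - b ≤ p → p ≤ b → ∣ p ∣ ≤ b
  ∣∣≤ {p} {b} l u with ∣p∣≡p∨∣p∣≡-p p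
  ... | inj₁ e = ≤-trans (≤-reflexive e) u
  ... | inj₂ e = ≤-trans (≤-reflexive e) (≤-trans (neg-antimono-≤ l) (≤-reflexive (solve 1 (λ b → :- (:- b) := b) refl b)))

  ≤∣∣ : ∀ p → p ≤ ∣ p ∣
  ≤∣∣ p with ≤-total 0ℚ p
  ... | inj₁ 0≤p = ≤-reflexive (sym (0≤p⇒∣p∣≡p 0≤p))
  ... | inj₂ p≤0 = ≤-trans p≤0 (0≤∣p∣ p)

  infixr 4 _⋀_
  _⋀_ : ∀ {P Q : ℕ → Set} → Eventually P → Eventually Q → Eventually λ n → P n × Q n
  (M , p) ⋀ (N , q) = M ℕ.⊔ N , λ n n≥ →
    p n (ℕₚ.≤-trans (ℕₚ.m≤m⊔n M N) n≥) , q n (ℕₚ.≤-trans (ℕₚ.m≤n⊔m M N) n≥)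

  eventually-map : ∀ {P Q : ℕ → Set} → (∀ {n} → P n → Q n) → Eventually P → Eventually Q
  eventually-map f (N , p) = N , λ n n≥ → f (p n n≥)

  always : ∀ {P : ℕ → Set} → (∀ n → P n) → Eventually P
  always p = 0 , λ n _ → p n

  eventually-witness : ∀ {P : ℕ → Set} → Eventually P → ∃[ n ] P n
  eventually-witness (N , p) = N , p N ℕₚ.≤-refl

  -- `x ≈ y` unfolds to this for the termwise differences, so equalities of reals reduce to ring
  -- identities between rational terms.
  Null : (ℕ → ℚ) → Set
  Null s = ∀ ε → 0ℚ < ε → Eventually λ n → ∣ s n ∣ ≤ ε

  Bounded : (ℕ → ℚ) → Set
  Bounded s = ∃[ B ] Eventually λ n → ∣ s n ∣ ≤ B

  Null-≗ : ∀ {s t} → (∀ n → s n ≡ t n) → Null s → Null t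
  Null-≗ e ν ε ε>0 = eventually-map (λ {n} → ≤-trans (≤-reflexive (cong ∣_∣ (sym (e n))))) (ν ε ε>0)

  Null-0 : Null λ _ → 0ℚ
  Null-0 ε ε>0 = always λ _ → <⇒≤ ε>0

  0<½* : ∀ {ε} → 0ℚ < ε → 0ℚ < ½ * ε
  0<½* ε>0 = 0<* (positive⁻¹ ½) ε>0

  ½+½ : ∀ ε → ½ * ε + ½ * ε ≡ ε
  ½+½ ε = trans (sym (*-distribʳ-+ ε ½ ½)) (*-identityˡ ε)

  Null-+ : ∀ {s t} → Null s → Null t → Null λ n → s n + t n
  Null-+ {s} {t} ν μ ε ε>0 = eventually-map
    (λ {n} (a , b) → ≤-trans (∣p+q∣≤∣p∣+∣q∣ (s n) (t n)) (≤-trans (+-mono-≤ a b) (≤-reflexive (½+½ ε))))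
    (ν (½ * ε) (0<½* ε>0) ⋀ μ (½ * ε) (0<½* ε>0))

  Null-neg : ∀ {s} → Null s → Null λ n → - s n
  Null-neg {s} ν ε ε>0 = eventually-map (λ {n} → ≤-trans (≤-reflexive (∣-p∣≡∣p∣ (s n)))) (ν ε ε>0)

  infixl 7 _÷_
  _÷_ : ∀ p {q} → 0ℚ < q → ℚ
  _÷_ p {q} q>0 = p * (1/ q) {{pos⇒nonZero q {{positive q>0}}}}

  0<÷ : ∀ {p q} → 0ℚ < p → (q>0 : 0ℚ < q) → 0ℚ < p ÷ q>0
  0<÷ {p} {q} p>0 q>0 = 0<* p>0 (positive⁻¹ _ {{1/pos⇒pos q {{positive q>0}}}})

  *÷ : ∀ p {q} (q>0 : 0ℚ < q) → q * (p ÷ q>0) ≡ p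
  *÷ p {q} q>0 = trans (solve 3 (λ p q r → q :* (p :* r) := p :* (q :* r)) refl p q _)
    (trans (cong (p *_) (*-inverseʳ q {{pos⇒nonZero q {{positive q>0}}}})) (*-identityʳ p))

  Null-*-bounded : ∀ {s t} → Bounded s → Null t → Null λ n → s n * t n
  Null-*-bounded {s} {t} (B , b) ν ε ε>0 = eventually-map
    (λ {n} (sB , tδ) → begin
      ∣ s n * t n ∣      ≡⟨ ∣p*q∣≡∣p∣*∣q∣ (s n) (t n) ⟩
      ∣ s n ∣ * ∣ t n ∣  ≤⟨ *-mono-≤-0≤ (0≤∣p∣ (s n)) (<⇒≤ (0<÷ ε>0 C>0)) (≤-trans sB (p≤q⊔p 1ℚ B)) tδ ⟩
      C * (ε ÷ C>0)      ≡⟨ *÷ ε C>0 ⟩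
      ε                  ∎)
    (b ⋀ ν (ε ÷ C>0) (0<÷ ε>0 C>0))
    where
    open ≤-Reasoning
    C = 1ℚ ⊔ B
    C>0 : 0ℚ < C
    C>0 = <-≤-trans (positive⁻¹ 1ℚ) (p≤p⊔q 1ℚ B)

  Bounded-+ : ∀ {s t} → Bounded s → Bounded t → Bounded λ n → s n + t n
  Bounded-+ {s} {t} (B , b) (C , c) = B + C ,
    eventually-map (λ {n} (x , y) → ≤-trans (∣p+q∣≤∣p∣+∣q∣ (s n) (t n)) (+-mono-≤ x y)) (b ⋀ c)

  Bounded-* : ∀ {s t} → Bounded s → Bounded t → Bounded λ n → s n * t n
  Bounded-* {s} {t} (B , b) (C , c) = (0ℚ ⊔ B) * (0ℚ ⊔ C) , eventually-map
    (λ {n} (x , y) → ≤-trans (≤-reflexive (∣p*q∣≡∣p∣*∣q∣ (s n) (t n)))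
      (*-mono-≤-0≤ (0≤∣p∣ (s n)) (p≤p⊔q 0ℚ C) (≤-trans x (p≤q⊔p 0ℚ B)) (≤-trans y (p≤q⊔p 0ℚ C))))
    (b ⋀ c)

  Bounded-const : ∀ q → Bounded λ _ → q
  Bounded-const q = ∣ q ∣ , always λ _ → ≤-refl

  Null-divide : ∀ {s t : ℕ → ℚ} {γ} → 0ℚ < γ → Eventually (λ n → γ ≤ s n) → Null (λ n → s n * t n) → Null t
  Null-divide {s} {t} {γ} γ>0 γ≤s ν ε ε>0 =
    eventually-map step (γ≤s ⋀ ν (γ * ε) (0<* γ>0 ε>0))
    where
    open ≤-Reasoning
    step : ∀ {n} → γ ≤ s n × ∣ s n * t n ∣ ≤ γ * ε → ∣ t n ∣ ≤ ε
    step {n} (g , e) = *-cancelˡ-≤-pos γ {{positive γ>0}} (begin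
      γ * ∣ t n ∣        ≤⟨ *-monoʳ-≤-nonNeg ∣ t n ∣ {{∣-∣-nonNeg (t n)}} (≤-trans g (≤∣∣ (s n))) ⟩
      ∣ s n ∣ * ∣ t n ∣  ≡⟨ ∣p*q∣≡∣p∣*∣q∣ (s n) (t n) ⟨
      ∣ s n * t n ∣      ≤⟨ e ⟩
      γ * ε              ∎)

  const-Null⇒0 : ∀ {q} → Null (λ _ → q) → q ≡ 0ℚ
  const-Null⇒0 {q} ν = ∣p∣≡0⇒p≡0 q (≤-antisym (≮⇒≥ small) (0≤∣p∣ q))
    where
    small : ¬ (0ℚ < ∣ q ∣)
    small 0<q with eventually-witness (ν (½ * ∣ q ∣) (0<½* 0<q))
    ... | _ , h = <-irrefl refl (<-≤-trans (<-by (½ * ∣ q ∣) (solve 1 (λ x → x :- con ½ :* x := con ½ :* x) refl ∣ q ∣) (0<½* 0<q)) h)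

-- Complex numbers, and zeros of products over positive reals

module ComplexNumbers where

  open import Defs
  open RationalSequences
  open Factorisations
  open import Algebra using (IsCommutativeRing)
  open import Data.Empty using (⊥-elim)
  open import Data.Nat using (ℕ)
  import Data.Nat.Properties as ℕₚ
  open import Data.Product using (_×_; _,_; ∃-syntax; proj₁; proj₂)
  open import Data.Rational as ℚ using (ℚ; 0ℚ; 1ℚ; ½)
  import Data.Rational.Properties as ℚₚ
  open import Data.Rational.Solver using (module +-*-Solver)
  open import Data.Sum using (_⊎_; inj₁; inj₂)
  open import Data.Vec using (Vec; []; _∷_; map; foldr′)
  open import Data.Vec.Relation.Unary.All using (All; []; _∷_)
  open import Relation.Binary.PropositionalEquality using (_≡_; refl; sym; trans; cong)
  open import Relation.Nullary using (¬_)

  open +-*-Solver using (solve; _:=_; _:+_; _:*_; _:-_; :-_; con)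

  Bounded-seq : ∀ x → Bounded (seq x)
  Bounded-seq x = Lemmas.bounded (seq x) (cauchy x)

  pointwise : ∀ x y → (∀ n → seq x n ≡ seq y n) → x ≈ y
  pointwise x y e = Null-≗
    (λ n → trans (sym (ℚₚ.+-inverseʳ (seq y n))) (cong (ℚ._- seq y n) (sym (e n)))) Null-0

  ≈-refl : ∀ {x} → x ≈ x
  ≈-refl {x} = pointwise x x λ _ → refl

  ≈-sym : ∀ {x y} → x ≈ y → y ≈ x
  ≈-sym {x} {y} e = Null-≗ (λ n → solve 2 (λ a b → :- (a :- b) := b :- a) refl (seq x n) (seq y n)) (Null-neg e)

  ≈-trans : ∀ {x y z} → x ≈ y → y ≈ z → x ≈ z
  ≈-trans {x} {y} {z} e f = Null-≗
    (λ n → solve 3 (λ a b c → (a :- b) :+ (b :- c) := a :- c) refl (seq x n) (seq y n) (seq z n))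
    (Null-+ e f)

  +-cong : ∀ {x x′ y y′} → x ≈ x′ → y ≈ y′ → x + y ≈ x′ + y′
  +-cong {x} {x′} {y} {y′} e f = Null-≗
    (λ n → solve 4 (λ a b c d → (a :- b) :+ (c :- d) := (a :+ c) :- (b :+ d)) refl
      (seq x n) (seq x′ n) (seq y n) (seq y′ n))
    (Null-+ e f)

  -‿cong : ∀ {x y} → x ≈ y → - x ≈ - y
  -‿cong {x} {y} e = Null-≗
    (λ n → solve 2 (λ a b → :- (a :- b) := (:- a) :- (:- b)) refl (seq x n) (seq y n))
    (Null-neg e)

  *-cong : ∀ {x x′ y y′} → x ≈ x′ → y ≈ y′ → x * y ≈ x′ * y′
  *-cong {x} {x′} {y} {y′} e f = Null-≗
    (λ n → solve 4 (λ a b c d → a :* (c :- d) :+ d :* (a :- b) := a :* c :- b :* d) refl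
      (seq x n) (seq x′ n) (seq y n) (seq y′ n))
    (Null-+ (Null-*-bounded (Bounded-seq x) f) (Null-*-bounded (Bounded-seq y′) e))

  ≈0⇒Null : ∀ {x} → x ≈ 0ℝ → Null (seq x)
  ≈0⇒Null {x} = Null-≗ λ n → solve 1 (λ a → a :- con 0ℚ := a) refl (seq x n)

  Null⇒≈0 : ∀ {x} → Null (seq x) → x ≈ 0ℝ
  Null⇒≈0 {x} = Null-≗ λ n → solve 1 (λ a → a := a :- con 0ℚ) refl (seq x n)

  negᶜ : ℂ → ℂ
  negᶜ z = (- re z) +i (- im z)

  -- A record, so that the two sides can be inferred from the equality.
  infix 4 _≅_
  record _≅_ (w z : ℂ) : Set where
    constructor ⟪_⟫
    field toᶜ : w ≈ᶜ z
  open _≅_ public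

  componentwise : ∀ {w z} → (∀ n → seq (re w) n ≡ seq (re z) n) → (∀ n → seq (im w) n ≡ seq (im z) n) → w ≅ z
  componentwise {w} {z} e f = ⟪ pointwise (re w) (re z) e , pointwise (im w) (im z) f ⟫

  opaque
    ℂ-isCommutativeRing : IsCommutativeRing _≅_ _+ᶜ_ _*ᶜ_ negᶜ 0ᶜ 1ᶜ
    ℂ-isCommutativeRing = record
      { isRing = record
        { +-isAbelianGroup = record
          { isGroup = record
            { isMonoid = record
              { isSemigroup = record
                { isMagma = record
                  { isEquivalence = record
                    { refl  = componentwise (λ _ → refl) (λ _ → refl)
                    ; sym   = λ { {w} {z} ⟪ a , b ⟫ → ⟪ ≈-sym {re w} {re z} a , ≈-sym {im w} {im z} b ⟫ }
                    ; trans = λ { {u} {w} {z} ⟪ a , b ⟫ ⟪ c , d ⟫ →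
                        ⟪ ≈-trans {re u} {re w} {re z} a c , ≈-trans {im u} {im w} {im z} b d ⟫ } }
                  ; ∙-cong = λ { {u} {w} {x} {y} ⟪ a , b ⟫ ⟪ c , d ⟫ →
                      ⟪ +-cong {re u} {re w} {re x} {re y} a c , +-cong {im u} {im w} {im x} {im y} b d ⟫ } }
                ; assoc = λ u w z → componentwise
                    (λ n → ℚₚ.+-assoc (seq (re u) n) (seq (re w) n) (seq (re z) n))
                    (λ n → ℚₚ.+-assoc (seq (im u) n) (seq (im w) n) (seq (im z) n)) }
              ; identity =
                  (λ w → componentwise (λ n → ℚₚ.+-identityˡ (seq (re w) n)) (λ n → ℚₚ.+-identityˡ (seq (im w) n))) ,
                  (λ w → componentwise (λ n → ℚₚ.+-identityʳ (seq (re w) n)) (λ n → ℚₚ.+-identityʳ (seq (im w) n))) }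
            ; inverse =
                (λ w → componentwise (λ n → ℚₚ.+-inverseˡ (seq (re w) n)) (λ n → ℚₚ.+-inverseˡ (seq (im w) n))) ,
                (λ w → componentwise (λ n → ℚₚ.+-inverseʳ (seq (re w) n)) (λ n → ℚₚ.+-inverseʳ (seq (im w) n)))
            ; ⁻¹-cong = λ { {w} {z} ⟪ a , b ⟫ → ⟪ -‿cong {re w} {re z} a , -‿cong {im w} {im z} b ⟫ } }
          ; comm = λ w z → componentwise
              (λ n → ℚₚ.+-comm (seq (re w) n) (seq (re z) n)) (λ n → ℚₚ.+-comm (seq (im w) n) (seq (im z) n)) }
        ; *-cong = λ { {u} {w} {x} {y} ⟪ a , b ⟫ ⟪ c , d ⟫ → ⟪
            +-cong {re u * re x} {re w * re y} { - (im u * im x)} { - (im w * im y)}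
              (*-cong {re u} {re w} {re x} {re y} a c)
              (-‿cong {im u * im x} {im w * im y} (*-cong {im u} {im w} {im x} {im y} b d)) ,
            +-cong {re u * im x} {re w * im y} {im u * re x} {im w * re y}
              (*-cong {re u} {re w} {im x} {im y} a d) (*-cong {im u} {im w} {re x} {re y} b c) ⟫ }
        ; *-assoc = λ u w z → componentwise
            (λ n → solve 6 (λ a b c d e f →
              (a :* c :- b :* d) :* e :- (a :* d :+ b :* c) :* f :=
              a :* (c :* e :- d :* f) :- b :* (c :* f :+ d :* e)) refl
              (seq (re u) n) (seq (im u) n) (seq (re w) n) (seq (im w) n) (seq (re z) n) (seq (im z) n))
            (λ n → solve 6 (λ a b c d e f →
              (a :* c :- b :* d) :* f :+ (a :* d :+ b :* c) :* e :=
              a :* (c :* f :+ d :* e) :+ b :* (c :* e :- d :* f)) refl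
              (seq (re u) n) (seq (im u) n) (seq (re w) n) (seq (im w) n) (seq (re z) n) (seq (im z) n))
        ; *-identity =
            (λ w → componentwise
              (λ n → solve 2 (λ a b → con 1ℚ :* a :- con 0ℚ :* b := a) refl (seq (re w) n) (seq (im w) n))
              (λ n → solve 2 (λ a b → con 1ℚ :* b :+ con 0ℚ :* a := b) refl (seq (re w) n) (seq (im w) n))) ,
            (λ w → componentwise
              (λ n → solve 2 (λ a b → a :* con 1ℚ :- b :* con 0ℚ := a) refl (seq (re w) n) (seq (im w) n))
              (λ n → solve 2 (λ a b → a :* con 0ℚ :+ b :* con 1ℚ := b) refl (seq (re w) n) (seq (im w) n)))
        ; distrib =
            (λ u w z → componentwise
              (λ n → solve 6 (λ a b c d e f →
                a :* (c :+ e) :- b :* (d :+ f) := (a :* c :- b :* d) :+ (a :* e :- b :* f)) refl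
                (seq (re u) n) (seq (im u) n) (seq (re w) n) (seq (im w) n) (seq (re z) n) (seq (im z) n))
              (λ n → solve 6 (λ a b c d e f →
                a :* (d :+ f) :+ b :* (c :+ e) := (a :* d :+ b :* c) :+ (a :* f :+ b :* e)) refl
                (seq (re u) n) (seq (im u) n) (seq (re w) n) (seq (im w) n) (seq (re z) n) (seq (im z) n))) ,
            (λ u w z → componentwise
              (λ n → solve 6 (λ a b c d e f →
                (c :+ e) :* a :- (d :+ f) :* b := (c :* a :- d :* b) :+ (e :* a :- f :* b)) refl
                (seq (re u) n) (seq (im u) n) (seq (re w) n) (seq (im w) n) (seq (re z) n) (seq (im z) n))
              (λ n → solve 6 (λ a b c d e f →
                (c :+ e) :* b :+ (d :+ f) :* a := (c :* b :+ d :* a) :+ (e :* b :+ f :* a)) refl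
                (seq (re u) n) (seq (im u) n) (seq (re w) n) (seq (im w) n) (seq (re z) n) (seq (im z) n))) }
      ; *-comm = λ w z → componentwise
          (λ n → solve 4 (λ a b c d → a :* c :- b :* d := c :* a :- d :* b) refl
            (seq (re w) n) (seq (im w) n) (seq (re z) n) (seq (im z) n))
          (λ n → solve 4 (λ a b c d → a :* d :+ b :* c := c :* b :+ d :* a) refl
            (seq (re w) n) (seq (im w) n) (seq (re z) n) (seq (im z) n)) }

  open Factorisation ℂ-isCommutativeRing _-ᶜ_ (λ _ _ → componentwise (λ _ → refl) (λ _ → refl)) eval (λ _ → refl) (λ _ _ _ → refl) public
    using (Regular; Distinct; Zeros; factorisation; sum-of-zeros)

  real-Regular : ∀ {u γ} → 0ℚ ℚ.< γ → (∀ n → seq (im u) n ≡ 0ℚ) →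
    Eventually (λ n → γ ℚ.≤ seq (re u) n) → Regular u
  real-Regular {u} γ>0 im0 γ≤ v ⟪ e , f ⟫ = ⟪
    Null⇒≈0 {re v} (Null-divide {seq (re u)} γ>0 γ≤ (Null-≗ (λ n → trans (cong (λ z → seq (re u) n ℚ.* seq (re v) n ℚ.- z ℚ.* seq (im v) n) (im0 n))
        (solve 3 (λ a b c → a :* b :- con 0ℚ :* c := a :* b) refl (seq (re u) n) (seq (re v) n) (seq (im v) n)))
      (≈0⇒Null {re (u *ᶜ v)} e))) ,
    Null⇒≈0 {im v} (Null-divide {seq (re u)} γ>0 γ≤ (Null-≗ (λ n → trans (cong (λ z → seq (re u) n ℚ.* seq (im v) n ℚ.+ z ℚ.* seq (re v) n) (im0 n))
        (solve 3 (λ a b c → a :* b :+ con 0ℚ :* c := a :* b) refl (seq (re u) n) (seq (im v) n) (seq (re v) n)))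
      (≈0⇒Null {im (u *ᶜ v)} f))) ⟫

  -- Cotransitivity, the constructive substitute for comparing two reals: past the index where the
  -- terms stay within (b - a) / 2 of each other, a single term is compared with the midpoint of a
  -- and b.
  compare : ∀ x {a b} → a ℚ.< b → Eventually (λ n → seq x n ℚ.≤ b) ⊎ Eventually (λ n → a ℚ.≤ seq x n)
  compare x {a} {b} a<b with cauchy x δ (0<½* (<⇒0<- a<b))
    where δ = ½ ℚ.* (b ℚ.- a)
  ... | N , near with ℚₚ.≤-total (seq x N) (½ ℚ.* (a ℚ.+ b))
  ...   | inj₁ le = inj₁ (N , λ n n≥ → ≤-by
            ((½ ℚ.* (b ℚ.- a) ℚ.- (seq x n ℚ.- seq x N)) ℚ.+ (½ ℚ.* (a ℚ.+ b) ℚ.- seq x N))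
            (solve 4 (λ a b p q → b :- p := (con ½ :* (b :- a) :- (p :- q)) :+ (con ½ :* (a :+ b) :- q)) refl a b (seq x n) (seq x N))
            (0≤+ (≤⇒0≤- (ℚₚ.≤-trans (≤∣∣ _) (near n N n≥ ℕₚ.≤-refl))) (≤⇒0≤- le)))
  ...   | inj₂ ge = inj₂ (N , λ n n≥ → ≤-by
            ((½ ℚ.* (b ℚ.- a) ℚ.- (seq x N ℚ.- seq x n)) ℚ.+ (seq x N ℚ.- ½ ℚ.* (a ℚ.+ b)))
            (solve 4 (λ a b p q → p :- a := (con ½ :* (b :- a) :- (q :- p)) :+ (q :- con ½ :* (a :+ b))) refl a b (seq x n) (seq x N))
            (0≤+ (≤⇒0≤- (ℚₚ.≤-trans (≤∣∣ _) (near N n ℕₚ.≤-refl n≥))) (≤⇒0≤- ge)))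

  -- Stated for an abstract operation because unfolding Πᶜ is infeasible.
  foldr-lower-bound : ∀ {A : Set} (P : ℚ → A → Set) (_∙_ : A → A → A) (ε : A) → P 1ℚ ε →
    (∀ {γ δ} x y → 0ℚ ℚ.< γ → 0ℚ ℚ.< δ → P γ x → P δ y → P (γ ℚ.* δ) (x ∙ y)) →
    ∀ {k} (xs : Vec A k) {γ} → 0ℚ ℚ.< γ → All (P γ) xs → ∃[ δ ] 0ℚ ℚ.< δ × P δ (foldr′ _∙_ ε xs)
  foldr-lower-bound P _∙_ ε unit product []       γ>0 []       = 1ℚ , ℚₚ.positive⁻¹ 1ℚ , unit
  foldr-lower-bound P _∙_ ε unit product (x ∷ xs) γ>0 (p ∷ ps) with foldr-lower-bound P _∙_ ε unit product xs γ>0 ps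
  ... | δ , δ>0 , q = _ , 0<* γ>0 δ>0 , product x (foldr′ _∙_ ε xs) γ>0 δ>0 p q

  opaque
    -- The squared modulus, term by term. It is exactly multiplicative at each index, so lower
    -- bounds for factors multiply to one for the product.
    normSq : ℂ → ℕ → ℚ
    normSq z n = seq (re z) n ℚ.* seq (re z) n ℚ.+ seq (im z) n ℚ.* seq (im z) n

    normSq-≡ : ∀ z n → normSq z n ≡ seq (re z) n ℚ.* seq (re z) n ℚ.+ seq (im z) n ℚ.* seq (im z) n
    normSq-≡ z n = refl

    normSq-* : ∀ w z n → normSq (w *ᶜ z) n ≡ normSq w n ℚ.* normSq z n
    normSq-* w z n = solve 4 (λ a b c d →
      (a :* c :- b :* d) :* (a :* c :- b :* d) :+ (a :* d :+ b :* c) :* (a :* d :+ b :* c) :=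
      (a :* a :+ b :* b) :* (c :* c :+ d :* d)) refl
      (seq (re w) n) (seq (im w) n) (seq (re z) n) (seq (im z) n)

    normSq-Null : ∀ {z} → z ≅ 0ᶜ → Null (normSq z)
    normSq-Null {z} ⟪ e , f ⟫ = Null-+
      (Null-*-bounded (Bounded-seq (re z)) (≈0⇒Null {re z} e))
      (Null-*-bounded (Bounded-seq (im z)) (≈0⇒Null {im z} f))

  Far : ℚ → ℂ → Set
  Far γ z = Eventually λ n → γ ℚ.≤ normSq z n

  opaque
    unfolding normSq
    Far-1 : Far 1ℚ 1ᶜ
    Far-1 = always λ n → ℚₚ.≤-refl

  Far-* : ∀ {γ δ} w z → 0ℚ ℚ.< γ → 0ℚ ℚ.< δ → Far γ w → Far δ z → Far (γ ℚ.* δ) (w *ᶜ z)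
  Far-* w z γ>0 δ>0 c d = eventually-map
    (λ {n} (g , h) → ℚₚ.≤-trans (*-mono-≤-0≤ (ℚₚ.<⇒≤ γ>0) (ℚₚ.≤-trans (ℚₚ.<⇒≤ δ>0) h) g h)
      (ℚₚ.≤-reflexive (sym (normSq-* w z n)))) (c ⋀ d)

  Far-Π : ∀ {k} (zs : Vec ℂ k) {γ} → 0ℚ ℚ.< γ → All (Far γ) zs → ∃[ δ ] 0ℚ ℚ.< δ × Far δ (Πᶜ zs)
  Far-Π = foldr-lower-bound Far _*ᶜ_ 1ᶜ Far-1 Far-*

  nonzero-product : ∀ {k} (zs : Vec ℂ k) {γ} → 0ℚ ℚ.< γ → All (Far γ) zs →
    ¬ Πᶜ zs ≅ 0ᶜ
  nonzero-product zs γ>0 far Π≈0 with Far-Π zs γ>0 far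
  ... | δ , δ>0 , d with eventually-witness (d ⋀ normSq-Null {Πᶜ zs} Π≈0 (½ ℚ.* δ) (0<½* δ>0))
  ...   | n , g , h = ℚₚ.<-irrefl refl (ℚₚ.<-≤-trans half (ℚₚ.≤-trans g (ℚₚ.≤-trans (≤∣∣ _) h)))
    where
    half : ½ ℚ.* δ ℚ.< δ
    half = <-by (½ ℚ.* δ) (solve 1 (λ x → x :- con ½ :* x := con ½ :* x) refl δ) (0<½* δ>0)

  PositiveReal : ℚ → ℂ → Set
  PositiveReal γ z = (∀ n → seq (im z) n ≡ 0ℚ) × Eventually λ n → γ ℚ.≤ seq (re z) n

  module _ {k} (zs : Vec ℂ k) {γ} (γ>0 : 0ℚ ℚ.< γ) (pos : All (PositiveReal γ) zs)
    (β : ℂ) (β-zero : Πᶜ (map (β -ᶜ_) zs) ≅ 0ᶜ) where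

    private
      map-far : ∀ {k} {zs : Vec ℂ k} {δ} → (∀ z → PositiveReal γ z → Far δ (β -ᶜ z)) →
        All (PositiveReal γ) zs → All (Far δ) (map (β -ᶜ_) zs)
      map-far far []                  = []
      map-far far (_∷_ {x = z} p ps) = far z p ∷ map-far far ps

      square-≥ : ∀ {δ p} → 0ℚ ℚ.≤ δ → δ ℚ.≤ p → δ ℚ.* δ ℚ.≤ p ℚ.* p
      square-≥ 0≤δ δ≤p = *-mono-≤-0≤ 0≤δ (ℚₚ.≤-trans 0≤δ δ≤p) δ≤p δ≤p

      im-far : ∀ {δ} x → 0ℚ ℚ.< δ → (∀ n → seq x n ℚ.* seq x n ≡ seq (im β) n ℚ.* seq (im β) n) →
        ¬ Eventually λ n → δ ℚ.≤ seq x n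
      im-far {δ} x δ>0 sq far = nonzero-product (map (β -ᶜ_) zs) (0<* δ>0 δ>0)
        (map-far (λ z (im0 , _) → eventually-map (λ {n} d → begin
            δ ℚ.* δ                         ≤⟨ square-≥ (ℚₚ.<⇒≤ δ>0) d ⟩
            seq x n ℚ.* seq x n             ≡⟨ sq n ⟩
            seq (im β) n ℚ.* seq (im β) n   ≡⟨ solve 1 (λ b → b :* b := con 0ℚ :+ (b :- con 0ℚ) :* (b :- con 0ℚ)) refl (seq (im β) n) ⟩
            0ℚ ℚ.+ (seq (im β) n ℚ.- 0ℚ) ℚ.* (seq (im β) n ℚ.- 0ℚ)
              ≡⟨ cong (λ y → 0ℚ ℚ.+ (seq (im β) n ℚ.- y) ℚ.* (seq (im β) n ℚ.- y)) (im0 n) ⟨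
            0ℚ ℚ.+ (seq (im β) n ℚ.- seq (im z) n) ℚ.* (seq (im β) n ℚ.- seq (im z) n)
              ≤⟨ ℚₚ.+-monoˡ-≤ ((seq (im β) n ℚ.- seq (im z) n) ℚ.* (seq (im β) n ℚ.- seq (im z) n)) (0≤-square (seq (re β) n ℚ.- seq (re z) n)) ⟩
            _ ≡⟨ normSq-≡ (β -ᶜ z) n ⟨
            normSq (β -ᶜ z) n ∎) far) pos) β-zero
        where open ℚₚ.≤-Reasoning

    -- For each sign, `compare` shows that ± im β is eventually at most ε or at least ε / 2. In the
    -- latter case β keeps distance ε / 2 from every real number in `zs`, and the product cannot
    -- vanish.
    zero-is-real : im β ≈ 0ℝ
    zero-is-real ε ε>0 = eventually-map (λ {n} (a , b) → ∣∣≤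
        (≤-by (ε ℚ.- (ℚ.- seq (im β) n)) (solve 2 (λ e x → (x :- con 0ℚ) :- (:- e) := e :- (:- x)) refl ε (seq (im β) n)) (≤⇒0≤- b))
        (≤-by (ε ℚ.- seq (im β) n) (solve 2 (λ e x → e :- (x :- con 0ℚ) := e :- x) refl ε (seq (im β) n)) (≤⇒0≤- a)))
      (proj₁ both ⋀ proj₂ both)
      where
      half<ε : ½ ℚ.* ε ℚ.< ε
      half<ε = <-by (½ ℚ.* ε) (solve 1 (λ x → x :- con ½ :* x := con ½ :* x) refl ε) (0<½* ε>0)
      bound : ∀ {A B} → A ⊎ Eventually (λ n → ½ ℚ.* ε ℚ.≤ seq (im β) n) → B ⊎ Eventually (λ n → ½ ℚ.* ε ℚ.≤ ℚ.- seq (im β) n) → A × B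
      bound (inj₁ u)   (inj₁ l)   = u , l
      bound (inj₂ far) _          = ⊥-elim (im-far (im β) (0<½* ε>0) (λ n → refl) far)
      bound _          (inj₂ far) = ⊥-elim (im-far (- im β) (0<½* ε>0)
        (λ n → solve 1 (λ b → (:- b) :* (:- b) := b :* b) refl (seq (im β) n)) far)
      both : Eventually (λ n → seq (im β) n ℚ.≤ ε) × Eventually (λ n → ℚ.- seq (im β) n ℚ.≤ ε)
      both = bound (compare (im β) half<ε) (compare (- im β) half<ε)

    -- Either re β is eventually at least γ / 4, or it is at most γ / 2 and then β keeps distance γ
    -- / 2 from all of `zs`, whose members are at least γ.
    zero-is-positive : 0ℝ < re β
    zero-is-positive = ½ ℚ.* (½ ℚ.* γ) , 0<½* (0<½* γ>0) ,
      eventually-map (λ h → ℚₚ.≤-trans (ℚₚ.≤-reflexive (ℚₚ.+-identityˡ _)) h) (above (compare (re β) quarter<half))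
      where
      open ℚₚ.≤-Reasoning
      quarter<half : ½ ℚ.* (½ ℚ.* γ) ℚ.< ½ ℚ.* γ
      quarter<half = <-by (½ ℚ.* (½ ℚ.* γ)) (solve 1 (λ x → x :- con ½ :* x := con ½ :* x) refl (½ ℚ.* γ)) (0<½* (0<½* γ>0))
      above : ∀ {A} → Eventually (λ n → seq (re β) n ℚ.≤ ½ ℚ.* γ) ⊎ A → A
      above (inj₂ far)  = far
      above (inj₁ near) = ⊥-elim (nonzero-product (map (β -ᶜ_) zs) (0<* (0<½* γ>0) (0<½* γ>0))
        (map-far (λ z (_ , g) → eventually-map (λ {n} (a , b) → begin
            ½ ℚ.* γ ℚ.* (½ ℚ.* γ)
              ≤⟨ square-≥ {½ ℚ.* γ} {seq (re z) n ℚ.- seq (re β) n} (ℚₚ.<⇒≤ (0<½* γ>0)) (≤-by ((½ ℚ.* γ ℚ.- seq (re β) n) ℚ.+ (seq (re z) n ℚ.- γ))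
                   (solve 3 (λ g b z → (z :- b) :- con ½ :* g := (con ½ :* g :- b) :+ (z :- g)) refl γ (seq (re β) n) (seq (re z) n))
                   (0≤+ (≤⇒0≤- a) (≤⇒0≤- b))) ⟩
            (seq (re z) n ℚ.- seq (re β) n) ℚ.* (seq (re z) n ℚ.- seq (re β) n)
              ≡⟨ solve 2 (λ b z → (z :- b) :* (z :- b) := (b :- z) :* (b :- z) :+ con 0ℚ) refl (seq (re β) n) (seq (re z) n) ⟩
            (seq (re β) n ℚ.- seq (re z) n) ℚ.* (seq (re β) n ℚ.- seq (re z) n) ℚ.+ 0ℚ
              ≤⟨ ℚₚ.+-monoʳ-≤ ((seq (re β) n ℚ.- seq (re z) n) ℚ.* (seq (re β) n ℚ.- seq (re z) n)) (0≤-square (seq (im β) n ℚ.- seq (im z) n)) ⟩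
            _ ≡⟨ normSq-≡ (β -ᶜ z) n ⟨
            normSq (β -ᶜ z) n ∎) (near ⋀ g)) pos) β-zero)

-- Evaluation at rational points, Lipschitz functions and bisection

module Intervals where

  open import Defs using (Eventually; Cauchy)
  open RationalSequences
  open Irreducibility using (module ℤ[x])
  open BasePolynomials
  open import Data.Integer as ℤ using (ℤ; +_; -[1+_]; 0ℤ; 1ℤ)
  import Data.Integer.Properties as ℤₚ
  open import Data.List using ([]; _∷_)
  open import Data.Nat as ℕ using (ℕ; zero; suc)
  import Data.Nat.Properties as ℕₚ
  open import Data.Product using (_×_; _,_; ∃-syntax)
  open import Data.Rational as ℚ hiding (_÷_)
  open import Data.Rational.Properties
  open import Data.Rational.Unnormalised as ℚᵘ using (mkℚᵘ; *≡*)
  import Data.Rational.Unnormalised.Properties as ℚᵘₚ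
  open import Data.Rational.Solver using (module +-*-Solver)
  open import Data.Sum using (inj₁; inj₂)
  open import Relation.Binary.PropositionalEquality using (_≡_; refl; sym; trans; cong; cong₂)
  open +-*-Solver using (solve; _:=_; _:+_; _:*_; _:-_; :-_; con)
  open ℤ[x] hiding (at)

  ι : ℤ → ℚ
  ι a = a ℚ./ 1

  toℚᵘ-ι : ∀ a → toℚᵘ (ι a) ℚᵘ.≃ mkℚᵘ a 0
  toℚᵘ-ι a = toℚᵘ-fromℚᵘ (mkℚᵘ a 0)

  ι-+ : ∀ a b → ι (a ℤ.+ b) ≡ ι a + ι b
  ι-+ a b = toℚᵘ-injective (begin
    toℚᵘ (ι (a ℤ.+ b))            ≈⟨ toℚᵘ-ι (a ℤ.+ b) ⟩
    mkℚᵘ (a ℤ.+ b) 0              ≈⟨ *≡* (cong (ℤ._* 1ℤ) (cong₂ ℤ._+_ (sym (ℤₚ.*-identityʳ a)) (sym (ℤₚ.*-identityʳ b)))) ⟩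
    mkℚᵘ a 0 ℚᵘ.+ mkℚᵘ b 0        ≈⟨ ℚᵘₚ.+-cong (toℚᵘ-ι a) (toℚᵘ-ι b) ⟨
    toℚᵘ (ι a) ℚᵘ.+ toℚᵘ (ι b)    ≈⟨ toℚᵘ-homo-+ (ι a) (ι b) ⟨
    toℚᵘ (ι a + ι b)              ∎)
    where open ℚᵘₚ.≃-Reasoning

  ι-* : ∀ a b → ι (a ℤ.* b) ≡ ι a * ι b
  ι-* a b = toℚᵘ-injective (begin
    toℚᵘ (ι (a ℤ.* b))            ≈⟨ toℚᵘ-ι (a ℤ.* b) ⟩
    mkℚᵘ a 0 ℚᵘ.* mkℚᵘ b 0        ≈⟨ ℚᵘₚ.*-cong (toℚᵘ-ι a) (toℚᵘ-ι b) ⟨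
    toℚᵘ (ι a) ℚᵘ.* toℚᵘ (ι b)    ≈⟨ toℚᵘ-homo-* (ι a) (ι b) ⟨
    toℚᵘ (ι a * ι b)              ∎)
    where open ℚᵘₚ.≃-Reasoning

  ι-mono : ∀ {a b} → a ℤ.≤ b → ι a ≤ ι b
  ι-mono {a} {b} a≤b = toℚᵘ-cancel-≤ (ℚᵘₚ.≤-respˡ-≃ (ℚᵘₚ.≃-sym (toℚᵘ-ι a)) (ℚᵘₚ.≤-respʳ-≃ (ℚᵘₚ.≃-sym (toℚᵘ-ι b))
    (ℚᵘ.*≤* (ℤₚ.*-monoʳ-≤-nonNeg 1ℤ a≤b))))

  ι-injective-0 : ∀ {a} → ι a ≡ 0ℚ → a ≡ 0ℤ
  ι-injective-0 {a} e with ℚᵘₚ.≃-trans (ℚᵘₚ.≃-sym (toℚᵘ-ι a)) (ℚᵘₚ.≃-reflexive (cong toℚᵘ e))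
  ... | *≡* eq = trans (sym (ℤₚ.*-identityʳ a)) eq

  archimedean : ∀ q → ∃[ n ] q ≤ ι (+ n)
  archimedean q@(mkℚ _ _ _) = ℤ.∣ ↥ q ∣ , toℚᵘ-cancel-≤ (ℚᵘₚ.≤-respʳ-≃ (ℚᵘₚ.≃-sym (toℚᵘ-ι (+ ℤ.∣ ↥ q ∣)))
    (ℚᵘ.*≤* (ℤₚ.≤-trans (ℤₚ.≤-reflexive (ℤₚ.*-identityʳ (↥ q))) (bound (↥ q) (↧ₙ q)))))
    where
    bound : ∀ i d .{{_ : ℕ.NonZero d}} → i ℤ.≤ + ℤ.∣ i ∣ ℤ.* + d
    bound (+ n) d = ℤₚ.≤-trans (ℤ.+≤+ (ℕₚ.m≤m*n n d)) (ℤₚ.≤-reflexive (ℤₚ.pos-* n d))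
    bound -[1+ n ] d = ℤₚ.≤-trans ℤ.-≤+ (ℤₚ.≤-reflexive (ℤₚ.pos-* (suc n) d))

  ev : Poly → ℚ → ℚ
  ev []      x = 0ℚ
  ev (a ∷ p) x = ι a + x * ev p x

  ev-zero : ∀ {p} → p ≋ [] → ∀ x → ev p x ≡ 0ℚ
  ev-zero {[]}    e x = refl
  ev-zero {a ∷ p} e x = trans (cong₂ (λ a y → ι a + x * y) (ℤ[x].at e 0) (ev-zero {p} (coeffs λ i → ℤ[x].at e (suc i)) x))
    (solve 1 (λ x → con 0ℚ :+ x :* con 0ℚ := con 0ℚ) refl x)

  ev-≋ : ∀ {p q} → p ≋ q → ∀ x → ev p x ≡ ev q x
  ev-≋ {[]}    {q}     e x = sym (ev-zero (≋-sym e) x)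
  ev-≋ {a ∷ p} {[]}    e x = ev-zero e x
  ev-≋ {a ∷ p} {b ∷ q} e x = cong₂ (λ a y → ι a + x * y) (ℤ[x].at e 0) (ev-≋ (tail-cong e) x)

  ev-⊕ : ∀ p q x → ev (p ⊕ q) x ≡ ev p x + ev q x
  ev-⊕ []      q       x = sym (+-identityˡ _)
  ev-⊕ (a ∷ p) []      x = sym (+-identityʳ _)
  ev-⊕ (a ∷ p) (b ∷ q) x = trans (cong₂ (λ c y → c + x * y) (ι-+ a b) (ev-⊕ p q x))
    (solve 5 (λ a b x p q → (a :+ b) :+ x :* (p :+ q) := (a :+ x :* p) :+ (b :+ x :* q)) refl (ι a) (ι b) x (ev p x) (ev q x))

  ev-· : ∀ a p x → ev (a · p) x ≡ ι a * ev p x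
  ev-· a []      x = sym (*-zeroʳ (ι a))
  ev-· a (b ∷ p) x = trans (cong₂ (λ c y → c + x * y) (ι-* a b) (ev-· a p x))
    (solve 4 (λ a b x p → a :* b :+ x :* (a :* p) := a :* (b :+ x :* p)) refl (ι a) (ι b) x (ev p x))

  ev-⊗ : ∀ p q x → ev (p ⊗ q) x ≡ ev p x * ev q x
  ev-⊗ []      q x = sym (*-zeroˡ (ev q x))
  ev-⊗ (a ∷ p) q x = trans (ev-⊕ (a · q) (0ℤ ∷ p ⊗ q) x)
    (trans (cong₂ (λ y z → y + (0ℚ + x * z)) (ev-· a q x) (ev-⊗ p q x))
      (solve 4 (λ a x p q → a :* q :+ (con 0ℚ :+ x :* (p :* q)) := (a :+ x :* p) :* q) refl (ι a) x (ev p x) (ev q x)))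

  infix 4 _∈[_,_]
  _∈[_,_] : ℚ → ℚ → ℚ → Set
  x ∈[ l , r ] = l ≤ x × x ≤ r

  ∈-within : ∀ {l r p q x} → l ≤ p → q ≤ r → x ∈[ p , q ] → x ∈[ l , r ]
  ∈-within l≤p q≤r (a , b) = ≤-trans l≤p a , ≤-trans b q≤r

  -- This form of continuity is closed under the operations used here and turns the width of a
  -- bracket directly into a bound for the variation of h on it.
  record Lipschitz (l r : ℚ) (h : ℚ → ℚ) : Set where
    constructor lipschitz
    field
      constant   : ℚ
      nonneg     : 0ℚ ≤ constant
      contracts  : ∀ {x y} → x ∈[ l , r ] → y ∈[ l , r ] → ∣ h x - h y ∣ ≤ constant * ∣ x - y ∣

  Lipschitz-within : ∀ {l r p q h} → l ≤ p → q ≤ r → Lipschitz l r h → Lipschitz p q h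
  Lipschitz-within a b (lipschitz L nn c) = lipschitz L nn λ i j → c (∈-within a b i) (∈-within a b j)

  Lipschitz-const : ∀ {l r} q → Lipschitz l r λ _ → q
  Lipschitz-const q = lipschitz 0ℚ ≤-refl λ {x} {y} _ _ →
    ≤-reflexive (trans (cong ∣_∣ (+-inverseʳ q)) (sym (*-zeroˡ ∣ x - y ∣)))

  Lipschitz-id : ∀ {l r} → Lipschitz l r λ x → x
  Lipschitz-id = lipschitz 1ℚ (<⇒≤ (positive⁻¹ 1ℚ)) λ {x} {y} _ _ → ≤-reflexive (sym (*-identityˡ ∣ x - y ∣))

  Lipschitz-+ : ∀ {l r g h} → Lipschitz l r g → Lipschitz l r h → Lipschitz l r λ x → g x + h x
  Lipschitz-+ {g = g} {h} (lipschitz K k c) (lipschitz L m d) = lipschitz (K + L) (0≤+ k m) λ {x} {y} i j → begin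
    ∣ g x + h x - (g y + h y) ∣            ≡⟨ cong ∣_∣ (solve 4 (λ a b c d → a :+ b :- (c :+ d) := (a :- c) :+ (b :- d)) refl (g x) (h x) (g y) (h y)) ⟩
    ∣ (g x - g y) + (h x - h y) ∣          ≤⟨ ∣p+q∣≤∣p∣+∣q∣ (g x - g y) (h x - h y) ⟩
    ∣ g x - g y ∣ + ∣ h x - h y ∣          ≤⟨ +-mono-≤ (c i j) (d i j) ⟩
    K * ∣ x - y ∣ + L * ∣ x - y ∣          ≡⟨ *-distribʳ-+ ∣ x - y ∣ K L ⟨
    (K + L) * ∣ x - y ∣                    ∎
    where open ≤-Reasoning

  Lipschitz-bounded : ∀ {l r h} → l ≤ r → Lipschitz l r h → ∃[ B ] 0ℚ ≤ B × (∀ {x} → x ∈[ l , r ] → ∣ h x ∣ ≤ B)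
  Lipschitz-bounded {l} {r} {h} l≤r (lipschitz L nn c) = ∣ h l ∣ + L * (r - l) , 0≤+ (0≤∣p∣ (h l)) (0≤* nn (≤⇒0≤- l≤r)) ,
    λ {x} (l≤x , x≤r) → begin
      ∣ h x ∣                        ≡⟨ cong ∣_∣ (solve 2 (λ a b → b := a :+ (b :- a)) refl (h l) (h x)) ⟩
      ∣ h l + (h x - h l) ∣          ≤⟨ ∣p+q∣≤∣p∣+∣q∣ (h l) (h x - h l) ⟩
      ∣ h l ∣ + ∣ h x - h l ∣        ≤⟨ +-monoʳ-≤ ∣ h l ∣ (c (l≤x , x≤r) (≤-refl , l≤r)) ⟩
      ∣ h l ∣ + L * ∣ x - l ∣        ≡⟨ cong (λ z → ∣ h l ∣ + L * z) (0≤p⇒∣p∣≡p (≤⇒0≤- l≤x)) ⟩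
      ∣ h l ∣ + L * (x - l)          ≤⟨ +-monoʳ-≤ ∣ h l ∣ (*-monoˡ-≤-nonNeg L {{nonNegative nn}} (+-monoˡ-≤ (- l) x≤r)) ⟩
      ∣ h l ∣ + L * (r - l)          ∎
    where open ≤-Reasoning

  product-difference : ∀ {A B K L z} a b c d → 0ℚ ≤ K → 0ℚ ≤ L → 0ℚ ≤ z →
    ∣ a ∣ ≤ A → ∣ d ∣ ≤ B → ∣ b - d ∣ ≤ L * z → ∣ a - c ∣ ≤ K * z → ∣ a * b - c * d ∣ ≤ (A * L + B * K) * z
  product-difference {A} {B} {K} {L} {z} a b c d 0≤K 0≤L 0≤z a≤A d≤B b-d a-c = begin
    ∣ a * b - c * d ∣
      ≡⟨ cong ∣_∣ (solve 4 (λ a b c d → a :* b :- c :* d := a :* (b :- d) :+ d :* (a :- c)) refl a b c d) ⟩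
    ∣ a * (b - d) + d * (a - c) ∣
      ≤⟨ ∣p+q∣≤∣p∣+∣q∣ (a * (b - d)) (d * (a - c)) ⟩
    ∣ a * (b - d) ∣ + ∣ d * (a - c) ∣
      ≡⟨ cong₂ _+_ (∣p*q∣≡∣p∣*∣q∣ a (b - d)) (∣p*q∣≡∣p∣*∣q∣ d (a - c)) ⟩
    ∣ a ∣ * ∣ b - d ∣ + ∣ d ∣ * ∣ a - c ∣
      ≤⟨ +-mono-≤ (*-mono-≤-0≤ (0≤∣p∣ a) (0≤* 0≤L 0≤z) a≤A b-d) (*-mono-≤-0≤ (0≤∣p∣ d) (0≤* 0≤K 0≤z) d≤B a-c) ⟩
    A * (L * z) + B * (K * z)
      ≡⟨ solve 5 (λ A B K L z → A :* (L :* z) :+ B :* (K :* z) := (A :* L :+ B :* K) :* z) refl A B K L z ⟩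
    (A * L + B * K) * z ∎
    where open ≤-Reasoning

  Lipschitz-* : ∀ {l r g h} → l ≤ r → Lipschitz l r g → Lipschitz l r h → Lipschitz l r λ x → g x * h x
  Lipschitz-* {g = g} {h} l≤r G@(lipschitz K k c) H@(lipschitz L m d) =
    let A , 0≤A , gA = Lipschitz-bounded l≤r G
        B , 0≤B , hB = Lipschitz-bounded l≤r H
    in lipschitz (A * L + B * K) (0≤+ (0≤* 0≤A m) (0≤* 0≤B k)) λ {x} {y} i j →
      product-difference (g x) (h x) (g y) (h y) k m (0≤∣p∣ (x - y)) (gA i) (hB j) (d i j) (c i j)

  Lipschitz-neg : ∀ {l r h} → Lipschitz l r h → Lipschitz l r λ x → - h x
  Lipschitz-neg {h = h} (lipschitz L nn c) = lipschitz L nn λ {x} {y} i j →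
    ≤-trans (≤-reflexive (trans (cong ∣_∣ (solve 2 (λ a b → (:- a) :- (:- b) := :- (a :- b)) refl (h x) (h y))) (∣-p∣≡∣p∣ (h x - h y)))) (c i j)

  Lipschitz-ev : ∀ {l r} → l ≤ r → ∀ p → Lipschitz l r (ev p)
  Lipschitz-ev l≤r []      = Lipschitz-const 0ℚ
  Lipschitz-ev l≤r (a ∷ p) = Lipschitz-+ (Lipschitz-const (ι a)) (Lipschitz-* l≤r Lipschitz-id (Lipschitz-ev l≤r p))

  ½^ : ℕ → ℚ
  ½^ zero    = 1ℚ
  ½^ (suc n) = ½ * ½^ n

  0≤½^ : ∀ n → 0ℚ ≤ ½^ n
  0≤½^ zero    = <⇒≤ (positive⁻¹ 1ℚ)
  0≤½^ (suc n) = 0≤* (<⇒≤ (positive⁻¹ ½)) (0≤½^ n)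

  -- Brings the archimedean property to bear on the powers of 1/2.
  ½^-harmonic : ∀ n → ι (+ suc n) * ½^ n ≤ 1ℚ
  ½^-harmonic zero    = ≤-refl
  ½^-harmonic (suc n) = ≤-trans (≤-by (½ * (ι (+ n) * ½^ n))
    (trans (cong₂ (λ u v → u * ½^ n - v * (½ * ½^ n)) (ι-+ 1ℤ (+ n)) (trans (ι-+ 1ℤ (+ suc n)) (cong (_+_ 1ℚ) (ι-+ 1ℤ (+ n)))))
      (solve 2 (λ m w → (con 1ℚ :+ m) :* w :- (con 1ℚ :+ (con 1ℚ :+ m)) :* (con ½ :* w) := con ½ :* (m :* w)) refl (ι (+ n)) (½^ n)))
    (0≤* (<⇒≤ (positive⁻¹ ½)) (0≤* (ι-mono {0ℤ} {+ n} (ℤ.+≤+ ℕ.z≤n)) (0≤½^ n)))) (½^-harmonic n)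

  ½^-small : ∀ C → 0ℚ ≤ C → ∀ ε → 0ℚ < ε → Eventually λ n → C * ½^ n ≤ ε
  ½^-small C 0≤C ε ε>0 with archimedean (C ÷ ε>0)
  ... | N , C/ε≤N = N , λ n N≤n → begin
    C * ½^ n                         ≡⟨ cong (_* ½^ n) (*÷ C ε>0) ⟨
    ε * (C ÷ ε>0) * ½^ n             ≤⟨ *-monoʳ-≤-nonNeg (½^ n) {{nonNegative (0≤½^ n)}} (*-monoˡ-≤-nonNeg ε {{nonNegative (<⇒≤ ε>0)}}
                                         (≤-trans C/ε≤N (ι-mono (ℤ.+≤+ (ℕₚ.m≤n⇒m≤1+n N≤n))))) ⟩
    ε * ι (+ suc n) * ½^ n           ≡⟨ *-assoc ε (ι (+ suc n)) (½^ n) ⟩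
    ε * (ι (+ suc n) * ½^ n)         ≤⟨ *-monoˡ-≤-nonNeg ε {{nonNegative (<⇒≤ ε>0)}} (½^-harmonic n) ⟩
    ε * 1ℚ                           ≡⟨ *-identityʳ ε ⟩
    ε                                ∎
    where open ≤-Reasoning

  difference-bound : ∀ x y {ε} → x - y ≤ ε → y - x ≤ ε → ∣ x - y ∣ ≤ ε
  difference-bound x y a b = ∣∣≤
    (≤-trans (neg-antimono-≤ b) (≤-reflexive (solve 2 (λ a b → :- (b :- a) := a :- b) refl x y))) a

  -- Functions take rationals to rationals, so the sign at a midpoint is decidable. The lower ends
  -- of the brackets form the zero.
  module Bisection (h : ℚ → ℚ) {p q : ℚ} (p≤q : p ≤ q) (hp≤0 : h p ≤ 0ℚ) (0≤hq : 0ℚ ≤ h q) where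

    record Bracket : Set where
      constructor bracket
      field
        lo hi  : ℚ
        p≤lo   : p ≤ lo
        lo≤hi  : lo ≤ hi
        hi≤q   : hi ≤ q
        below  : h lo ≤ 0ℚ
        above  : 0ℚ ≤ h hi
    open Bracket

    lo≤mid : ∀ B → lo B ≤ ½ * (lo B + hi B)
    lo≤mid B = ≤-by (½ * (hi B - lo B)) (solve 2 (λ a b → con ½ :* (a :+ b) :- a := con ½ :* (b :- a)) refl (lo B) (hi B))
      (0≤* (<⇒≤ (positive⁻¹ ½)) (≤⇒0≤- (lo≤hi B)))

    mid≤hi : ∀ B → ½ * (lo B + hi B) ≤ hi B
    mid≤hi B = ≤-by (½ * (hi B - lo B)) (solve 2 (λ a b → b :- con ½ :* (a :+ b) := con ½ :* (b :- a)) refl (lo B) (hi B))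
      (0≤* (<⇒≤ (positive⁻¹ ½)) (≤⇒0≤- (lo≤hi B)))

    record Halved (B : Bracket) : Set where
      constructor halved
      field
        next  : Bracket
        rises : lo B ≤ lo next
        falls : hi next ≤ hi B
        width : hi next - lo next ≡ ½ * (hi B - lo B)
    open Halved

    halve : ∀ B → Halved B
    halve B with ≤-total (h (½ * (lo B + hi B))) 0ℚ
    ... | inj₁ le = halved (bracket _ (hi B) (≤-trans (p≤lo B) (lo≤mid B)) (mid≤hi B) (hi≤q B) le (above B)) (lo≤mid B) ≤-refl
          (solve 2 (λ a b → b :- con ½ :* (a :+ b) := con ½ :* (b :- a)) refl (lo B) (hi B))
    ... | inj₂ ge = halved (bracket (lo B) _ (p≤lo B) (lo≤mid B) (≤-trans (mid≤hi B) (hi≤q B)) (below B) ge) ≤-refl (mid≤hi B)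
          (solve 2 (λ a b → con ½ :* (a :+ b) :- a := con ½ :* (b :- a)) refl (lo B) (hi B))

    brackets : ℕ → Bracket
    brackets zero    = bracket p q ≤-refl p≤q ≤-refl hp≤0 0≤hq
    brackets (suc n) = next (halve (brackets n))

    width-½^ : ∀ n → hi (brackets n) - lo (brackets n) ≡ (q - p) * ½^ n
    width-½^ zero    = sym (*-identityʳ (q - p))
    width-½^ (suc n) = trans (width (halve (brackets n))) (trans (cong (½ *_) (width-½^ n))
      (solve 2 (λ w x → con ½ :* (w :* x) := w :* (con ½ :* x)) refl (q - p) (½^ n)))

    lo-mono : ∀ {m n} → m ℕ.≤ n → lo (brackets m) ≤ lo (brackets n)
    lo-mono {n = n} m≤n with ℕₚ.m≤n⇒m<n∨m≡n m≤n
    ... | inj₂ refl = ≤-refl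
    lo-mono {n = suc n} m≤n | inj₁ (ℕ.s≤s m≤n′) = ≤-trans (lo-mono m≤n′) (rises (halve (brackets n)))

    hi-mono : ∀ {m n} → m ℕ.≤ n → hi (brackets n) ≤ hi (brackets m)
    hi-mono {n = n} m≤n with ℕₚ.m≤n⇒m<n∨m≡n m≤n
    ... | inj₂ refl = ≤-refl
    hi-mono {n = suc n} m≤n | inj₁ (ℕ.s≤s m≤n′) = ≤-trans (falls (halve (brackets n))) (hi-mono m≤n′)

    zeros : ℕ → ℚ
    zeros n = lo (brackets n)

    zeros∈ : ∀ n → zeros n ∈[ p , q ]
    zeros∈ n = p≤lo (brackets n) , ≤-trans (lo≤hi (brackets n)) (hi≤q (brackets n))

    zeros-near : ∀ {N m n} → N ℕ.≤ m → N ℕ.≤ n → zeros m - zeros n ≤ (q - p) * ½^ N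
    zeros-near {N} {m} {n} N≤m N≤n = ≤-trans
      (+-mono-≤ (≤-trans (lo≤hi (brackets m)) (hi-mono N≤m)) (neg-antimono-≤ (lo-mono N≤n)))
      (≤-reflexive (width-½^ N))

    zeros-cauchy : Cauchy zeros
    zeros-cauchy ε ε>0 =
      let N , small = ½^-small (q - p) (≤⇒0≤- p≤q) ε ε>0
          near = λ {m} {n} (m≥ : N ℕ.≤ m) (n≥ : N ℕ.≤ n) → ≤-trans (zeros-near m≥ n≥) (small N ℕₚ.≤-refl)
      in N , λ m n m≥ n≥ → difference-bound (zeros m) (zeros n) (near m≥ n≥) (near n≥ m≥)

    module _ (L : Lipschitz p q h) where
      open Lipschitz L

      -- Since h ≥ 0 at the upper end, h at the lower end is no less than minus its variation over
      -- the bracket.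
      h-zeros : ∀ n → - (constant * (q - p) * ½^ n) ≤ h (zeros n)
      h-zeros n = ≤-by ((constant * ((q - p) * ½^ n) - (h b - h a)) + h b)
        (solve 5 (λ K w x a b → a :- (:- (K :* w :* x)) := (K :* (w :* x) :- (b :- a)) :+ b) refl constant (q - p) (½^ n) (h a) (h b))
        (0≤+ (≤⇒0≤- (begin
          h b - h a            ≤⟨ ≤∣∣ (h b - h a) ⟩
          ∣ h b - h a ∣        ≤⟨ contracts (≤-trans (p≤lo B) (lo≤hi B) , hi≤q B) (p≤lo B , ≤-trans (lo≤hi B) (hi≤q B)) ⟩
          constant * ∣ b - a ∣ ≡⟨ cong (constant *_) (trans (0≤p⇒∣p∣≡p (≤⇒0≤- (lo≤hi B))) (width-½^ n)) ⟩
          constant * ((q - p) * ½^ n) ∎)) (above B))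
        where
        open ≤-Reasoning
        B = brackets n
        a = lo B
        b = hi B

      small-at-zeros : ∀ ε → 0ℚ < ε → Eventually λ n → - ε ≤ h (zeros n) × h (zeros n) ≤ 0ℚ
      small-at-zeros ε ε>0 = eventually-map (λ {n} s → ≤-trans (neg-antimono-≤ s) (h-zeros n) , below (brackets n))
        (½^-small (constant * (q - p)) (0≤* nonneg (≤⇒0≤- p≤q)) ε ε>0)

      zeros-Null : Null λ n → h (zeros n)
      zeros-Null ε ε>0 = eventually-map (λ (a , b) → ∣∣≤ a (≤-trans b (<⇒≤ ε>0))) (small-at-zeros ε ε>0)

  -- A given value need not be attained at a rational point, so the target is an interval. Bisection
  -- for h - b keeps the values at most b and brings them within b - a of it.
  intermediate-value : ∀ {h p q a b} → p ≤ q → Lipschitz p q h → h p ≤ a → a < b → b ≤ h q →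
    ∃[ x ] x ∈[ p , q ] × h x ∈[ a , b ]
  intermediate-value {h} {p} {q} {a} {b} p≤q L hp≤a a<b b≤hq =
    let n , l , u = eventually-witness (small-at-zeros (Lipschitz-+ L (Lipschitz-const (- b))) (b - a) (<⇒0<- a<b))
    in zeros n , zeros∈ n , shift (h (zeros n)) l u
    where
    open Bisection (λ x → h x + - b) p≤q
      (≤-trans (+-monoˡ-≤ (- b) (≤-trans hp≤a (<⇒≤ a<b))) (≤-reflexive (+-inverseʳ b))) (≤⇒0≤- b≤hq)
    shift : ∀ z → - (b - a) ≤ z + - b → z + - b ≤ 0ℚ → z ∈[ a , b ]
    shift z l u =
      ≤-by (z + - b - (- (b - a))) (solve 3 (λ a b z → z :- a := (z :+ :- b) :- (:- (b :- a))) refl a b z) (≤⇒0≤- l) ,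
      ≤-by (0ℚ - (z + - b)) (solve 2 (λ b z → b :- z := con 0ℚ :- (z :+ :- b)) refl b z) (≤⇒0≤- u)

  -- Consecutive intervals with disjoint interiors between l and r.
  data Chain (P : ℚ → ℚ → Set) : ℚ → ℚ → ℕ → Set where
    []   : ∀ {l r} → l ≤ r → Chain P l r 0
    cell : ∀ {l p q r n} → l ≤ p → p < q → P p q → Chain P q r n → Chain P l r (suc n)

  refine-chain : ∀ {P Q : ℚ → ℚ → Set} →
    (∀ {p q} → p < q → P p q → ∃[ m ] ∃[ m′ ] (p < m × m < m′ × m′ < q) × Q p m × Q m m′ × Q m′ q) →
    ∀ {l r n} → Chain P l r n → Chain Q l r (n ℕ.* 3)
  refine-chain split ([] l≤r) = [] l≤r
  refine-chain split (cell l≤p p<q P rest) with split p<q P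
  ... | m , m′ , (a , b , c) , x , y , z =
    cell l≤p a x (cell ≤-refl b y (cell ≤-refl c z (refine-chain split rest)))

  map-chain : ∀ {P Q : ℚ → ℚ → Set} → (∀ {p q} → p < q → P p q → Q p q) →
    ∀ {l r n} → Chain P l r n → Chain Q l r n
  map-chain g ([] l≤r)            = [] l≤r
  map-chain g (cell l≤p p<q P ch) = cell l≤p p<q (g p<q P) (map-chain g ch)

-- Iteration of the cubic on intervals

module Dynamics where

  open import Defs using (Eventually; ℝ; mkℝ; seq)
  open RationalSequences
  open Intervals
  open Irreducibility using (module ℤ[x])

  open BasePolynomials
  open Family using (N; D; H; 3^_)
  open import Data.Empty using (⊥-elim)
  open import Data.Integer using (+_; -[1+_])
  open import Data.Nat as ℕ using (ℕ; zero; suc)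
  open import Data.Product using (_×_; _,_; ∃-syntax; proj₁; proj₂)
  open import Data.Rational as ℚ hiding (_÷_)
  open import Data.Rational.Properties
  open import Data.Rational.Solver using (module +-*-Solver)
  open import Data.Sum using (_⊎_; inj₁; inj₂)
  open import Relation.Binary.PropositionalEquality using (_≡_; _≢_; refl; sym; trans; cong; cong₂; subst; module ≡-Reasoning)
  open import Relation.Nullary using (yes; no)
  open import Relation.Nullary.Decidable using (from-yes)
  open import Relation.Binary.Definitions using (Tri; tri<; tri≈; tri>)
  import Data.Nat.Properties as ℕₚ
  open +-*-Solver using (solve; _:=_; _:+_; _:*_; _:-_; :-_; con)
  open ℤ[x] using (_⊗_; _⊕_; _·_)

  -- The junk value is inverse 0 = 0.
  inverse : ℚ → ℚ
  inverse q with q ≟ 0ℚ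
  ... | yes _   = 0ℚ
  ... | no  q≢0 = (1/ q) {{≢-nonZero q≢0}}

  *-inverse : ∀ {q} → q ≢ 0ℚ → q * inverse q ≡ 1ℚ
  *-inverse {q} q≢0 with q ≟ 0ℚ
  ... | yes q≡0 = ⊥-elim (q≢0 q≡0)
  ... | no  q≢0 = *-inverseʳ q {{≢-nonZero q≢0}}

  -- The sign and the margin κ are uniform on the interval; the margin yields the Lipschitz constant
  -- of 1 / h.
  record AwayFrom0 (h : ℚ → ℚ) (p q : ℚ) : Set where
    constructor away
    field
      sign κ  : ℚ
      unit    : sign * sign ≡ 1ℚ
      κ>0     : 0ℚ < κ
      bounded : ∀ {x} → x ∈[ p , q ] → κ ≤ sign * h x

  AwayFrom0-within : ∀ {h l r p q} → l ≤ p → q ≤ r → AwayFrom0 h l r → AwayFrom0 h p q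
  AwayFrom0-within a b (away σ κ u κ>0 bd) = away σ κ u κ>0 λ i → bd (∈-within a b i)

  module _ {h p q} (A : AwayFrom0 h p q) where
    open AwayFrom0 A

    away⇒≢0 : ∀ {x} → x ∈[ p , q ] → h x ≢ 0ℚ
    away⇒≢0 {x} i e = <-irrefl refl (<-≤-trans κ>0 (≤-trans (bounded i) (≤-reflexive (trans (cong (sign *_) e) (*-zeroʳ sign)))))

    square-≥ : ∀ {x y} → x ∈[ p , q ] → y ∈[ p , q ] → κ * κ ≤ h x * h y
    square-≥ {x} {y} i j = begin
      κ * κ                            ≤⟨ *-mono-≤-0≤ (<⇒≤ κ>0) (≤-trans (<⇒≤ κ>0) (bounded j)) (bounded i) (bounded j) ⟩
      sign * h x * (sign * h y)        ≡⟨ solve 3 (λ s a b → s :* a :* (s :* b) := s :* s :* (a :* b)) refl sign (h x) (h y) ⟩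
      sign * sign * (h x * h y)        ≡⟨ trans (cong (_* (h x * h y)) unit) (*-identityˡ _) ⟩
      h x * h y                        ∎
      where open ≤-Reasoning

    -- 1 / h(x) - 1 / h(y) is (h(y) - h(x)) / (h(x) h(y)), and the denominator is at least κ².
    Lipschitz-inverse : Lipschitz p q h → Lipschitz p q λ x → inverse (h x)
    Lipschitz-inverse (lipschitz L nn c) = lipschitz (L ÷ κκ>0) (0≤* nn (<⇒≤ (positive⁻¹ _ {{1/pos⇒pos (κ * κ) {{positive κκ>0}}}}))) bound
      where
      κκ>0 = 0<* κ>0 κ>0
      open ≤-Reasoning
      bound : ∀ {x y} → x ∈[ p , q ] → y ∈[ p , q ] → ∣ inverse (h x) - inverse (h y) ∣ ≤ (L ÷ κκ>0) * ∣ x - y ∣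
      bound {x} {y} i j = *-cancelˡ-≤-pos (κ * κ) {{positive κκ>0}} (begin
        κ * κ * ∣ inverse (h x) - inverse (h y) ∣
          ≤⟨ *-monoʳ-≤-nonNeg _ {{∣-∣-nonNeg (inverse (h x) - inverse (h y))}} (≤-trans (square-≥ i j) (≤∣∣ (h x * h y))) ⟩
        ∣ h x * h y ∣ * ∣ inverse (h x) - inverse (h y) ∣
          ≡⟨ ∣p*q∣≡∣p∣*∣q∣ (h x * h y) (inverse (h x) - inverse (h y)) ⟨
        ∣ h x * h y * (inverse (h x) - inverse (h y)) ∣
          ≡⟨ cong ∣_∣ (solve 4 (λ a b u v → a :* b :* (u :- v) := b :* (a :* u) :- a :* (b :* v)) refl (h x) (h y) (inverse (h x)) (inverse (h y))) ⟩
        ∣ h y * (h x * inverse (h x)) - h x * (h y * inverse (h y)) ∣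
          ≡⟨ cong₂ (λ u v → ∣ h y * u - h x * v ∣) (*-inverse (away⇒≢0 i)) (*-inverse (away⇒≢0 j)) ⟩
        ∣ h y * 1ℚ - h x * 1ℚ ∣
          ≡⟨ cong ∣_∣ (solve 2 (λ a b → b :* con 1ℚ :- a :* con 1ℚ := :- (a :- b)) refl (h x) (h y)) ⟩
        ∣ - (h x - h y) ∣
          ≡⟨ ∣-p∣≡∣p∣ (h x - h y) ⟩
        ∣ h x - h y ∣
          ≤⟨ c i j ⟩
        L * ∣ x - y ∣
          ≡⟨ cong (_* ∣ x - y ∣) (*÷ L κκ>0) ⟨
        κ * κ * (L ÷ κκ>0) * ∣ x - y ∣
          ≡⟨ *-assoc (κ * κ) (L ÷ κκ>0) ∣ x - y ∣ ⟩
        κ * κ * ((L ÷ κκ>0) * ∣ x - y ∣) ∎)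

  w : ℚ → ℚ
  w t = t * t * t - ι (+ 4) * t

  w-odd : ∀ t → w (- t) ≡ - w t
  w-odd t = solve 1 (λ t → (:- t) :* (:- t) :* (:- t) :- con (ι (+ 4)) :* (:- t) := :- (t :* t :* t :- con (ι (+ 4)) :* t)) refl t

  -- The local minimum of w, at 2 / √3, lies in [1, 13/10], and w ≤ w(1) = -3 on that interval.
  b 13/10 : ℚ
  b   = + 9 ℚ./ 4
  13/10 = + 13 ℚ./ 10

  w-above : ∀ {t} → b ≤ t → b ≤ w t
  -- The Taylor expansion of w(t) - b at b; all its coefficients are positive.
  w-above {t} b≤t = ≤-by
    (+ 9 ℚ./ 64 + (+ 179 ℚ./ 16 * u + (+ 27 ℚ./ 4 * (u * u) + u * u * u)))
    (solve 1 (λ t → let u = t :- con b in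
      t :* t :* t :- con (ι (+ 4)) :* t :- con b := con (+ 9 ℚ./ 64) :+ (con (+ 179 ℚ./ 16) :* u :+ (con (+ 27 ℚ./ 4) :* (u :* u) :+ u :* u :* u))) refl t)
    (0≤+ (<⇒≤ (positive⁻¹ (+ 9 ℚ./ 64))) (0≤+ (0≤* (<⇒≤ (positive⁻¹ (+ 179 ℚ./ 16))) 0≤u)
      (0≤+ (0≤* (<⇒≤ (positive⁻¹ (+ 27 ℚ./ 4))) (0≤-square u)) (0≤* (0≤-square u) 0≤u))))
    where
    u = t - b
    0≤u = ≤⇒0≤- b≤t

  neg-neg : ∀ x → - (- x) ≡ x
  neg-neg = solve 1 (λ x → :- (:- x) := x) refl

  neg-flip : ∀ {x y} → x ≤ - y → y ≤ - x
  neg-flip {x} {y} h = ≤-trans (≤-reflexive (sym (neg-neg y))) (neg-antimono-≤ h)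

  w-below : ∀ {t} → t ≤ - b → w t ≤ - b
  w-below {t} h = neg-flip (≤-trans (w-above (neg-flip h)) (≤-reflexive (w-odd t)))

  -- Between the zeros of w the cubic reaches beyond ± b.
  w-hump : ∀ {t} → t ∈[ 1ℚ , 13/10 ] → w t ≤ - b
  -- In u = t - 1 the difference is 3/4 + u - 3u² - u³, rewritten with v = 13/10 - t so that every
  -- term is nonnegative on the interval.
  w-hump {t} (1≤t , t≤) = ≤-by
    (+ 3 ℚ./ 4 + (+ 1 ℚ./ 100 * u + (+ 33 ℚ./ 10 * (u * v) + u * u * v)))
    (solve 1 (λ t → let u = t :- con 1ℚ; v = con 13/10 :- t in
      :- con b :- (t :* t :* t :- con (ι (+ 4)) :* t) :=
      con (+ 3 ℚ./ 4) :+ (con (+ 1 ℚ./ 100) :* u :+ (con (+ 33 ℚ./ 10) :* (u :* v) :+ u :* u :* v))) refl t)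
    (0≤+ (<⇒≤ (positive⁻¹ (+ 3 ℚ./ 4))) (0≤+ (0≤* (<⇒≤ (positive⁻¹ (+ 1 ℚ./ 100))) 0≤u)
      (0≤+ (0≤* (<⇒≤ (positive⁻¹ (+ 33 ℚ./ 10))) (0≤* 0≤u 0≤v)) (0≤* (0≤-square u) 0≤v))))
    where
    u = t - 1ℚ
    v = 13/10 - t
    0≤u = ≤⇒0≤- 1≤t
    0≤v = ≤⇒0≤- t≤

  Rises Switches : (ℚ → ℚ) → ℚ → ℚ → Set
  Rises t p q = t p ≤ - b × b ≤ t q
  Switches t p q = Rises t p q ⊎ Rises (λ x → - t x) p q

  w-dip : ∀ {t} → t ∈[ - 13/10 , - 1ℚ ] → b ≤ w t
  w-dip {t} (l , u) = ≤-trans (neg-flip (w-hump { - t} (neg-flip u , ≤-trans (neg-antimono-≤ l) (from-yes (- (- 13/10) ≤? 13/10)))))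
    (≤-reflexive (trans (cong -_ (w-odd t)) (neg-neg (w t))))

  -- The intermediate value theorem gives weak inequalities between points; the gap between their
  -- values makes them strict.
  strictly : ∀ {t : ℚ → ℚ} {x y c d} → x ≤ y → t x ≤ c → c < d → d ≤ t y → x < y
  strictly {t} x≤y tx≤c c<d d≤ty = ≰⇒> λ y≤x →
    <-irrefl refl (<-≤-trans c<d (≤-trans d≤ty (≤-trans (≤-reflexive (cong t (≤-antisym y≤x x≤y))) tx≤c)))

  -- On its way up t enters [-13/10, -1], where w ≥ b, and later [1, 13/10], where w ≤ -b; at the
  -- two ends w preserves the bounds -b and b. So w ∘ t rises, falls and rises again.
  split-rise : ∀ {t p q} → p < q → Lipschitz p q t → Rises t p q →
    ∃[ m ] ∃[ m′ ] (p < m × m < m′ × m′ < q) ×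
      Rises (λ x → w (t x)) p m × Rises (λ x → - w (t x)) m m′ × Rises (λ x → w (t x)) m′ q
  split-rise {t} {p} {q} p<q L (tp , tq) =
    let m , (p≤m , m≤q) , (l , u) = intermediate-value (<⇒≤ p<q) L
          (≤-trans tp (from-yes (- b ≤? - 13/10))) (from-yes (- 13/10 <? - 1ℚ)) (≤-trans (from-yes (- 1ℚ ≤? b)) tq)
        m′ , (m≤m′ , m′≤q) , (l′ , u′) = intermediate-value m≤q (Lipschitz-within p≤m ≤-refl L)
          (≤-trans u (from-yes (- 1ℚ ≤? 1ℚ))) (from-yes (1ℚ <? 13/10)) (≤-trans (from-yes (13/10 ≤? b)) tq)
    in m , m′ ,
      (strictly {t} p≤m tp (from-yes (- b <? - 13/10)) l , strictly {t} m≤m′ u (from-yes (- 1ℚ <? 1ℚ)) l′ , strictly {t} m′≤q u′ (from-yes (13/10 <? b)) tq) ,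
      (w-below tp , w-dip (l , u)) , (neg-antimono-≤ (w-dip (l , u)) , neg-flip (w-hump (l′ , u′))) , (w-hump (l′ , u′) , w-above tq)

  Rises-≗ : ∀ {t s p q} → (∀ x → t x ≡ s x) → Rises t p q → Rises s p q
  Rises-≗ {p = p} {q} e (l , u) = ≤-trans (≤-reflexive (sym (e p))) l , ≤-trans u (≤-reflexive (e q))

  split-switch : ∀ {t p q} → p < q → Lipschitz p q t → Switches t p q →
    ∃[ m ] ∃[ m′ ] (p < m × m < m′ × m′ < q) ×
      Switches (λ x → w (t x)) p m × Switches (λ x → w (t x)) m m′ × Switches (λ x → w (t x)) m′ q
  split-switch p<q L (inj₁ r) =
    let m , m′ , order , x , y , z = split-rise p<q L r
    in m , m′ , order , inj₁ x , inj₂ y , inj₁ z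
  split-switch {t} p<q L (inj₂ r) =
    let m , m′ , order , x , y , z = split-rise p<q (Lipschitz-neg L) r
    in m , m′ , order ,
      inj₂ (Rises-≗ (λ x → w-odd (t x)) x) ,
      inj₁ (Rises-≗ (λ x → trans (cong -_ (w-odd (t x))) (neg-neg (w (t x)))) y) ,
      inj₂ (Rises-≗ (λ x → w-odd (t x)) z)

  τ : ℕ → ℚ → ℚ
  τ zero    x = ev φ x * inverse (ev f x)
  τ (suc e) x = w (τ e x)

  Lipschitz-τ : ∀ {p q} → p ≤ q → AwayFrom0 (ev f) p q → ∀ e → Lipschitz p q (τ e)
  Lipschitz-τ p≤q A zero    = Lipschitz-* p≤q (Lipschitz-ev p≤q φ) (Lipschitz-inverse A (Lipschitz-ev p≤q f))
  Lipschitz-τ p≤q A (suc e) =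
    Lipschitz-+ (Lipschitz-* p≤q (Lipschitz-* p≤q t t) t) (Lipschitz-neg (Lipschitz-* p≤q (Lipschitz-const (ι (+ 4))) t))
    where t = Lipschitz-τ p≤q A e

  ev-N : ∀ e {x} → ev f x ≢ 0ℚ → ev (N e) x ≡ ev (D e) x * τ e x
  ev-N zero {x} f≢0 = sym (trans (solve 3 (λ f p i → f :* (p :* i) := p :* (f :* i)) refl (ev f x) (ev φ x) (inverse (ev f x)))
    (trans (cong (ev φ x *_) (*-inverse f≢0)) (*-identityʳ (ev φ x))))
  ev-N (suc e) {x} f≢0 = begin
    ev (N e ⊗ (N e ⊗ N e) ⊕ -[1+ 3 ] · (N e ⊗ (D e ⊗ D e))) x
      ≡⟨ ev-⊕ (N e ⊗ (N e ⊗ N e)) _ x ⟩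
    ev (N e ⊗ (N e ⊗ N e)) x + ev (-[1+ 3 ] · (N e ⊗ (D e ⊗ D e))) x
      ≡⟨ cong₂ _+_ (trans (ev-⊗ (N e) _ x) (cong (n *_) (ev-⊗ (N e) (N e) x)))
           (trans (ev-· -[1+ 3 ] (N e ⊗ (D e ⊗ D e)) x) (cong (ι -[1+ 3 ] *_) (trans (ev-⊗ (N e) _ x) (cong (n *_) (ev-⊗ (D e) (D e) x))))) ⟩
    n * (n * n) + ι -[1+ 3 ] * (n * (d * d))
      ≡⟨ cong (λ n → n * (n * n) + ι -[1+ 3 ] * (n * (d * d))) (ev-N e f≢0) ⟩
    d * t * (d * t * (d * t)) + ι -[1+ 3 ] * (d * t * (d * d))
      ≡⟨ solve 2 (λ d t → d :* t :* (d :* t :* (d :* t)) :+ con (ι -[1+ 3 ]) :* (d :* t :* (d :* d)) :=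
           d :* (d :* d) :* (t :* t :* t :- con (ι (+ 4)) :* t)) refl d t ⟩
    d * (d * d) * w t
      ≡⟨ cong (_* w t) (trans (ev-⊗ (D e) _ x) (cong (d *_) (ev-⊗ (D e) (D e) x))) ⟨
    ev (D (suc e)) x * w t ∎
    where
    open ≡-Reasoning
    n = ev (N e) x
    d = ev (D e) x
    t = τ e x

  ev-H : ∀ e {x} → ev f x ≢ 0ℚ → ev (H e) x ≡ ev (D e) x * (τ e x + ι (+ 2))
  ev-H e {x} f≢0 = trans (ev-⊕ (N e) (D e ⊕ D e) x) (trans (cong₂ _+_ (ev-N e f≢0) (ev-⊕ (D e) (D e) x))
    (solve 2 (λ d t → d :* t :+ (d :+ d) := d :* (t :+ con (ι (+ 2)))) refl (ev (D e) x) (τ e x)))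

  -- `D e` is f to the odd power 3ᵉ.
  D-same-sign : ∀ e {x y} → 0ℚ < ev f x * ev f y → 0ℚ < ev (D e) x * ev (D e) y
  D-same-sign zero    h = h
  D-same-sign (suc e) {x} {y} h = <-≤-trans (0<* ih (0<* ih ih)) (≤-reflexive (sym (trans
    (cong₂ _*_ (cube x) (cube y))
    (solve 2 (λ a b → a :* (a :* a) :* (b :* (b :* b)) := a :* b :* (a :* b :* (a :* b))) refl (ev (D e) x) (ev (D e) y)))))
    where
    ih = D-same-sign e h
    cube : ∀ x → ev (D (suc e)) x ≡ ev (D e) x * (ev (D e) x * ev (D e) x)
    cube x = trans (ev-⊗ (D e) _ x) (cong (ev (D e) x *_) (ev-⊗ (D e) (D e) x))

  Cell : ℕ → ℚ → ℚ → Set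
  Cell e p q = AwayFrom0 (ev f) p q × Switches (τ e) p q

  refine : ∀ e {p q} → p < q → Cell e p q →
    ∃[ m ] ∃[ m′ ] (p < m × m < m′ × m′ < q) × Cell (suc e) p m × Cell (suc e) m m′ × Cell (suc e) m′ q
  refine e p<q (A , s) =
    let m , m′ , (a , b , c) , x , y , z = split-switch p<q (Lipschitz-τ (<⇒≤ p<q) A e) s
    in m , m′ , (a , b , c) ,
      (AwayFrom0-within ≤-refl (<⇒≤ (<-trans b c)) A , x) ,
      (AwayFrom0-within (<⇒≤ a) (<⇒≤ c) A , y) ,
      (AwayFrom0-within (<⇒≤ (<-trans a b)) ≤-refl A , z)

  -- A gap at the left end is enough to separate the zeros of consecutive intervals from each other,
  -- and the first one from 0.
  record Root (h : ℚ → ℚ) (p q : ℚ) : Set where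
    constructor root
    field
      value     : ℝ
      vanishing : Null λ n → h (seq value n)
      γ         : ℚ
      γ>0       : 0ℚ < γ
      above     : Eventually λ n → p + γ ≤ seq value n
      below     : ∀ n → seq value n ≤ q

  Root-neg : ∀ {h p q} → Root (λ x → - h x) p q → Root h p q
  Root-neg {h} (root v n γ γ>0 a b) = root v
    (Null-≗ (λ n → solve 1 (λ z → :- (:- z) := z) refl (h (seq v n))) (Null-neg n)) γ γ>0 a b

  -- Along the bisection h is eventually at least h(p) / 2, so it has risen by η = -h(p) / 2 from
  -- the left end, which takes a distance of at least η / (1 + K). The summand 1 makes the divisor
  -- positive even if K = 0.
  rising-root : ∀ {h p q} → p < q → Lipschitz p q h → h p < 0ℚ → 0ℚ ≤ h q → Root h p q
  rising-root {h} {p} {q} p<q L@(lipschitz K nn c) hp<0 0≤hq = root (mkℝ zeros zeros-cauchy) (zeros-Null L) γ γ>0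
    (eventually-map (λ {n} (l , _) → stays n l) (small-at-zeros L η η>0))
    (λ n → proj₂ (zeros∈ n))
    where
    open Bisection h (<⇒≤ p<q) (<⇒≤ hp<0) 0≤hq
    0<-hp : 0ℚ < - h p
    0<-hp = neg-antimono-< hp<0
    η = ½ * (- h p)
    η>0 = 0<½* 0<-hp
    K′ = 1ℚ + K
    K′>0 : 0ℚ < K′
    K′>0 = <-≤-trans (positive⁻¹ 1ℚ) (≤-by K (solve 1 (λ k → con 1ℚ :+ k :- con 1ℚ := k) refl K) nn)
    γ = η ÷ K′>0
    γ>0 = 0<÷ η>0 K′>0
    stays : ∀ n → - η ≤ h (zeros n) → p + γ ≤ zeros n
    stays n l = ≤-by (zeros n - p - γ) (solve 3 (λ p g z → z :- (p :+ g) := z :- p :- g) refl p γ (zeros n))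
      (≤⇒0≤- (*-cancelˡ-≤-pos K′ {{positive K′>0}} (begin
        K′ * γ                 ≡⟨ *÷ η K′>0 ⟩
        η                      ≡⟨ solve 1 (λ y → con ½ :* (:- y) := :- (con ½ :* (:- y)) :- y) refl (h p) ⟩
        - η - h p              ≤⟨ +-monoˡ-≤ (- h p) l ⟩
        h (zeros n) - h p      ≤⟨ ≤∣∣ (h (zeros n) - h p) ⟩
        ∣ h (zeros n) - h p ∣  ≤⟨ c (zeros∈ n) (≤-refl , <⇒≤ p<q) ⟩
        K * ∣ zeros n - p ∣    ≡⟨ cong (K *_) (0≤p⇒∣p∣≡p 0≤z-p) ⟩
        K * (zeros n - p)      ≤⟨ *-monoʳ-≤-nonNeg (zeros n - p) {{nonNegative 0≤z-p}} {K} {K′} (≤-by 1ℚ (solve 1 (λ k → con 1ℚ :+ k :- k := con 1ℚ) refl K) (<⇒≤ (positive⁻¹ 1ℚ))) ⟩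
        K′ * (zeros n - p)     ∎)))
      where
      open ≤-Reasoning
      0≤z-p = ≤⇒0≤- (proj₁ (zeros∈ n))

  root-of-sign-change : ∀ {h p q} → p < q → Lipschitz p q h → h p * h q < 0ℚ → Root h p q
  root-of-sign-change {h} {p} {q} p<q L hphq<0 = by-sign (<-cmp (h p) 0ℚ)
    where
    by-sign : Tri (h p < 0ℚ) (h p ≡ 0ℚ) (0ℚ < h p) → Root h p q
    by-sign (tri≈ _ hp≡0 _) = ⊥-elim (<-irrefl (trans (cong (_* h q) hp≡0) (*-zeroˡ (h q))) hphq<0)
    by-sign (tri< hp<0 _ _) = rising-root p<q L hp<0 (≮⇒≥ λ hq<0 → <-asym hphq<0
      (<-≤-trans (0<* (neg-antimono-< hp<0) (neg-antimono-< hq<0)) (≤-reflexive (solve 2 (λ a b → (:- a) :* (:- b) := a :* b) refl (h p) (h q)))))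
    by-sign (tri> _ _ 0<hp) = Root-neg (rising-root p<q (Lipschitz-neg L) (neg-antimono-< 0<hp)
      (neg-antimono-≤ (≮⇒≥ λ 0<hq → <-asym hphq<0 (0<* 0<hp 0<hq))))

  -- H = D (τ + 2): the factor D has the same sign at both ends, while τ + 2 changes sign because -2
  -- lies strictly between -9/4 and 9/4.
  H-root : ∀ e {p q} → p < q → Cell e p q → Root (ev (H e)) p q
  H-root e {p} {q} p<q (A , s) = root-of-sign-change p<q (Lipschitz-ev (<⇒≤ p<q) (H e))
    (<-by (signs * spread) (trans (cong₂ (λ u v → 0ℚ - u * v) (ev-H e (away⇒≢0 A p∈)) (ev-H e (away⇒≢0 A q∈)))
        (solve 4 (λ d t d′ t′ → con 0ℚ :- d :* (t :+ con (ι (+ 2))) :* (d′ :* (t′ :+ con (ι (+ 2)))) :=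
          d :* d′ :* (:- ((t :+ con (ι (+ 2))) :* (t′ :+ con (ι (+ 2)))))) refl (ev (D e) p) (τ e p) (ev (D e) q) (τ e q)))
      (0<* (D-same-sign e (<-≤-trans (0<* (AwayFrom0.κ>0 A) (AwayFrom0.κ>0 A)) (square-≥ A p∈ q∈))) (opposite s)))
    where
    p∈ : p ∈[ p , q ]
    p∈ = ≤-refl , <⇒≤ p<q
    q∈ : q ∈[ p , q ]
    q∈ = <⇒≤ p<q , ≤-refl
    signs = ev (D e) p * ev (D e) q
    spread = - ((τ e p + ι (+ 2)) * (τ e q + ι (+ 2)))
    quarter : ∀ {a c} → a ≤ - b → b ≤ c → 0ℚ < - ((a + ι (+ 2)) * (c + ι (+ 2)))
    quarter {a} {c} a≤ ≤c = <-≤-trans (0<* { - a - ι (+ 2)} {c + ι (+ 2)}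
        (<-≤-trans (positive⁻¹ (+ 1 ℚ./ 4)) (≤-by (- a - b) (solve 1 (λ a → (:- a) :- con (ι (+ 2)) :- con (+ 1 ℚ./ 4) := (:- a) :- con b) refl a) (≤⇒0≤- (neg-flip {a} {b} a≤))))
        (<-≤-trans (positive⁻¹ b) (≤-trans ≤c (≤-by (ι (+ 2)) (solve 1 (λ c → c :+ con (ι (+ 2)) :- c := con (ι (+ 2))) refl c) (<⇒≤ (positive⁻¹ (ι (+ 2))))))))
      (≤-reflexive (solve 2 (λ a c → ((:- a) :- con (ι (+ 2))) :* (c :+ con (ι (+ 2))) := :- ((a :+ con (ι (+ 2))) :* (c :+ con (ι (+ 2))))) refl a c))
    opposite : Switches (τ e) p q → 0ℚ < spread
    opposite (inj₁ (l , u)) = quarter l u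
    opposite (inj₂ (l , u)) = <-≤-trans (quarter {τ e q} {τ e p} (neg-flip u) (≤-trans (neg-flip { - τ e p} {b} l) (≤-reflexive (neg-neg (τ e p)))))
      (≤-reflexive (cong -_ (*-comm (τ e q + ι (+ 2)) (τ e p + ι (+ 2)))))

  chain : ∀ {l r} → Chain (Cell 0) l r 30 → ∀ e → Chain (Cell e) l r (30 ℕ.* 3^ e)
  chain c zero    = c
  chain {l} {r} c (suc e) = subst (Chain (Cell (suc e)) l r) (ℕₚ.*-assoc 30 (3^ e) 3) (refine-chain (refine e) (chain c e))

-- Certified intervals for the base pair

module BaseCells where

  open RationalSequences
  open Intervals
  open Dynamics
  open BasePolynomials
  open import Data.Integer as ℤ using (ℤ; +_; -[1+_]; 0ℤ; 1ℤ)
  import Data.Integer.Properties as ℤₚ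
  open import Data.List as List using (List; []; _∷_)
  open import Data.Nat using (ℕ; zero; suc)
  open import Data.Product using (_×_; _,_; ∃-syntax)
  open import Data.Rational as ℚ hiding (_÷_)
  open import Data.Rational.Properties
  open import Data.Rational.Solver using (module +-*-Solver)
  open import Data.Unit using (⊤; tt)
  open import Data.Sum as Sum using (_⊎_; inj₁; inj₂)
  open import Data.Vec using (Vec; []; _∷_; fromList; toList)
  open import Data.Vec.Relation.Unary.All as All using (All; []; _∷_)
  open import Relation.Binary.PropositionalEquality using (_≡_; refl; sym; trans; cong; cong₂; module ≡-Reasoning)
  open import Relation.Nullary using (yes)
  open import Relation.Nullary.Decidable using (Dec; from-yes; map′; _×-dec_)
  open +-*-Solver using (solve; _:=_; _:+_; _:*_; _:-_; :-_; con)

  infixr 8 _^ℚ_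
  _^ℚ_ : ℚ → ℕ → ℚ
  x ^ℚ zero  = 1ℚ
  x ^ℚ suc n = x * x ^ℚ n

  0<^ : ∀ {x} → 0ℚ < x → ∀ n → 0ℚ < x ^ℚ n
  0<^ x>0 zero    = positive⁻¹ 1ℚ
  0<^ x>0 (suc n) = 0<* x>0 (0<^ x>0 n)

  0≤^ : ∀ {x} → 0ℚ ≤ x → ∀ n → 0ℚ ≤ x ^ℚ n
  0≤^ 0≤x zero    = <⇒≤ (positive⁻¹ 1ℚ)
  0≤^ 0≤x (suc n) = 0≤* 0≤x (0≤^ 0≤x n)

  ^-mono : ∀ {x y} → 0ℚ ≤ x → x ≤ y → ∀ n → x ^ℚ n ≤ y ^ℚ n
  ^-mono 0≤x x≤y zero    = ≤-refl
  ^-mono 0≤x x≤y (suc n) = *-mono-≤-0≤ 0≤x (0≤^ (≤-trans 0≤x x≤y) n) x≤y (^-mono 0≤x x≤y n)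

  -- Binary forms: c₀ uⁿ + c₁ uⁿ⁻¹ v + … + cₙ vⁿ.
  Form : ℕ → Set
  Form = Vec ℤ

  value : ∀ {n} → Form n → ℚ → ℚ → ℚ
  value []              u v = 0ℚ
  value {suc n} (c ∷ F) u v = ι c * u ^ℚ n + v * value F u v

  -- Multiplication by α u + β v.
  linear : ∀ {n} → ℤ → ℤ → ℤ → Form n → Form (suc n)
  linear α β carry []      = β ℤ.* carry ∷ []
  linear α β carry (c ∷ F) = α ℤ.* c ℤ.+ β ℤ.* carry ∷ linear α β c F

  combine : ∀ {n} → ℤ → Form n → Form n → Form n
  combine a []      []      = []
  combine a (w ∷ W) (c ∷ F) = a ℤ.* w ℤ.+ c ∷ combine a W F

  module _ (u v : ℚ) where

    value-linear : ∀ {n} α β carry (F : Form n) →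
      value (linear α β carry F) u v ≡ (ι α * u + ι β * v) * value F u v + ι β * ι carry * u ^ℚ n
    value-linear α β carry [] = trans (cong (λ z → z * 1ℚ + v * 0ℚ) (ι-* β carry))
      (solve 4 (λ k v x z → k :* con 1ℚ :+ v :* con 0ℚ := (x :+ z) :* con 0ℚ :+ k :* con 1ℚ) refl (ι β * ι carry) v (ι α * u) (ι β * v))
    value-linear {suc n} α β carry (c ∷ F) = trans
      (cong₂ (λ z y → z * (u * u ^ℚ n) + v * y) (trans (ι-+ (α ℤ.* c) (β ℤ.* carry)) (cong₂ _+_ (ι-* α c) (ι-* β carry))) (value-linear α β c F))
      (solve 8 (λ a b k c u v p y →
        (a :* c :+ b :* k) :* (u :* p) :+ v :* ((a :* u :+ b :* v) :* y :+ b :* c :* p) :=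
        (a :* u :+ b :* v) :* (c :* p :+ v :* y) :+ b :* k :* (u :* p)) refl (ι α) (ι β) (ι carry) (ι c) u v (u ^ℚ n) (value F u v))

    value-linear-0 : ∀ {n} α β (F : Form n) → value (linear α β 0ℤ F) u v ≡ (ι α * u + ι β * v) * value F u v
    value-linear-0 {n} α β F = trans (value-linear α β 0ℤ F)
      (solve 3 (λ x b p → x :+ b :* con 0ℚ :* p := x) refl ((ι α * u + ι β * v) * value F u v) (ι β) (u ^ℚ n))

    value-combine : ∀ {n} a (W F : Form n) → value (combine a W F) u v ≡ ι a * value W u v + value F u v
    value-combine a [] [] = solve 1 (λ a → con 0ℚ := a :* con 0ℚ :+ con 0ℚ) refl (ι a)
    value-combine {suc n} a (w ∷ W) (c ∷ F) = trans
      (cong₂ (λ z y → z * u ^ℚ n + v * y) (trans (ι-+ (a ℤ.* w) c) (cong (_+ ι c) (ι-* a w))) (value-combine a W F))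
      (solve 7 (λ a w c p v y z → (a :* w :+ c) :* p :+ v :* (a :* y :+ z) := a :* (w :* p :+ v :* y) :+ (c :* p :+ v :* z)) refl
        (ι a) (ι w) (ι c) (u ^ℚ n) v (value W u v) (value F u v))

  -- The Bernstein form of a polynomial on [α / m, β / m].
  module Bernstein (α β m : ℤ) where

    power : ∀ n → Form (suc n)
    power zero    = 1ℤ ∷ []
    power (suc n) = linear m m 0ℤ (power n)

    -- Horner's rule with x replaced by (α u + β v) / (m u + m v), the powers of the denominator
    -- being multiplied out.
    form : ∀ {n} → Vec ℤ n → Form n
    form []      = []
    form {suc n} (a ∷ p) = combine a (power n) (linear α β 0ℤ (form p))

    evᵥ : ∀ {n} → Vec ℤ n → ℚ → ℚ
    evᵥ p = ev (toList p)

    module _ (u v : ℚ) where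
      ω = ι m * u + ι m * v

      value-power : ∀ n → value (power n) u v ≡ ω ^ℚ n
      value-power zero    = solve 1 (λ v → con 1ℚ :* con 1ℚ :+ v :* con 0ℚ := con 1ℚ) refl v
      value-power (suc n) = trans (value-linear-0 u v m m (power n)) (cong (ω *_) (value-power n))

      -- The form has degree n - 1; the factor ω on the left avoids the exponent n - 1, which would
      -- be truncated for n = 0.
      value-form : ∀ {n} (p : Vec ℤ n) y → ι α * u + ι β * v ≡ y * ω →
        value (form p) u v * ω ≡ ω ^ℚ n * evᵥ p y
      value-form []      y e = solve 1 (λ w → con 0ℚ :* w := con 1ℚ :* con 0ℚ) refl ω
      value-form {suc n} (a ∷ p) y e = begin
        value (combine a (power n) (linear α β 0ℤ (form p))) u v * ω
          ≡⟨ cong (_* ω) (trans (value-combine u v a (power n) _)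
               (cong₂ (λ x z → ι a * x + z) (value-power n) (trans (value-linear-0 u v α β (form p)) (cong (_* value (form p) u v) e)))) ⟩
        (ι a * ω ^ℚ n + y * ω * value (form p) u v) * ω
          ≡⟨ solve 5 (λ a w y x z → (a :* x :+ y :* w :* z) :* w := w :* (a :* x :+ y :* (z :* w))) refl (ι a) ω y (ω ^ℚ n) (value (form p) u v) ⟩
        ω * (ι a * ω ^ℚ n + y * (value (form p) u v * ω))
          ≡⟨ cong (λ z → ω * (ι a * ω ^ℚ n + y * z)) (value-form p y e) ⟩
        ω * (ι a * ω ^ℚ n + y * (ω ^ℚ n * evᵥ p y))
          ≡⟨ solve 5 (λ w a x y z → w :* (a :* x :+ y :* (x :* z)) := w :* x :* (a :+ y :* z)) refl ω (ι a) (ω ^ℚ n) y (evᵥ p y) ⟩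
        ω * ω ^ℚ n * (ι a + y * evᵥ p y) ∎
        where open ≡-Reasoning

  -- After multiplication by s every term is nonnegative, and the term in uⁿ or the one in vⁿ alone
  -- reaches δⁿ, as integer coefficients of the right sign are at least 1.
  positive-form : ∀ {n} (s : ℤ) (F : Form (suc n)) → All (λ c → 1ℤ ℤ.≤ s ℤ.* c) F → ∀ {u v δ} → 0ℚ ≤ u → 0ℚ ≤ v → 0ℚ ≤ δ →
    δ ≤ u ⊎ δ ≤ v → δ ^ℚ n ≤ ι s * value F u v
  positive-form s (c ∷ []) (1≤ ∷ []) {u} {v} _ _ _ _ = ≤-trans (ι-mono 1≤) (≤-reflexive
    (trans (ι-* s c) (solve 3 (λ s c v → s :* c := s :* (c :* con 1ℚ :+ v :* con 0ℚ)) refl (ι s) (ι c) v)))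
  positive-form {suc n} s (c ∷ F@(_ ∷ _)) (1≤ ∷ all) {u} {v} {δ} 0≤u 0≤v 0≤δ side = ≤-trans (bound side)
    (≤-reflexive (solve 5 (λ s c p v y → s :* c :* p :+ v :* (s :* y) := s :* (c :* p :+ v :* y)) refl (ι s) (ι c) (u ^ℚ suc n) v (value F u v)))
    where
    open ≤-Reasoning
    1≤sc : 1ℚ ≤ ι s * ι c
    1≤sc = ≤-trans (ι-mono 1≤) (≤-reflexive (ι-* s c))
    0≤sF : 0ℚ ≤ ι s * value F u v
    0≤sF = ≤-trans (0≤^ ≤-refl n) (positive-form s F all {δ = 0ℚ} 0≤u 0≤v ≤-refl (inj₁ 0≤u))
    bound : δ ≤ u ⊎ δ ≤ v → δ ^ℚ suc n ≤ ι s * ι c * u ^ℚ suc n + v * (ι s * value F u v)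
    bound (inj₁ δ≤u) = begin
      δ ^ℚ suc n                 ≤⟨ ^-mono 0≤δ δ≤u (suc n) ⟩
      u ^ℚ suc n                 ≡⟨ *-identityˡ (u ^ℚ suc n) ⟨
      1ℚ * u ^ℚ suc n            ≤⟨ *-monoʳ-≤-nonNeg (u ^ℚ suc n) {{nonNegative (0≤^ 0≤u (suc n))}} 1≤sc ⟩
      ι s * ι c * u ^ℚ suc n     ≤⟨ ≤-by (v * (ι s * value F u v)) (solve 2 (λ x y → x :+ y :- x := y) refl (ι s * ι c * u ^ℚ suc n) _) (0≤* 0≤v 0≤sF) ⟩
      ι s * ι c * u ^ℚ suc n + v * (ι s * value F u v) ∎
    bound (inj₂ δ≤v) = begin
      δ * δ ^ℚ n                 ≤⟨ *-mono-≤-0≤ 0≤δ 0≤sF δ≤v (positive-form s F all 0≤u 0≤v 0≤δ (inj₂ δ≤v)) ⟩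
      v * (ι s * value F u v)    ≤⟨ ≤-by (ι s * ι c * u ^ℚ suc n) (solve 2 (λ x y → x :+ y :- y := x) refl (ι s * ι c * u ^ℚ suc n) _)
                                     (0≤* (≤-trans (<⇒≤ (positive⁻¹ 1ℚ)) 1≤sc) (0≤^ 0≤u (suc n))) ⟩
      ι s * ι c * u ^ℚ suc n + v * (ι s * value F u v) ∎

  scale : ℤ
  scale = + 1000

  point : ℤ → ℚ
  point α = ι α * (+ 1 ℚ./ 1000)

  point-scale : ∀ α → ι scale * point α ≡ ι α
  point-scale α = trans (solve 3 (λ m a r → m :* (a :* r) := m :* r :* a) refl (ι scale) (ι α) (+ 1 ℚ./ 1000)) (*-identityˡ (ι α))

  -- The value at α / 1000 times the power of 1000 that clears denominators, so that certificates
  -- are checked in integer arithmetic.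
  homogeneous : ∀ {n} → ℤ → Vec ℤ n → ℤ
  homogeneous α []              = 0ℤ
  homogeneous {suc n} α (a ∷ p) = a ℤ.* scale ℤ.^ n ℤ.+ α ℤ.* homogeneous α p

  ι-^ : ∀ a n → ι (a ℤ.^ n) ≡ ι a ^ℚ n
  ι-^ a zero    = refl
  ι-^ a (suc n) = trans (ι-* a (a ℤ.^ n)) (cong (ι a *_) (ι-^ a n))

  homogeneous-ev : ∀ {n} α (p : Vec ℤ n) → ι (homogeneous α p) * ι scale ≡ ι scale ^ℚ n * ev (toList p) (point α)
  homogeneous-ev α []              = refl
  homogeneous-ev {suc n} α (a ∷ p) = begin
    ι (a ℤ.* scale ℤ.^ n ℤ.+ α ℤ.* homogeneous α p) * m
      ≡⟨ cong (_* m) (trans (ι-+ (a ℤ.* scale ℤ.^ n) (α ℤ.* homogeneous α p)) (cong₂ _+_ (trans (ι-* a (scale ℤ.^ n)) (cong (ι a *_) (ι-^ scale n))) (trans (ι-* α (homogeneous α p)) (cong (_* h) (sym (point-scale α)))))) ⟩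
    (ι a * m ^ℚ n + m * x * h) * m
      ≡⟨ solve 5 (λ a y m x h → (a :* y :+ m :* x :* h) :* m := m :* (a :* y :+ x :* (h :* m))) refl (ι a) (m ^ℚ n) m x h ⟩
    m * (ι a * m ^ℚ n + x * (h * m))
      ≡⟨ cong (λ z → m * (ι a * m ^ℚ n + x * z)) (homogeneous-ev α p) ⟩
    m * (ι a * m ^ℚ n + x * (m ^ℚ n * ev (toList p) x))
      ≡⟨ solve 5 (λ m a y x e → m :* (a :* y :+ x :* (y :* e)) := m :* y :* (a :+ x :* e)) refl m (ι a) (m ^ℚ n) x (ev (toList p) x) ⟩
    m * m ^ℚ n * (ι a + x * ev (toList p) x) ∎
    where
    open ≡-Reasoning
    m = ι scale
    x = point α
    h = ι (homogeneous α p)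

  -- The sign s certifies s f > 0 on [α, β] / 1000, with φ / f ≤ - 9 / 4 at the left end
  -- and φ / f ≥ 9 / 4 at the right end.
  ev-++0 : ∀ p x → ev (p List.++ 0ℤ ∷ []) x ≡ ev p x
  ev-++0 []      x = solve 1 (λ x → con 0ℚ :+ x :* con 0ℚ := con 0ℚ) refl x
  ev-++0 (a ∷ p) x = cong (λ y → ι a + x * y) (ev-++0 p x)

  opaque
    unfolding φ f

    -- f gets a zero leading coefficient so that both polynomials are homogenised with the same
    -- power of 1000 and their ratio is preserved.
    fᵥ φᵥ : Vec ℤ 31
    fᵥ = fromList (f List.++ 0ℤ ∷ [])
    φᵥ = fromList φ

    ev-fᵥ : ∀ x → ev (toList fᵥ) x ≡ ev f x
    ev-fᵥ = ev-++0 f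

    ev-φᵥ : ∀ x → ev (toList φᵥ) x ≡ ev φ x
    ev-φᵥ x = refl

  -- Once s f > 0 is known, the conditions on φ / f at the ends can be multiplied by 4 s f and
  -- become integer inequalities.
  record Certificate (s α β : ℤ) : Set where
    constructor certificate
    field
      unit     : s ℤ.* s ≡ 1ℤ
      ordered  : α ℤ.< β
      definite : All (λ c → 1ℤ ℤ.≤ s ℤ.* c) (Bernstein.form α β scale fᵥ)
      left     : s ℤ.* (+ 4 ℤ.* homogeneous α φᵥ ℤ.+ + 9 ℤ.* homogeneous α fᵥ) ℤ.≤ 0ℤ
      right    : 0ℤ ℤ.≤ s ℤ.* (+ 4 ℤ.* homogeneous β φᵥ ℤ.+ -[1+ 8 ] ℤ.* homogeneous β fᵥ)

  certificate? : ∀ s α β → Dec (Certificate s α β)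
  certificate? s α β = map′ (λ (u , o , p , l , r) → certificate u o p l r) (λ (certificate u o p l r) → u , o , p , l , r)
    ((s ℤ.* s ℤ.≟ 1ℤ) ×-dec (α ℤ.<? β) ×-dec
     All.all? (λ c → 1ℤ ℤ.≤? s ℤ.* c) (Bernstein.form α β scale fᵥ) ×-dec
     (s ℤ.* (+ 4 ℤ.* homogeneous α φᵥ ℤ.+ + 9 ℤ.* homogeneous α fᵥ) ℤ.≤? 0ℤ) ×-dec
     (0ℤ ℤ.≤? s ℤ.* (+ 4 ℤ.* homogeneous β φᵥ ℤ.+ -[1+ 8 ] ℤ.* homogeneous β fᵥ)))

  module _ {s α β : ℤ} (C : Certificate s α β) where
    open Certificate C

    private
      l = point α
      r = point β
      m = ι scale
      σ = ι s

      σσ≡1 : σ * σ ≡ 1ℚ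
      σσ≡1 = trans (sym (ι-* s s)) (cong ι unit)

      m>0 : 0ℚ < m
      m>0 = positive⁻¹ m

      l<r : l < r
      l<r = *-monoˡ-<-pos (+ 1 ℚ./ 1000) (ι-mono-< ordered)
        where
        ι-mono-< : ∀ {a b} → a ℤ.< b → ι a < ι b
        ι-mono-< {a} {b} a<b = <-≤-trans (<-by 1ℚ (trans (cong (_- ι a) (ι-+ 1ℤ a)) (solve 1 (λ a → con 1ℚ :+ a :- a := con 1ℚ) refl (ι a))) (positive⁻¹ 1ℚ))
          (ι-mono (ℤₚ.i<j⇒suc[i]≤j a<b))

      ω = m * (r - l)
      ω>0 = 0<* m>0 (<⇒0<- l<r)
      -- At every point of the interval, the distance to one of its ends is at least δ.
      δ = ½ * (r - l)
      δ>0 = 0<½* (<⇒0<- l<r)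
      κ = (δ ^ℚ 30 * ω) ÷ 0<^ ω>0 31

      bound : ∀ {x} → x ∈[ l , r ] → κ ≤ σ * ev f x
      bound {x} (l≤x , x≤r) = *-cancelˡ-≤-pos (ω ^ℚ 31) {{positive (0<^ ω>0 31)}} (begin
        ω ^ℚ 31 * κ                        ≡⟨ *÷ (δ ^ℚ 30 * ω) (0<^ ω>0 31) ⟩
        δ ^ℚ 30 * ω                        ≤⟨ *-monoʳ-≤-nonNeg ω {{nonNegative (<⇒≤ ω>0)}}
                                               (positive-form s F definite (≤⇒0≤- x≤r) (≤⇒0≤- l≤x) (<⇒≤ δ>0) side) ⟩
        σ * value F u v * ω                ≡⟨ *-assoc σ (value F u v) ω ⟩
        σ * (value F u v * ω)              ≡⟨ cong (λ y → σ * (value F u v * y)) ω≡ ⟨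
        σ * (value F u v * Bernstein.ω α β scale u v)  ≡⟨ cong (σ *_) (Bernstein.value-form α β scale u v fᵥ x on-line) ⟩
        σ * (Bernstein.ω α β scale u v ^ℚ 31 * ev (toList fᵥ) x)   ≡⟨ cong₂ (λ y z → σ * (y ^ℚ 31 * z)) ω≡ (ev-fᵥ x) ⟩
        σ * (ω ^ℚ 31 * ev f x)             ≡⟨ solve 3 (λ s w y → s :* (w :* y) := w :* (s :* y)) refl σ (ω ^ℚ 31) (ev f x) ⟩
        ω ^ℚ 31 * (σ * ev f x)             ∎)
        where
        open ≤-Reasoning
        F = Bernstein.form α β scale fᵥ
        u = r - x
        v = x - l
        ω≡ : Bernstein.ω α β scale u v ≡ ω
        ω≡ = solve 4 (λ m r x l → m :* (r :- x) :+ m :* (x :- l) := m :* (r :- l)) refl m r x l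
        on-line : ι α * u + ι β * v ≡ x * Bernstein.ω α β scale u v
        on-line = trans (cong₂ (λ a b → a * u + b * v) (sym (point-scale α)) (sym (point-scale β)))
          (solve 4 (λ m r x l → m :* l :* (r :- x) :+ m :* r :* (x :- l) := x :* (m :* (r :- x) :+ m :* (x :- l))) refl m r x l)
        side : δ ≤ u ⊎ δ ≤ v
        side = Sum.swap (Sum.map
          (λ h → ≤-by (x - ½ * (l + r)) (solve 3 (λ l r x → x :- l :- con ½ :* (r :- l) := x :- con ½ :* (l :+ r)) refl l r x) (≤⇒0≤- h))
          (λ h → ≤-by (½ * (l + r) - x) (solve 3 (λ l r x → r :- x :- con ½ :* (r :- l) := con ½ :* (l :+ r) :- x) refl l r x) (≤⇒0≤- h))
          (≤-total (½ * (l + r)) x))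

      κ>0 : 0ℚ < κ
      κ>0 = 0<÷ (0<* (0<^ δ>0 30) ω>0) (0<^ ω>0 31)

      A : AwayFrom0 (ev f) l r
      A = away σ κ σσ≡1 κ>0 bound

      -- The value of φ / f at an end point, scaled by 4 c, compared through the homogenised values.
      compare-ratio : ∀ γ c → point γ ∈[ l , r ] →
        m ^ℚ 31 * (σ * ev f (point γ) * (ι (+ 4) * τ 0 (point γ) + ι c)) ≡
        m * ι (s ℤ.* (+ 4 ℤ.* homogeneous γ φᵥ ℤ.+ c ℤ.* homogeneous γ fᵥ))
      compare-ratio γ c i = begin
        M * (σ * ev f x * (ι (+ 4) * (ev φ x * inverse (ev f x)) + ι c))
          ≡⟨ solve 6 (λ M s f p i c → M :* (s :* f :* (con (ι (+ 4)) :* (p :* i) :+ c)) :=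
               s :* (con (ι (+ 4)) :* (M :* p) :* (f :* i) :+ c :* (M :* f))) refl M σ (ev f x) (ev φ x) (inverse (ev f x)) (ι c) ⟩
        σ * (ι (+ 4) * (M * ev φ x) * (ev f x * inverse (ev f x)) + ι c * (M * ev f x))
          ≡⟨ cong (λ z → σ * (ι (+ 4) * (M * ev φ x) * z + ι c * (M * ev f x))) (*-inverse (away⇒≢0 A i)) ⟩
        σ * (ι (+ 4) * (M * ev φ x) * 1ℚ + ι c * (M * ev f x))
          ≡⟨ cong₂ (λ y z → σ * (ι (+ 4) * y * 1ℚ + ι c * z)) (trans (homogeneous-ev γ φᵥ) (cong (M *_) (ev-φᵥ x))) (trans (homogeneous-ev γ fᵥ) (cong (M *_) (ev-fᵥ x))) ⟨
        σ * (ι (+ 4) * (ι hφ * m) * 1ℚ + ι c * (ι hf * m))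
          ≡⟨ solve 5 (λ s p f m c → s :* (con (ι (+ 4)) :* (p :* m) :* con 1ℚ :+ c :* (f :* m)) := m :* (s :* (con (ι (+ 4)) :* p :+ c :* f))) refl σ (ι hφ) (ι hf) m (ι c) ⟩
        m * (σ * (ι (+ 4) * ι hφ + ι c * ι hf))
          ≡⟨ cong (m *_) (trans (ι-* s _) (cong (σ *_) (trans (ι-+ (+ 4 ℤ.* hφ) (c ℤ.* hf)) (cong₂ _+_ (ι-* (+ 4) hφ) (ι-* c hf))))) ⟨
        m * ι (s ℤ.* (+ 4 ℤ.* hφ ℤ.+ c ℤ.* hf)) ∎
        where
        open ≡-Reasoning
        x = point γ
        M = m ^ℚ 31
        hφ = homogeneous γ φᵥ
        hf = homogeneous γ fᵥ

      factor-sign : ∀ γ → point γ ∈[ l , r ] → 0ℚ < m ^ℚ 31 * (σ * ev f (point γ))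
      factor-sign γ i = 0<* (0<^ m>0 31) (<-≤-trans κ>0 (bound i))

      l∈ : l ∈[ l , r ]
      l∈ = ≤-refl , <⇒≤ l<r
      r∈ : r ∈[ l , r ]
      r∈ = <⇒≤ l<r , ≤-refl

      left-end : τ 0 l ≤ - b
      left-end = *-cancelˡ-≤-pos (ι (+ 4)) (≤-by (- (ι (+ 4) * τ 0 l + ι (+ 9)))
        (solve 1 (λ t → con (ι (+ 4)) :* (:- con b) :- con (ι (+ 4)) :* t := :- (con (ι (+ 4)) :* t :+ con (ι (+ 9)))) refl (τ 0 l))
        (neg-antimono-≤ (*-cancelˡ-≤-pos P {{positive (factor-sign α l∈)}} (begin
          P * (ι (+ 4) * τ 0 l + ι (+ 9))   ≡⟨ *-assoc (m ^ℚ 31) (σ * ev f l) _ ⟩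
          m ^ℚ 31 * (σ * ev f l * (ι (+ 4) * τ 0 l + ι (+ 9)))   ≡⟨ compare-ratio α (+ 9) l∈ ⟩
          m * ι (s ℤ.* (+ 4 ℤ.* homogeneous α φᵥ ℤ.+ + 9 ℤ.* homogeneous α fᵥ))  ≤⟨ *-monoˡ-≤-nonNeg m (ι-mono left) ⟩
          m * 0ℚ                            ≡⟨ trans (*-zeroʳ m) (sym (*-zeroʳ P)) ⟩
          P * 0ℚ                            ∎))))
        where
        open ≤-Reasoning
        P = m ^ℚ 31 * (σ * ev f l)

      right-end : b ≤ τ 0 r
      right-end = *-cancelˡ-≤-pos (ι (+ 4)) (≤-by (ι (+ 4) * τ 0 r + ι -[1+ 8 ])
        (solve 1 (λ t → con (ι (+ 4)) :* t :- con (ι (+ 4)) :* con b := con (ι (+ 4)) :* t :+ con (ι -[1+ 8 ])) refl (τ 0 r))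
        (*-cancelˡ-≤-pos P {{positive (factor-sign β r∈)}} (begin
          P * 0ℚ                            ≡⟨ trans (*-zeroʳ P) (sym (*-zeroʳ m)) ⟩
          m * 0ℚ                            ≤⟨ *-monoˡ-≤-nonNeg m (ι-mono right) ⟩
          m * ι (s ℤ.* (+ 4 ℤ.* homogeneous β φᵥ ℤ.+ -[1+ 8 ] ℤ.* homogeneous β fᵥ))  ≡⟨ compare-ratio β -[1+ 8 ] r∈ ⟨
          m ^ℚ 31 * (σ * ev f r * (ι (+ 4) * τ 0 r + ι -[1+ 8 ]))   ≡⟨ *-assoc (m ^ℚ 31) (σ * ev f r) _ ⟨
          P * (ι (+ 4) * τ 0 r + ι -[1+ 8 ]) ∎)))
        where
        open ≤-Reasoning
        P = m ^ℚ 31 * (σ * ev f r)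

    certified-cell : point α < point β × Cell 0 (point α) (point β)
    certified-cell = l<r , A , inj₁ (left-end , right-end)

  Certified : ℤ → List (ℤ × ℤ × ℤ) → Set
  Certified l []                 = ⊤
  Certified l ((s , α , β) ∷ cs) = l ℤ.≤ α × Certificate s α β × Certified β cs

  certified? : ∀ l cs → Dec (Certified l cs)
  certified? l []                 = yes tt
  certified? l ((s , α , β) ∷ cs) = (l ℤ.≤? α) ×-dec certificate? s α β ×-dec certified? β cs

  certified-chain : ∀ l cs → Certified l cs → ∃[ r ] Chain (Cell 0) (point l) r (List.length cs)
  certified-chain l []                 _             = point l , [] ≤-refl
  certified-chain l ((s , α , β) ∷ cs) (l≤α , C , D) =
    let r , ch = certified-chain β cs D
        p<q , c = certified-cell C
    in r , cell (*-monoʳ-≤-nonNeg (+ 1 ℚ./ 1000) (ι-mono l≤α)) p<q c ch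

  -- End points in thousandths. The signs alternate, so each of the 29 gaps contains exactly one
  -- zero of f. The first cell can start at 0 because φ(0) / f(0) = 9 / (-4) meets the bound -9/4
  -- exactly; the last one lies beyond the zero 4.
  cells : List (ℤ × ℤ × ℤ)
  cells =
    (-[1+ 0 ] , + 0 , + 34) ∷ (+ 1 , + 37 , + 58) ∷ (-[1+ 0 ] , + 60 , + 80) ∷
    (+ 1 , + 90 , + 120) ∷ (-[1+ 0 ] , + 130 , + 195) ∷ (+ 1 , + 200 , + 297) ∷
    (-[1+ 0 ] , + 300 , + 370) ∷ (+ 1 , + 400 , + 500) ∷ (-[1+ 0 ] , + 540 , + 680) ∷
    (+ 1 , + 700 , + 790) ∷ (-[1+ 0 ] , + 800 , + 990) ∷ (+ 1 , + 1040 , + 1270) ∷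
    (-[1+ 0 ] , + 1300 , + 1440) ∷ (+ 1 , + 1460 , + 1530) ∷ (-[1+ 0 ] , + 1600 , + 1700) ∷
    (+ 1 , + 1800 , + 2100) ∷ (-[1+ 0 ] , + 2200 , + 2230) ∷ (+ 1 , + 2260 , + 2320) ∷
    (-[1+ 0 ] , + 2400 , + 2600) ∷ (+ 1 , + 2700 , + 2800) ∷ (-[1+ 0 ] , + 2850 , + 2880) ∷
    (+ 1 , + 2900 , + 3100) ∷ (-[1+ 0 ] , + 3150 , + 3200) ∷ (+ 1 , + 3300 , + 3450) ∷
    (-[1+ 0 ] , + 3490 , + 3520) ∷ (+ 1 , + 3600 , + 3660) ∷ (-[1+ 0 ] , + 3700 , + 3760) ∷
    (+ 1 , + 3800 , + 3850) ∷ (-[1+ 0 ] , + 3900 , + 3980) ∷ (+ 1 , + 5000 , + 9000) ∷ []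

  opaque
    unfolding fᵥ φᵥ
    base-certified : Certified 0ℤ cells
    base-certified = from-yes (certified? 0ℤ cells)

  base-chain : ∃[ r ] Chain (Cell 0) 0ℚ r 30
  base-chain = certified-chain 0ℤ cells base-certified

-- Existence of logarithms and bounds for them

module Logarithms where

  open import Defs
  open RationalSequences
  open Intervals using (ι; ι-*; ι-+; ι-mono; toℚᵘ-ι; archimedean; ½^; 0≤½^; ½^-small; Lipschitz; Lipschitz-const; Lipschitz-id; Lipschitz-+; Lipschitz-*; module Bisection; difference-bound)
  open import Data.Empty using (⊥; ⊥-elim)
  open import Data.Integer as ℤ using (ℤ; +_; 0ℤ; 1ℤ)
  import Data.Integer.Properties as ℤₚ
  open import Data.Nat as ℕ using (ℕ; zero; suc; _!)
  import Data.Nat.Properties as ℕₚ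
  open import Data.Product using (_×_; _,_; ∃-syntax; proj₁; proj₂)
  open import Data.Rational as ℚ using (ℚ; 0ℚ; 1ℚ; ½; nonNegative; toℚᵘ)
  open import Data.Rational.Properties as ℚₚ hiding (_<?_)
  open import Data.Rational.Unnormalised as ℚᵘ using (mkℚᵘ)
  import Data.Rational.Unnormalised.Properties as ℚᵘₚ
  open import Data.Rational.Solver using (module +-*-Solver)
  open import Data.Sum using (_⊎_; inj₁; inj₂; [_,_]′)
  open import Relation.Binary.PropositionalEquality using (_≡_; refl; sym; trans; cong; cong₂; subst; module ≡-Reasoning)
  open import Relation.Nullary.Decidable using (from-yes)
  open +-*-Solver using (solve; _:=_; _:+_; _:*_; _:-_; :-_; con)

  reciprocal : ∀ d .{{_ : ℕ.NonZero d}} → (1ℤ ℚ./ d) ℚ.* ι (+ d) ≡ 1ℚ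
  reciprocal (suc d) = toℚᵘ-injective (begin
    toℚᵘ ((1ℤ ℚ./ suc d) ℚ.* ι (+ suc d))             ≈⟨ toℚᵘ-homo-* (1ℤ ℚ./ suc d) (ι (+ suc d)) ⟩
    toℚᵘ (1ℤ ℚ./ suc d) ℚᵘ.* toℚᵘ (ι (+ suc d))       ≈⟨ ℚᵘₚ.*-cong (toℚᵘ-fromℚᵘ (mkℚᵘ 1ℤ d)) (toℚᵘ-ι (+ suc d)) ⟩
    mkℚᵘ 1ℤ d ℚᵘ.* mkℚᵘ (+ suc d) 0                   ≈⟨ ℚᵘₚ.*-inverseˡ (mkℚᵘ (+ suc d) 0) ⟩
    toℚᵘ 1ℚ                                           ∎)
    where open ℚᵘₚ.≃-Reasoning

  1/_!′ : ℕ → ℚ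
  1/ k !′ = (1ℤ ℚ./ (k !)) {{k ℕₚ.!≢0}}

  1/!-step : ∀ k → 1/ suc k !′ ℚ.* ι (+ suc k) ≡ 1/ k !′
  1/!-step k = begin
    c′ ℚ.* ι (+ suc k)                            ≡⟨ *-identityʳ _ ⟨
    c′ ℚ.* ι (+ suc k) ℚ.* 1ℚ                     ≡⟨ cong (λ z → c′ ℚ.* ι (+ suc k) ℚ.* z) (reciprocal (k !) {{k ℕₚ.!≢0}}) ⟨
    c′ ℚ.* ι (+ suc k) ℚ.* (c ℚ.* ι (+ (k !)))    ≡⟨ solve 4 (λ a b c d → a :* b :* (c :* d) := a :* (b :* d) :* c) refl c′ (ι (+ suc k)) c (ι (+ (k !))) ⟩
    c′ ℚ.* (ι (+ suc k) ℚ.* ι (+ (k !))) ℚ.* c    ≡⟨ cong (λ z → c′ ℚ.* z ℚ.* c) (trans (cong ι (ℤₚ.pos-* (suc k) (k !))) (ι-* (+ suc k) (+ (k !)))) ⟨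
    c′ ℚ.* ι (+ (suc k !)) ℚ.* c                  ≡⟨ cong (ℚ._* c) (reciprocal (suc k !) {{suc k ℕₚ.!≢0}}) ⟩
    1ℚ ℚ.* c                                      ≡⟨ *-identityˡ c ⟩
    c                                             ∎
    where
    open ≡-Reasoning
    c  = 1/ k !′
    c′ = 1/ suc k !′

  0≤ι : ∀ n → 0ℚ ℚ.≤ ι (+ n)
  0≤ι n = ι-mono {0ℤ} {+ n} (ℤ.+≤+ ℕ.z≤n)

  0<1/! : ∀ k → 0ℚ ℚ.< 1/ k !′
  0<1/! k = *-cancelʳ-<-nonNeg (ι (+ (k !))) {{nonNegative (0≤ι (k !))}}
    (<-≤-trans (≤-<-trans (≤-reflexive (*-zeroˡ (ι (+ (k !))))) (positive⁻¹ 1ℚ)) (≤-reflexive (sym (reciprocal (k !) {{k ℕₚ.!≢0}}))))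

  pow : ℚ → ℕ → ℚ
  pow p zero    = 1ℚ
  pow p (suc k) = p ℚ.* pow p k

  term : ℚ → ℕ → ℚ
  term p k = 1/ k !′ ℚ.* pow p k

  E : ℕ → ℚ → ℚ
  E zero    p = 0ℚ
  E (suc k) p = E k p ℚ.+ term p k

  seq-expSum : ∀ y i n → seq (expSum y i) n ≡ E i (seq y n)
  seq-expSum y zero    n = refl
  seq-expSum y (suc i) n = cong₂ (λ a b → a ℚ.+ 1/ i !′ ℚ.* b) (seq-expSum y i n) (seq-^ i)
    where
    seq-^ : ∀ k → seq (y ^ k) n ≡ pow (seq y n) k
    seq-^ zero    = refl
    seq-^ (suc k) = cong (seq y n ℚ.*_) (seq-^ k)

  pow-mono : ∀ {p q} → 0ℚ ℚ.≤ p → p ℚ.≤ q → ∀ k → 0ℚ ℚ.≤ pow p k × pow p k ℚ.≤ pow q k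
  pow-mono 0≤p p≤q zero    = <⇒≤ (positive⁻¹ 1ℚ) , ≤-refl
  pow-mono 0≤p p≤q (suc k) with pow-mono 0≤p p≤q k
  ... | 0≤pow , le = 0≤* 0≤p 0≤pow , *-mono-≤-0≤ 0≤p (≤-trans 0≤pow le) p≤q le

  0≤term : ∀ {p} → 0ℚ ℚ.≤ p → ∀ k → 0ℚ ℚ.≤ term p k
  0≤term 0≤p k = 0≤* (<⇒≤ (0<1/! k)) (proj₁ (pow-mono 0≤p ≤-refl k))

  term-mono : ∀ {p q} → 0ℚ ℚ.≤ p → p ℚ.≤ q → ∀ k → term p k ℚ.≤ term q k
  term-mono 0≤p p≤q k = *-monoˡ-≤-nonNeg (1/ k !′) {{nonNegative (<⇒≤ (0<1/! k))}} (proj₂ (pow-mono 0≤p p≤q k))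

  E-mono : ∀ {p q} → 0ℚ ℚ.≤ p → p ℚ.≤ q → ∀ i → E i p ℚ.≤ E i q
  E-mono 0≤p p≤q zero    = ≤-refl
  E-mono 0≤p p≤q (suc i) = +-mono-≤ (E-mono 0≤p p≤q i) (term-mono 0≤p p≤q i)

  E-mono-index : ∀ {p} → 0ℚ ℚ.≤ p → ∀ {i j} → i ℕ.≤ j → E i p ℚ.≤ E j p
  E-mono-index 0≤p {i} {j} i≤j with ℕₚ.m≤n⇒m<n∨m≡n i≤j
  ... | inj₂ refl = ≤-refl
  E-mono-index {p} 0≤p {i} {suc j} _ | inj₁ (ℕ.s≤s i≤j) = ≤-trans (E-mono-index 0≤p i≤j)
    (≤-by (term p j) (solve 2 (λ a b → a :+ b :- a := b) refl (E j p) (term p j)) (0≤term 0≤p j))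

  -- exp q - exp p ≥ q - p, already for the partial sums.
  E-expands : ∀ {p q} → 0ℚ ℚ.≤ p → p ℚ.≤ q → ∀ i → q ℚ.- p ℚ.≤ E (2 ℕ.+ i) q ℚ.- E (2 ℕ.+ i) p
  E-expands {p} {q} 0≤p p≤q zero = ≤-reflexive (solve 2 (λ p q → q :- p :=
    (con 0ℚ :+ con 1ℚ :* con 1ℚ :+ con 1ℚ :* (q :* con 1ℚ)) :- (con 0ℚ :+ con 1ℚ :* con 1ℚ :+ con 1ℚ :* (p :* con 1ℚ))) refl p q)
  E-expands {p} {q} 0≤p p≤q (suc i) = ≤-trans (E-expands 0≤p p≤q i)
    (≤-by (term q (2 ℕ.+ i) ℚ.- term p (2 ℕ.+ i))
      (solve 4 (λ a b c d → (a :+ b) :- (c :+ d) :- (a :- c) := b :- d) refl (E (2 ℕ.+ i) q) (term q (2 ℕ.+ i)) (E (2 ℕ.+ i) p) (term p (2 ℕ.+ i)))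
      (≤⇒0≤- (term-mono 0≤p p≤q (2 ℕ.+ i))))

  -- The difference is 1/2 + (p - 1)² / 2. It yields log x ≤ (x + 1) / 2, the upper bound for
  -- logarithms in the final inequality.
  E-two : ∀ {p} → 0ℚ ℚ.≤ p → p ℚ.+ p ℚ.≤ E 3 p
  E-two {p} 0≤p = ≤-by (½ ℚ.+ ½ ℚ.* ((p ℚ.- 1ℚ) ℚ.* (p ℚ.- 1ℚ)))
    (trans (cong (ℚ._- (p ℚ.+ p)) E-3) (square p))
    (0≤+ (<⇒≤ (positive⁻¹ ½)) (0≤* (<⇒≤ (positive⁻¹ ½)) (0≤-square (p ℚ.- 1ℚ))))
    where
    square : ∀ p → 1ℚ ℚ.+ p ℚ.+ ½ ℚ.* (p ℚ.* p) ℚ.- (p ℚ.+ p) ≡ ½ ℚ.+ ½ ℚ.* ((p ℚ.- 1ℚ) ℚ.* (p ℚ.- 1ℚ))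
    square = solve 1 (λ p → con 1ℚ :+ p :+ con ½ :* (p :* p) :- (p :+ p) :=
      con ½ :+ con ½ :* ((p :- con 1ℚ) :* (p :- con 1ℚ))) refl
    E-3 : E 3 p ≡ 1ℚ ℚ.+ p ℚ.+ ½ ℚ.* (p ℚ.* p)
    E-3 = cong₂ ℚ._+_ (cong (1ℚ ℚ.+_) (trans (*-identityˡ _) (*-identityʳ p))) (cong (λ x → ½ ℚ.* (p ℚ.* x)) (*-identityʳ p))

  module _ (B : ℕ) where
    private
      β = ι (+ B)
      K = B ℕ.+ B

    -- The ratio of consecutive terms is p / (k + 1), at most 1/2 as soon as k ≥ 2B.
    term-halves : ∀ {p} → 0ℚ ℚ.≤ p → p ℚ.≤ β → ∀ k → K ℕ.≤ k → term p (suc k) ℚ.+ term p (suc k) ℚ.≤ term p k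
    term-halves {p} 0≤p p≤β k K≤k = begin
      c′ ℚ.* (p ℚ.* P) ℚ.+ c′ ℚ.* (p ℚ.* P)    ≡⟨ solve 3 (λ c p P → c :* (p :* P) :+ c :* (p :* P) := c :* (p :+ p) :* P) refl c′ p P ⟩
      c′ ℚ.* (p ℚ.+ p) ℚ.* P                   ≤⟨ *-monoʳ-≤-nonNeg P {{nonNegative (proj₁ (pow-mono 0≤p ≤-refl k))}}
                                                   (*-monoˡ-≤-nonNeg c′ {{nonNegative (<⇒≤ (0<1/! (suc k)))}} 2p≤) ⟩
      c′ ℚ.* ι (+ suc k) ℚ.* P                 ≡⟨ cong (ℚ._* P) (1/!-step k) ⟩
      term p k                                 ∎
      where
      open ≤-Reasoning
      c′ = 1/ suc k !′
      P  = pow p k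
      2p≤ : p ℚ.+ p ℚ.≤ ι (+ suc k)
      2p≤ = ≤-trans (+-mono-≤ p≤β p≤β) (≤-trans (≤-reflexive (sym (ι-+ (+ B) (+ B)))) (ι-mono (ℤ.+≤+ (ℕₚ.m≤n⇒m≤1+n K≤k))))

    private
      term-bound : ∀ {p} → 0ℚ ℚ.≤ p → p ℚ.≤ β → ∀ n → term p (K ℕ.+ n) ℚ.≤ term β K ℚ.* ½^ n
      term-bound {p} 0≤p p≤β zero = ≤-trans (≤-reflexive (cong (term p) (ℕₚ.+-identityʳ K)))
        (≤-trans (term-mono 0≤p p≤β K) (≤-reflexive (sym (*-identityʳ (term β K)))))
      term-bound {p} 0≤p p≤β (suc n) = begin
        term p (K ℕ.+ suc n)              ≡⟨ cong (term p) (ℕₚ.+-suc K n) ⟩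
        t                                 ≡⟨ solve 1 (λ t → t := con ½ :* (t :+ t)) refl t ⟩
        ½ ℚ.* (t ℚ.+ t)                   ≤⟨ *-monoˡ-≤-nonNeg ½ (≤-trans (term-halves 0≤p p≤β (K ℕ.+ n) (ℕₚ.m≤m+n K n)) (term-bound 0≤p p≤β n)) ⟩
        ½ ℚ.* (term β K ℚ.* ½^ n)         ≡⟨ solve 2 (λ a b → con ½ :* (a :* b) := a :* (con ½ :* b)) refl (term β K) (½^ n) ⟩
        term β K ℚ.* (½ ℚ.* ½^ n)         ∎
        where
        open ≤-Reasoning
        t = term p (suc (K ℕ.+ n))

    private
      -- E i + 2 term i decreases from K on, which bounds the tail by twice its first term.
      potential : ∀ {p} → 0ℚ ℚ.≤ p → p ℚ.≤ β → ∀ j d → K ℕ.≤ j →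
        E (d ℕ.+ j) p ℚ.+ (term p (d ℕ.+ j) ℚ.+ term p (d ℕ.+ j)) ℚ.≤ E j p ℚ.+ (term p j ℚ.+ term p j)
      potential 0≤p p≤β j zero    K≤j = ≤-refl
      potential {p} 0≤p p≤β j (suc d) K≤j = ≤-trans
        (≤-by (t ℚ.- (t′ ℚ.+ t′)) (solve 3 (λ e t s → e :+ (t :+ t) :- (e :+ t :+ (s :+ s)) := t :- (s :+ s)) refl (E (d ℕ.+ j) p) t t′)
          (≤⇒0≤- (term-halves 0≤p p≤β (d ℕ.+ j) (ℕₚ.≤-trans K≤j (ℕₚ.m≤n+m j d)))))
        (potential 0≤p p≤β j d K≤j)
        where
        t  = term p (d ℕ.+ j)
        t′ = term p (suc (d ℕ.+ j))

      tail : ∀ {p} → 0ℚ ℚ.≤ p → p ℚ.≤ β → ∀ j i → K ℕ.≤ j → j ℕ.≤ i → E i p ℚ.- E j p ℚ.≤ term p j ℚ.+ term p j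
      tail {p} 0≤p p≤β j i K≤j j≤i = ≤-by
        (E j p ℚ.+ (s ℚ.+ s) ℚ.- (E i p ℚ.+ (t ℚ.+ t)) ℚ.+ (t ℚ.+ t))
        (solve 4 (λ a b s t → (s :+ s) :- (a :- b) := b :+ (s :+ s) :- (a :+ (t :+ t)) :+ (t :+ t)) refl (E i p) (E j p) s t)
        (0≤+ (≤⇒0≤- (subst (λ k → E k p ℚ.+ (term p k ℚ.+ term p k) ℚ.≤ E j p ℚ.+ (s ℚ.+ s)) (ℕₚ.m∸n+n≡m j≤i) (potential 0≤p p≤β j (i ℕ.∸ j) K≤j)))
          (0≤+ (0≤term 0≤p i) (0≤term 0≤p i)))
        where
        s = term p j
        t = term p i

    opaque
      -- The index must not depend on p, since a real argument enters through all the rational terms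
      -- of its sequence.
      uniform-tail : ∀ η → 0ℚ ℚ.< η → ∃[ I ] ∀ {p} → 0ℚ ℚ.≤ p → p ℚ.≤ β → ∀ i j → I ℕ.≤ j → j ℕ.≤ i → E i p ℚ.- E j p ℚ.≤ η
      uniform-tail η η>0 = K ℕ.+ N , λ {p} 0≤p p≤β i j I≤j j≤i → begin
        E i p ℚ.- E j p                                 ≤⟨ tail 0≤p p≤β j i (ℕₚ.≤-trans (ℕₚ.m≤m+n K N) I≤j) j≤i ⟩
        term p j ℚ.+ term p j                           ≤⟨ +-mono-≤ (bound 0≤p p≤β j I≤j) (bound 0≤p p≤β j I≤j) ⟩
        term β K ℚ.* ½^ (j ℕ.∸ K) ℚ.+ term β K ℚ.* ½^ (j ℕ.∸ K)   ≡⟨ *-distribʳ-+ (½^ (j ℕ.∸ K)) (term β K) (term β K) ⟨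
        (term β K ℚ.+ term β K) ℚ.* ½^ (j ℕ.∸ K)        ≤⟨ small (j ℕ.∸ K) (ℕₚ.≤-trans (ℕₚ.≤-reflexive (sym (ℕₚ.m+n∸m≡n K N))) (ℕₚ.∸-monoˡ-≤ K I≤j)) ⟩
        η                                               ∎
        where
        open ≤-Reasoning
        eventually-small : Eventually λ n → (term β K ℚ.+ term β K) ℚ.* ½^ n ℚ.≤ η
        eventually-small = ½^-small (term β K ℚ.+ term β K) (0≤+ (0≤term (0≤ι B) K) (0≤term (0≤ι B) K)) η η>0
        N : ℕ
        N = proj₁ eventually-small
        small : ∀ n → N ℕ.≤ n → (term β K ℚ.+ term β K) ℚ.* ½^ n ℚ.≤ η
        small = proj₂ eventually-small
        bound : ∀ {p} → 0ℚ ℚ.≤ p → p ℚ.≤ β → ∀ j → K ℕ.+ N ℕ.≤ j → term p j ℚ.≤ term β K ℚ.* ½^ (j ℕ.∸ K)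
        bound {p} 0≤p p≤β j I≤j = ≤-trans (≤-reflexive (cong (term p) (sym (ℕₚ.m+[n∸m]≡n (ℕₚ.≤-trans (ℕₚ.m≤m+n K N) I≤j)))))
          (term-bound 0≤p p≤β (j ℕ.∸ K))

  opaque
    -- A natural number exceeding exp m by at least 2.
    exp-bound : ∀ m → ∃[ b ] ∀ i → E i (ι (+ m)) ℚ.+ ι (+ 2) ℚ.≤ ι (+ b)
    exp-bound m =
      let I , t = uniform-tail m 1ℚ (positive⁻¹ 1ℚ)
          b , le = archimedean (E I (ι (+ m)) ℚ.+ 1ℚ ℚ.+ ι (+ 2))
      in b , λ i → ≤-trans (+-monoˡ-≤ (ι (+ 2)) {E i (ι (+ m))} {E I (ι (+ m)) ℚ.+ 1ℚ} (bound I (λ i → t (0≤ι m) ≤-refl i I ℕₚ.≤-refl) i (ℕₚ.≤-total I i))) le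
      where
      bound : ∀ I → (∀ i → I ℕ.≤ i → E i (ι (+ m)) ℚ.- E I (ι (+ m)) ℚ.≤ 1ℚ) → ∀ i → I ℕ.≤ i ⊎ i ℕ.≤ I → E i (ι (+ m)) ℚ.≤ E I (ι (+ m)) ℚ.+ 1ℚ
      bound I t i (inj₁ I≤i) = ≤-by (1ℚ ℚ.- (E i (ι (+ m)) ℚ.- E I (ι (+ m)))) (solve 2 (λ a b → b :+ con 1ℚ :- a := con 1ℚ :- (a :- b)) refl (E i (ι (+ m))) (E I (ι (+ m))))
        (≤⇒0≤- (t i I≤i))
      bound I t i (inj₂ i≤I) = ≤-trans (E-mono-index (0≤ι m) i≤I) (≤-by 1ℚ (solve 1 (λ a → a :+ con 1ℚ :- a := con 1ℚ) refl (E I (ι (+ m)))) (<⇒≤ (positive⁻¹ 1ℚ)))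

  Lipschitz-E : ∀ {l r} → l ℚ.≤ r → ∀ i → Lipschitz l r (E i)
  Lipschitz-E l≤r zero    = Lipschitz-const 0ℚ
  Lipschitz-E l≤r (suc i) = Lipschitz-+ (Lipschitz-E l≤r i) (Lipschitz-* l≤r (Lipschitz-const (1/ i !′)) (Lipschitz-pow i))
    where
    Lipschitz-pow : ∀ k → Lipschitz _ _ λ p → pow p k
    Lipschitz-pow zero    = Lipschitz-const 1ℚ
    Lipschitz-pow (suc k) = Lipschitz-* l≤r Lipschitz-id (Lipschitz-pow k)

  record ApproximateLog (q δ : ℚ) : Set where
    constructor approximate
    field
      log    : ℚ
      0≤log  : 0ℚ ℚ.≤ log
      index  : ℕ
      close  : ∀ i → index ℕ.≤ i → E i log ℚ.≤ q ℚ.+ δ × q ℚ.≤ E i log ℚ.+ δ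

  -- Bisection on [0, q] for one partial sum: it is 1 ≤ q at 0 and at least 1 + q at q. Its index is
  -- large enough for all later partial sums to stay within δ of it.
  approximate-log : ∀ q δ → 1ℚ ℚ.≤ q → 0ℚ ℚ.< δ → ApproximateLog q δ
  approximate-log q δ 1≤q δ>0 = found (eventually-witness (small-at-zeros Lip δ δ>0))
    where
    B = proj₁ (archimedean q)
    q≤B : q ℚ.≤ ι (+ B)
    q≤B = proj₂ (archimedean q)
    I = proj₁ (uniform-tail B δ δ>0)
    t : ∀ {p} → 0ℚ ℚ.≤ p → p ℚ.≤ ι (+ B) → ∀ i j → I ℕ.≤ j → j ℕ.≤ i → E i p ℚ.- E j p ℚ.≤ δ
    t = proj₂ (uniform-tail B δ δ>0)
    0≤q = ≤-trans (<⇒≤ (positive⁻¹ 1ℚ)) 1≤q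
    J = 2 ℕ.+ I
    h : ℚ → ℚ
    h p = E J p ℚ.+ ℚ.- q
    Lip = Lipschitz-+ (Lipschitz-E 0≤q J) (Lipschitz-const (ℚ.- q))
    E0 : ∀ i → E (suc i) 0ℚ ≡ 1ℚ
    E0 zero    = refl
    E0 (suc i) = trans (cong₂ (λ a b → a ℚ.+ 1/ suc i !′ ℚ.* b) (E0 i) (*-zeroˡ (pow 0ℚ i)))
      (solve 1 (λ c → con 1ℚ :+ c :* con 0ℚ := con 1ℚ) refl (1/ suc i !′))
    h0≤0 : h 0ℚ ℚ.≤ 0ℚ
    h0≤0 = ≤-trans (≤-reflexive (cong (ℚ._+ ℚ.- q) (E0 (suc I)))) (≤-trans (+-monoˡ-≤ (ℚ.- q) 1≤q) (≤-reflexive (+-inverseʳ q)))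
    0≤hq : 0ℚ ℚ.≤ h q
    0≤hq = ≤⇒0≤- {q} {E J q} (≤-by (E J q ℚ.- E J 0ℚ ℚ.- (q ℚ.- 0ℚ) ℚ.+ 1ℚ)
      (trans (solve 2 (λ a q → a :- q := a :- con 1ℚ :- (q :- con 0ℚ) :+ con 1ℚ) refl (E J q) q) (cong (λ z → E J q ℚ.- z ℚ.- (q ℚ.- 0ℚ) ℚ.+ 1ℚ) (sym (E0 (suc I)))))
      (0≤+ (≤⇒0≤- (E-expands ≤-refl 0≤q I)) (<⇒≤ (positive⁻¹ 1ℚ))))
    open Bisection h 0≤q h0≤0 0≤hq using (zeros; zeros∈; small-at-zeros)
    found : ∃[ n ] (ℚ.- δ ℚ.≤ h (zeros n) × h (zeros n) ℚ.≤ 0ℚ) → ApproximateLog q δ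
    found (n , l , u) = approximate p 0≤p J λ i J≤i →
      ≤-by (δ ℚ.- (E i p ℚ.- E J p) ℚ.+ (0ℚ ℚ.- h p))
        (solve 4 (λ a b q d → q :+ d :- a := d :- (a :- b) :+ (con 0ℚ :- (b :+ :- q))) refl (E i p) (E J p) q δ)
        (0≤+ (≤⇒0≤- (t 0≤p (≤-trans (proj₂ (zeros∈ n)) q≤B) i J (ℕₚ.m≤n+m I 2) J≤i)) (≤⇒0≤- u)) ,
      ≤-by (E i p ℚ.- E J p ℚ.+ (h p ℚ.- ℚ.- δ))
        (solve 4 (λ a b q d → a :+ d :- q := a :- b :+ (b :+ :- q :- :- d)) refl (E i p) (E J p) q δ)
        (0≤+ (≤⇒0≤- (E-mono-index 0≤p J≤i)) (≤⇒0≤- l))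
      where
      p = zeros n
      0≤p = proj₁ (zeros∈ n)

  0<½^ : ∀ n → 0ℚ ℚ.< ½^ n
  0<½^ zero    = positive⁻¹ 1ℚ
  0<½^ (suc n) = 0<* (positive⁻¹ ½) (0<½^ n)

  ½^≤1 : ∀ n → ½^ n ℚ.≤ 1ℚ
  ½^≤1 zero    = ≤-refl
  ½^≤1 (suc n) = ≤-trans (*-monoˡ-≤-nonNeg ½ (½^≤1 n)) (from-yes (½ ℚ.* 1ℚ ℚ.≤? 1ℚ))

  -- The n-th term of log x is an approximate logarithm of the n-th term of x, whose exponential is
  -- off by at most ½ⁿ.
  module Logarithm (x : ℝ) (1≤x : ∀ n → 1ℚ ℚ.≤ seq x n) where

    A : ∀ n → ApproximateLog (seq x n) (½^ n)
    A n = approximate-log (seq x n) (½^ n) (1≤x n) (0<½^ n)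

    y : ℕ → ℚ
    y n = ApproximateLog.log (A n)

    0≤y : ∀ n → 0ℚ ℚ.≤ y n
    0≤y n = ApproximateLog.0≤log (A n)

    M : ℕ → ℕ
    M n = ApproximateLog.index (A n)

    E≤ : ∀ n i → M n ℕ.≤ i → E i (y n) ℚ.≤ seq x n ℚ.+ ½^ n
    E≤ n i M≤i = proj₁ (ApproximateLog.close (A n) i M≤i)

    ≤E : ∀ n i → M n ℕ.≤ i → seq x n ℚ.≤ E i (y n) ℚ.+ ½^ n
    ≤E n i M≤i = proj₂ (ApproximateLog.close (A n) i M≤i)

    -- exp expands distances on the nonnegative half-line, so logarithms differ by no more than
    -- their arguments, up to the two errors.
    y-difference : ∀ m n → y m ℚ.- y n ℚ.≤ ℚ.∣ seq x m ℚ.- seq x n ∣ ℚ.+ (½^ m ℚ.+ ½^ n)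
    y-difference m n = [ close , far ]′ (≤-total (y m) (y n))
      where
      close : y m ℚ.≤ y n → y m ℚ.- y n ℚ.≤ ℚ.∣ seq x m ℚ.- seq x n ∣ ℚ.+ (½^ m ℚ.+ ½^ n)
      close ym≤yn = ≤-trans (≤-trans (+-monoˡ-≤ (ℚ.- y n) ym≤yn) (≤-reflexive (+-inverseʳ (y n))))
          (0≤+ (0≤∣p∣ (seq x m ℚ.- seq x n)) (0≤+ (0≤½^ m) (0≤½^ n)))
      open ≤-Reasoning
      k = M m ℕ.+ M n
      i = 2 ℕ.+ k
      far : y n ℚ.≤ y m → y m ℚ.- y n ℚ.≤ ℚ.∣ seq x m ℚ.- seq x n ∣ ℚ.+ (½^ m ℚ.+ ½^ n)
      far yn≤ym = begin
        y m ℚ.- y n                                           ≤⟨ E-expands (0≤y n) yn≤ym k ⟩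
        E i (y m) ℚ.- E i (y n)                               ≤⟨ ≤-by (seq x m ℚ.+ ½^ m ℚ.- E i (y m) ℚ.+ (E i (y n) ℚ.+ ½^ n ℚ.- seq x n))
          (solve 6 (λ a b u v d e → u :- v :+ (d :+ e) :- (a :- b) := u :+ d :- a :+ (b :+ e :- v)) refl (E i (y m)) (E i (y n)) (seq x m) (seq x n) (½^ m) (½^ n))
          (0≤+ (≤⇒0≤- (E≤ m i (ℕₚ.≤-trans (ℕₚ.m≤m+n (M m) (M n)) (ℕₚ.m≤n+m k 2)))) (≤⇒0≤- (≤E n i (ℕₚ.≤-trans (ℕₚ.m≤n+m (M n) (M m)) (ℕₚ.m≤n+m k 2))))) ⟩
        seq x m ℚ.- seq x n ℚ.+ (½^ m ℚ.+ ½^ n)               ≤⟨ +-monoˡ-≤ (½^ m ℚ.+ ½^ n) (≤∣∣ (seq x m ℚ.- seq x n)) ⟩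
        ℚ.∣ seq x m ℚ.- seq x n ∣ ℚ.+ (½^ m ℚ.+ ½^ n)         ∎

    ½^-null : ∀ ε → 0ℚ ℚ.< ε → Eventually λ n → ½^ n ℚ.≤ ε
    ½^-null ε ε>0 = eventually-map (λ {n} → ≤-trans (≤-reflexive (sym (*-identityˡ (½^ n))))) (½^-small 1ℚ (<⇒≤ (positive⁻¹ 1ℚ)) ε ε>0)

    y-cauchy : Cauchy y
    y-cauchy ε ε>0 =
      let N , near = cauchy x (½ ℚ.* ε) (0<½* ε>0)
          N′ , small = ½^-null (½ ℚ.* (½ ℚ.* ε)) (0<½* (0<½* ε>0))
          bound = λ m n (m≥ : N ℕ.⊔ N′ ℕ.≤ m) (n≥ : N ℕ.⊔ N′ ℕ.≤ n) → ≤-trans (y-difference m n) (≤-trans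
            (+-mono-≤ (near m n (ℕₚ.≤-trans (ℕₚ.m≤m⊔n N N′) m≥) (ℕₚ.≤-trans (ℕₚ.m≤m⊔n N N′) n≥))
              (+-mono-≤ (small m (ℕₚ.≤-trans (ℕₚ.m≤n⊔m N N′) m≥)) (small n (ℕₚ.≤-trans (ℕₚ.m≤n⊔m N N′) n≥))))
            (≤-reflexive (solve 1 (λ e → con ½ :* e :+ (con ½ :* (con ½ :* e) :+ con ½ :* (con ½ :* e)) := e) refl ε)))
      in N ℕ.⊔ N′ , λ m n m≥ n≥ → difference-bound (y m) (y n) (bound m n m≥ n≥) (bound n m n≥ m≥)

    log : ℝ
    log = mkℝ y y-cauchy

    2y≤ : ∀ n → y n ℚ.+ y n ℚ.≤ seq x n ℚ.+ 1ℚ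
    2y≤ n = begin
      y n ℚ.+ y n               ≤⟨ E-two (0≤y n) ⟩
      E 3 (y n)                 ≤⟨ E-mono-index (0≤y n) (ℕₚ.m≤m+n 3 (M n)) ⟩
      E (3 ℕ.+ M n) (y n)       ≤⟨ E≤ n (3 ℕ.+ M n) (ℕₚ.m≤n+m (M n) 3) ⟩
      seq x n ℚ.+ ½^ n          ≤⟨ +-monoʳ-≤ (seq x n) (½^≤1 n) ⟩
      seq x n ℚ.+ 1ℚ            ∎
      where open ≤-Reasoning

    -- If the logarithm were at most m, the term of x would be at most exp m + 1; the margin 2 in
    -- `exp-bound` absorbs this error and leaves a contradiction.
    ≤y : ∀ m → (∀ n → ι (+ proj₁ (exp-bound m)) ℚ.≤ seq x n) → ∀ n → ι (+ m) ℚ.≤ y n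
    ≤y m b≤x n = [ (λ m≤y → m≤y) , (λ y≤m → ⊥-elim (impossible y≤m)) ]′ (≤-total (ι (+ m)) (y n))
      where
      i = M n
      impossible : y n ℚ.≤ ι (+ m) → ⊥
      impossible y≤m = <-irrefl refl (<-≤-trans (positive⁻¹ 1ℚ) (≤-by
        (E i (ι (+ m)) ℚ.- E i (y n) ℚ.+ (ι (+ proj₁ (exp-bound m)) ℚ.- (E i (ι (+ m)) ℚ.+ ι (+ 2))) ℚ.+ (seq x n ℚ.- ι (+ proj₁ (exp-bound m))) ℚ.+ (E i (y n) ℚ.+ ½^ n ℚ.- seq x n) ℚ.+ (1ℚ ℚ.- ½^ n))
        (solve 5 (λ e f b x d → con 0ℚ :- con 1ℚ := e :- f :+ (b :- (e :+ con (ι (+ 2)))) :+ (x :- b) :+ (f :+ d :- x) :+ (con 1ℚ :- d)) refl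
          (E i (ι (+ m))) (E i (y n)) (ι (+ proj₁ (exp-bound m))) (seq x n) (½^ n))
        (0≤+ (0≤+ (0≤+ (0≤+ (≤⇒0≤- (E-mono (0≤y n) y≤m i)) (≤⇒0≤- (proj₂ (exp-bound m) i))) (≤⇒0≤- (b≤x n))) (≤⇒0≤- (≤E n i ℕₚ.≤-refl))) (≤⇒0≤- (½^≤1 n)))))

    -- The n-th approximation is good only from index `M n` on, so index i is compared with j =
    -- max(i, M n): monotonicity in the index gives the upper bound, and the tail estimate, uniform
    -- because the terms of log x are bounded, gives the lower one. Errors of ε / 4 leave the margin
    -- ε / 2 that `_<_` asks for.
    isLog : IsLog x log
    isLog ε ε>0 = I , λ i I≤i →
      (½ ℚ.* ε , 0<½* ε>0 , eventually-map (λ {n} s → subst (λ e → e ℚ.+ ½ ℚ.* ε ℚ.≤ seq x n ℚ.+ ε) (sym (seq-expSum log i n))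
        (≤-by (η ℚ.- ½^ n ℚ.+ (E (j n i) (y n) ℚ.- E i (y n)) ℚ.+ (seq x n ℚ.+ ½^ n ℚ.- E (j n i) (y n)) ℚ.+ η)
          (solve 5 (λ e x f d g → x :+ e :- (f :+ con ½ :* e) :=
             con ½ :* (con ½ :* e) :- d :+ (g :- f) :+ (x :+ d :- g) :+ con ½ :* (con ½ :* e)) refl ε (seq x n) (E i (y n)) (½^ n) (E (j n i) (y n)))
          (0≤+ (0≤+ (0≤+ (≤⇒0≤- s) (≤⇒0≤- (E-mono-index (0≤y n) (ℕₚ.m≤m⊔n i (M n))))) (≤⇒0≤- (E≤ n (j n i) (ℕₚ.m≤n⊔m i (M n))))) (<⇒≤ η>0))))
        (½^-null η η>0)) ,
      (½ ℚ.* ε , 0<½* ε>0 , eventually-map (λ {n} (b , s) → subst (λ e → seq x n ℚ.+ ½ ℚ.* ε ℚ.≤ e ℚ.+ ε) (sym (seq-expSum log i n))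
        (≤-by (η ℚ.- ½^ n ℚ.+ (η ℚ.- (E (j n i) (y n) ℚ.- E i (y n))) ℚ.+ (E (j n i) (y n) ℚ.+ ½^ n ℚ.- seq x n))
          (solve 5 (λ e x f d g → f :+ e :- (x :+ con ½ :* e) :=
             con ½ :* (con ½ :* e) :- d :+ (con ½ :* (con ½ :* e) :- (g :- f)) :+ (g :+ d :- x)) refl ε (seq x n) (E i (y n)) (½^ n) (E (j n i) (y n)))
          (0≤+ (0≤+ (≤⇒0≤- s) (≤⇒0≤- (t (0≤y n) (≤-trans (≤∣∣ (y n)) (≤-trans b C≤B)) (j n i) i I≤i (ℕₚ.m≤m⊔n i (M n))))) (≤⇒0≤- (≤E n (j n i) (ℕₚ.m≤n⊔m i (M n)))))))
        (proj₂ y-bounded ⋀ ½^-null η η>0))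
      where
      η = ½ ℚ.* (½ ℚ.* ε)
      η>0 = 0<½* (0<½* ε>0)
      j : ℕ → ℕ → ℕ
      j n i = i ℕ.⊔ M n
      y-bounded = Lemmas.bounded y y-cauchy
      C = proj₁ y-bounded
      B = proj₁ (archimedean C)
      C≤B : C ℚ.≤ ι (+ B)
      C≤B = proj₂ (archimedean C)
      I = proj₁ (uniform-tail B η η>0)
      t : ∀ {p} → 0ℚ ℚ.≤ p → p ℚ.≤ ι (+ B) → ∀ i j → I ℕ.≤ j → j ℕ.≤ i → E i p ℚ.- E j p ℚ.≤ η
      t = proj₂ (uniform-tail B η η>0)

-- Minimal polynomials over the rationals

open import Defs
open RationalSequences
open ComplexNumbers
open Irreducibility using (module ℤ[x])
open Family
open Intervals using (ι; ι-+; ι-*; ι-mono; ι-injective-0; toℚᵘ-ι; ev; ev-≋; ev-⊕; ev-⊗; ev-·; Chain; []; cell; map-chain)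
open Dynamics using (Root; root; chain; H-root)
open BaseCells using (base-chain)
open Logarithms
open import Algebra using (IsCommutativeRing)
open import Data.Empty using (⊥)
open import Data.Fin as Fin using (Fin)
open import Data.Integer as ℤ using (ℤ; +_; 0ℤ; 1ℤ)
import Data.Integer.Properties as ℤₚ
open import Data.List as List using (List; []; _∷_)
open import Data.Nat as ℕ using (ℕ; zero; suc; z≤n; s≤s)
import Data.Nat.Properties as ℕₚ
open import Data.Product using (_×_; _,_; ∃-syntax; proj₁; proj₂)
open import Data.Rational as ℚ using (ℚ; 0ℚ; 1ℚ; toℚᵘ; ↥_; ↧_; positive; nonNegative)
import Data.Rational.Properties as ℚₚ
open import Data.Rational.Unnormalised as ℚᵘ using (mkℚᵘ; *≡*)
import Data.Rational.Unnormalised.Properties as ℚᵘₚ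
open import Data.Rational.Solver using (module +-*-Solver)
open import Data.Sum using (_⊎_; inj₁; inj₂; [_,_]′)
open import Data.Vec as Vec using (Vec; []; _∷_; tabulate; last)
open import Data.Vec.Properties using (map-∘)
open import Data.Vec.Relation.Unary.All as All using (All; []; _∷_)
open import Relation.Binary.PropositionalEquality using (_≡_; _≢_; refl; sym; trans; cong; cong₂; subst; module ≡-Reasoning)
open import Relation.Nullary.Decidable using (from-yes)
open +-*-Solver using (solve; _:=_; _:+_; _:*_; _:-_; :-_; con)
module C = IsCommutativeRing ℂ-isCommutativeRing
open ℤ[x] using (Poly; _!_; _≋_; coeffs; _⊕_; _⊗_; _·_; Deg<; Deg≤; vanish; beyond; Deg<-tail; tail≋[]; ∷-cong; ≋-refl; ·-!)

Real : ℂ → Set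
Real z = ∀ n → seq (im z) n ≡ 0ℚ

horner : ∀ {m} → Monic ℚ m → ℚ → ℚ
horner []      x = 1ℚ
horner (a ∷ q) x = a ℚ.+ x ℚ.* horner q x

eval-real : ∀ {m} (q : Monic ℚ m) z → Real z → ∀ n →
  seq (re (evalℚ q z)) n ≡ horner q (seq (re z) n) × seq (im (evalℚ q z)) n ≡ 0ℚ
eval-real []      z r n = refl , refl
eval-real (a ∷ q) z r n =
  cong (a ℚ.+_) (trans (cong₂ (λ u v → seq (re z) n ℚ.* u ℚ.- v ℚ.* seq (im (evalℚ q z)) n) (proj₁ (eval-real q z r n)) (r n))
    (solve 3 (λ x h w → x :* h :- con 0ℚ :* w := x :* h) refl (seq (re z) n) (horner q (seq (re z) n)) (seq (im (evalℚ q z)) n))) ,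
  trans (cong₂ (λ u v → 0ℚ ℚ.+ (seq (re z) n ℚ.* u ℚ.+ v ℚ.* seq (re (evalℚ q z)) n)) (proj₂ (eval-real q z r n)) (r n))
    (solve 2 (λ x w → con 0ℚ :+ (x :* con 0ℚ :+ con 0ℚ :* w) := con 0ℚ) refl (seq (re z) n) (seq (re (evalℚ q z)) n))

coefficients : Poly → ∀ n → Monic ℤ n
coefficients p n = tabulate λ i → p ! Fin.toℕ i

horner-coefficients : ∀ p n → Deg≤ p n → p ! n ≡ 1ℤ → ∀ x → horner (Vec.map ι (coefficients p n)) x ≡ ev p x
horner-coefficients (a ∷ p) zero d refl x = sym (trans (ev-≋ {a ∷ p} {1ℤ ∷ []} (∷-cong refl (tail≋[] d)) x)
  (solve 1 (λ x → con 1ℚ :+ x :* con 0ℚ := con 1ℚ) refl x))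
horner-coefficients (a ∷ p) (suc n) d m x = cong (λ y → ι a ℚ.+ x ℚ.* y) (horner-coefficients p n (Deg<-tail d) m x)

infixl 9 _‼_
_‼_ : List ℚ → ℕ → ℚ
[]      ‼ i     = 0ℚ
(q ∷ s) ‼ zero  = q
(q ∷ s) ‼ suc i = s ‼ i

evq : List ℚ → ℚ → ℚ
evq []      x = 0ℚ
evq (a ∷ q) x = a ℚ.+ x ℚ.* evq q x

ι-numerator : ∀ a → ι (↥ a) ≡ ι (↧ a) ℚ.* a
ι-numerator a@(ℚ.mkℚ _ _ _) = ℚₚ.toℚᵘ-injective (begin
  toℚᵘ (ι (↥ a))                       ≈⟨ toℚᵘ-ι (↥ a) ⟩
  mkℚᵘ (↥ a) 0                         ≈⟨ *≡* (trans (cong (λ d → ↥ a ℤ.* (+ d)) (ℕₚ.*-identityˡ (ℚ.↧ₙ a))) (trans (ℤₚ.*-comm (↥ a) (↧ a)) (sym (ℤₚ.*-identityʳ _)))) ⟩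
  mkℚᵘ (↧ a) 0 ℚᵘ.* toℚᵘ a             ≈⟨ ℚᵘₚ.*-congʳ {toℚᵘ a} (toℚᵘ-ι (↧ a)) ⟨
  toℚᵘ (ι (↧ a)) ℚᵘ.* toℚᵘ a           ≈⟨ ℚₚ.toℚᵘ-homo-* (ι (↧ a)) a ⟨
  toℚᵘ (ι (↧ a) ℚ.* a)                 ∎)
  where open ℚᵘₚ.≃-Reasoning

*-cancel-0 : ∀ {a b} → a ≢ 0ℚ → a ℚ.* b ≡ 0ℚ → b ≡ 0ℚ
*-cancel-0 {a} {b} a≢0 ab≡0 = begin
  b                     ≡⟨ ℚₚ.*-identityˡ b ⟨
  1ℚ ℚ.* b              ≡⟨ cong (ℚ._* b) (ℚₚ.*-inverseˡ a) ⟨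
  ℚ.1/ a ℚ.* a ℚ.* b    ≡⟨ ℚₚ.*-assoc (ℚ.1/ a) a b ⟩
  ℚ.1/ a ℚ.* (a ℚ.* b)  ≡⟨ cong (ℚ.1/ a ℚ.*_) ab≡0 ⟩
  ℚ.1/ a ℚ.* 0ℚ         ≡⟨ ℚₚ.*-zeroʳ (ℚ.1/ a) ⟩
  0ℚ                    ∎
  where
  open ≡-Reasoning
  instance
    a-nonZero : ℚ.NonZero a
    a-nonZero = ℚ.≢-nonZero a≢0

-- `P-ev` carries vanishing at a point from q to the integer polynomial P, and `P-coeff` carries P =
-- 0 back to q.
record Cleared (q : List ℚ) : Set where
  constructor cleared
  field
    L        : ℤ
    L≢0      : L ≢ 0ℤ
    P        : Poly
    P-Deg    : Deg< P (List.length q)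
    P-coeff  : ∀ i → ι (P ! i) ≡ ι L ℚ.* q ‼ i
    P-ev     : ∀ x → ev P x ≡ ι L ℚ.* evq q x

clear-denominators : ∀ q → Cleared q
clear-denominators [] = cleared 1ℤ (λ ()) [] (vanish λ _ _ → refl) (λ i → refl) (λ x → refl)
clear-denominators (a ∷ q) = cleared (↧ a ℤ.* L)
  (λ z → nonzero (ℤₚ.i*j≡0⇒i≡0∨j≡0 (↧ a) z))
  (↥ a ℤ.* L ∷ ↧ a · P)
  (ℤ[x].Deg<-∷ (ℤ[x].Deg<-· P-Deg))
  coeff
  (λ x → trans (cong₂ (λ u v → u ℚ.+ x ℚ.* v) head (trans (ev-· (↧ a) P x) (cong (ι (↧ a) ℚ.*_) (P-ev x))))
    (trans (solve 5 (λ d l a x y → d :* l :* a :+ x :* (d :* (l :* y)) := d :* l :* (a :+ x :* y)) refl (ι (↧ a)) (ι L) a x (evq q x))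
      (cong (ℚ._* (a ℚ.+ x ℚ.* evq q x)) (sym (ι-* (↧ a) L)))))
  where
  open Cleared (clear-denominators q)
  nonzero : ↧ a ≡ 0ℤ ⊎ L ≡ 0ℤ → ⊥
  nonzero (inj₁ ())
  nonzero (inj₂ z) = L≢0 z
  head : ι (↥ a ℤ.* L) ≡ ι (↧ a) ℚ.* ι L ℚ.* a
  head = trans (ι-* (↥ a) L) (trans (cong (ℚ._* ι L) (ι-numerator a))
    (solve 3 (λ d a l → d :* a :* l := d :* l :* a) refl (ι (↧ a)) a (ι L)))
  coeff : ∀ i → ι ((↥ a ℤ.* L ∷ ↧ a · P) ! i) ≡ ι (↧ a ℤ.* L) ℚ.* (a ∷ q) ‼ i
  coeff zero    = trans head (cong (ℚ._* a) (sym (ι-* (↧ a) L)))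
  coeff (suc i) = begin
    ι ((↧ a · P) ! i)                  ≡⟨ cong ι (·-! (↧ a) P i) ⟩
    ι (↧ a ℤ.* P ! i)                  ≡⟨ ι-* (↧ a) (P ! i) ⟩
    ι (↧ a) ℚ.* ι (P ! i)              ≡⟨ cong (ι (↧ a) ℚ.*_) (P-coeff i) ⟩
    ι (↧ a) ℚ.* (ι L ℚ.* q ‼ i)        ≡⟨ ℚₚ.*-assoc (ι (↧ a)) (ι L) (q ‼ i) ⟨
    ι (↧ a) ℚ.* ι L ℚ.* q ‼ i          ≡⟨ cong (ℚ._* q ‼ i) (ι-* (↧ a) L) ⟨
    ι (↧ a ℤ.* L) ℚ.* q ‼ i            ∎
    where open ≡-Reasoning

module MinimalPolynomial (e : ℕ) (v : ℝ) (v-zero : Null λ k → ev (H (suc e)) (seq v k)) where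

  n : ℕ
  n = degH (suc e)

  h : Monic ℤ n
  h = coefficients (H (suc e)) n

  α : ℂ
  α = ℝ→ℂ v

  Vanishes : Poly → Set
  Vanishes p = Null λ k → ev p (seq v k)

  ev-bounded : ∀ p → Bounded λ k → ev p (seq v k)
  ev-bounded []      = Bounded-const 0ℚ
  ev-bounded (a ∷ p) = Bounded-+ (Bounded-const (ι a)) (Bounded-* (Bounded-seq v) (ev-bounded p))

  vanishing-low-degree : ∀ m → m ℕ.≤ n → ∀ q → Deg< q m → Vanishes q → q ≋ []
  vanishing-low-degree = H-Schönemann.lower-degree-zero (suc e) Vanishes
    (λ {p} {q} e → Null-≗ (λ k → ev-≋ {p} {q} e (seq v k)))
    (λ {p} {q} a b → Null-≗ (λ k → sym (ev-⊕ p q (seq v k))) (Null-+ a b))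
    (λ {p} q a → Null-≗ (λ k → trans (ℚₚ.*-comm (ev q (seq v k)) (ev p (seq v k))) (sym (ev-⊗ p q (seq v k)))) (Null-*-bounded (ev-bounded q) a))
    (λ a ν → ι-injective-0 (const-Null⇒0 (Null-≗ (λ k → solve 2 (λ a x → a :+ x :* con 0ℚ := a) refl (ι a) (seq v k)) ν)))
    v-zero (degree-bound (H-Top e))

  vanishing-rational : ∀ q → List.length q ℕ.≤ n → Null (λ k → evq q (seq v k)) → ∀ i → q ‼ i ≡ 0ℚ
  vanishing-rational q len ν i = *-cancel-0 (λ z → L≢0 (ι-injective-0 z)) (trans (sym (P-coeff i)) (cong ι (ℤ[x].at P≋[] i)))
    where
    open Cleared (clear-denominators q)
    P≋[] : P ≋ []
    P≋[] = vanishing-low-degree (List.length q) len P P-Deg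
      (Null-≗ (λ k → sym (P-ev (seq v k))) (Null-*-bounded (Bounded-const (ι L)) ν))

  annihilator-Null : ∀ {m} (q : Monic ℚ m) → evalℚ q α ≅ 0ᶜ → Null λ k → horner q (seq v k)
  annihilator-Null q ⟪ z , _ ⟫ = Null-≗ (λ k → proj₁ (eval-real q α (λ _ → refl) k)) (≈0⇒Null {re (evalℚ q α)} z)

  monicList : ∀ {m} → Monic ℚ m → List ℚ
  monicList []      = 1ℚ ∷ []
  monicList (a ∷ q) = a ∷ monicList q

  evq-monicList : ∀ {m} (q : Monic ℚ m) x → evq (monicList q) x ≡ horner q x
  evq-monicList []      x = solve 1 (λ x → con 1ℚ :+ x :* con 0ℚ := con 1ℚ) refl x
  evq-monicList (a ∷ q) x = cong (λ y → a ℚ.+ x ℚ.* y) (evq-monicList q x)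

  length-monicList : ∀ {m} (q : Monic ℚ m) → List.length (monicList q) ≡ suc m
  length-monicList []      = refl
  length-monicList (a ∷ q) = cong suc (length-monicList q)

  leading-monicList : ∀ {m} (q : Monic ℚ m) → monicList q ‼ m ≡ 1ℚ
  leading-monicList []      = refl
  leading-monicList (a ∷ q) = leading-monicList q

  -- For m < n all the m + 1 coefficients would vanish, the leading 1 among them.
  minimal : ∀ {m} (q : Monic ℚ m) → evalℚ q α ≅ 0ᶜ → n ℕ.≤ m
  minimal {m} q z = ℕₚ.≮⇒≥ λ m<n → 1≢0 (trans (sym (leading-monicList q))
    (vanishing-rational (monicList q) (ℕₚ.≤-trans (ℕₚ.≤-reflexive (length-monicList q)) m<n)
      (Null-≗ (λ k → sym (evq-monicList q (seq v k))) (annihilator-Null q z)) m))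
    where
    1≢0 : 1ℚ ≢ 0ℚ
    1≢0 ()

  difference : ∀ {m} → Vec ℚ m → Vec ℚ m → List ℚ
  difference []      []      = []
  difference (a ∷ p) (b ∷ q) = a ℚ.- b ∷ difference p q

  length-difference : ∀ {m} (p q : Vec ℚ m) → List.length (difference p q) ≡ m
  length-difference []      []      = refl
  length-difference (a ∷ p) (b ∷ q) = cong suc (length-difference p q)

  evq-difference : ∀ {m} (p q : Monic ℚ m) x → evq (difference p q) x ≡ horner p x ℚ.+ ℚ.- horner q x
  evq-difference []      []      x = refl
  evq-difference (a ∷ p) (b ∷ q) x = trans (cong (λ y → a ℚ.- b ℚ.+ x ℚ.* y) (evq-difference p q x))
    (solve 5 (λ a b x p q → a :- b :+ x :* (p :+ :- q) := (a :+ x :* p) :+ :- (b :+ x :* q)) refl a b x (horner p x) (horner q x))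

  difference-zero : ∀ {m} (p q : Vec ℚ m) → (∀ i → difference p q ‼ i ≡ 0ℚ) → p ≡ q
  difference-zero []      []      _ = refl
  difference-zero (a ∷ p) (b ∷ q) z = cong₂ _∷_
    (trans (solve 2 (λ a b → a := a :- b :+ b) refl a b) (trans (cong (ℚ._+ b) (z 0)) (ℚₚ.+-identityˡ b)))
    (difference-zero p q (λ i → z (suc i)))

  -- The leading terms cancel in the difference. Conjugates are defined through an arbitrary minimal
  -- polynomial, which this identifies with the known one.
  unique : ∀ (p q : Monic ℚ n) → evalℚ p α ≅ 0ᶜ → evalℚ q α ≅ 0ᶜ → p ≡ q
  unique p q y z = difference-zero p q (vanishing-rational (difference p q) (ℕₚ.≤-reflexive (length-difference p q))
    (Null-≗ (λ k → sym (evq-difference p q (seq v k))) (Null-+ (annihilator-Null p y) (Null-neg (annihilator-Null q z)))))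

h-zero : ∀ e z → Real z → Null (λ k → ev (H (suc e)) (seq (re z) k)) →
  evalℚ (Vec.map ι (coefficients (H (suc e)) (degH (suc e)))) z ≅ 0ᶜ
h-zero e z r ν = ⟪
  Null⇒≈0 {re (evalℚ h z)} (Null-≗ (λ k → sym (trans (proj₁ (eval-real h z r k))
    (horner-coefficients (H (suc e)) (degH (suc e)) (degree-bound (H-Top e)) (monic (H-Top e)) (seq (re z) k)))) ν) ,
  Null⇒≈0 {im (evalℚ h z)} (Null-≗ (λ k → sym (proj₂ (eval-real h z r k))) Null-0) ⟫
  where h = Vec.map ι (coefficients (H (suc e)) (degH (suc e)))

-- The zeros, their conjugacy and their sum

record Roots (g : ℚ → ℚ) (l : ℚ) (k : ℕ) : Set where
  constructor roots
  field
    zs       : Vec ℂ k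
    real     : All Real zs
    zeros    : All (λ z → Null λ n → g (seq (re z) n)) zs
    γ        : ℚ
    γ>0      : 0ℚ ℚ.< γ
    above    : All (λ z → Eventually λ n → l ℚ.+ γ ℚ.≤ seq (re z) n) zs
    distinct : Distinct zs

-- The zero of a cell is at most its right end q, and the later ones are eventually at least q + γ.
-- Differences are thus bounded below by a positive rational, which makes them regular.
chain-roots : ∀ {g l r k} → Chain (Root g) l r k → Roots g l k
chain-roots ([] l≤r) = roots [] [] [] 1ℚ (ℚₚ.positive⁻¹ 1ℚ) [] _
chain-roots {g} {l} (cell {p = p} {q} l≤p p<q (root v ν γ γ>0 a b) rest) =
  roots (ℝ→ℂ v ∷ R.zs) ((λ _ → refl) ∷ R.real) (ν ∷ R.zeros) (γ ℚ.⊓ R.γ) μ>0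
    (eventually-map (ℚₚ.≤-trans (ℚₚ.+-mono-≤ l≤p (ℚₚ.p⊓q≤p γ R.γ))) a ∷
      All.map (eventually-map (ℚₚ.≤-trans (ℚₚ.+-mono-≤ (ℚₚ.≤-trans l≤p (ℚₚ.<⇒≤ p<q)) (ℚₚ.p⊓q≤q γ R.γ)))) R.above)
    (separated R.real R.above , R.distinct)
  where
  module R = Roots (chain-roots rest)
  μ>0 : 0ℚ ℚ.< γ ℚ.⊓ R.γ
  μ>0 = [ (λ e → ℚₚ.<-≤-trans γ>0 (ℚₚ.≤-reflexive (sym e))) , (λ e → ℚₚ.<-≤-trans R.γ>0 (ℚₚ.≤-reflexive (sym e))) ]′ (ℚₚ.⊓-sel γ R.γ)
  separated : ∀ {m} {ws : Vec ℂ m} → All Real ws → All (λ z → Eventually λ n → q ℚ.+ R.γ ℚ.≤ seq (re z) n) ws →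
    All (λ w → Regular (w -ᶜ ℝ→ℂ v)) ws
  separated []       []       = []
  separated {ws = w ∷ _} (r ∷ rs) (a ∷ as) = real-Regular {w -ᶜ ℝ→ℂ v} R.γ>0
    (λ n → cong (λ y → y ℚ.- 0ℚ) (r n))
    (eventually-map (λ {n} h → ≤-by ((seq (re w) n ℚ.- (q ℚ.+ R.γ)) ℚ.+ (q ℚ.- seq v n))
      (solve 4 (λ w v q d → w :- v :- d := (w :- (q :+ d)) :+ (q :- v)) refl (seq (re w) n) (seq v n) q R.γ)
      (0≤+ (≤⇒0≤- h) (≤⇒0≤- (b n)))) a) ∷ separated rs as

Σ-real : ∀ {k} (zs : Vec ℂ k) → All Real zs → Real (Σᶜ zs)
Σ-real []       []       n = refl
Σ-real (z ∷ zs) (r ∷ rs) n = cong₂ ℚ._+_ (r n) (Σ-real zs rs n)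

last-coefficients : ∀ {A : Set} (g : ℤ → A) p n → last (Vec.map g (coefficients p (suc n))) ≡ g (p ! n)
last-coefficients g p       zero    = refl
last-coefficients g []      (suc n) = last-coefficients g [] n
last-coefficients g (a ∷ p) (suc n) = last-coefficients g p n

last-map : ∀ {A B : Set} (g : A → B) {m} (xs : Vec A (suc m)) → last (Vec.map g xs) ≡ g (last xs)
last-map g (x ∷ [])         = refl
last-map g (x ∷ xs@(_ ∷ _)) = last-map g xs

complexify : ∀ {m} → Vec ℚ m → Monic ℂ m
complexify = Vec.map (λ a → ℝ→ℂ (fromℚ a))

sum-of-zeros-Null : ∀ p m (zs : Vec ℂ m) → 0 ℕ.< m → Zeros (complexify (Vec.map ι (coefficients p m))) zs → Distinct zs →
  Null λ i → ι ((0ℤ ∷ p) ! m) ℚ.+ seq (re (Σᶜ zs)) i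
sum-of-zeros-Null p (suc m) zs _ z d = Null-≗
  (λ i → cong (ℚ._+ seq (re (Σᶜ zs)) i) (trans (cong (λ w → seq (re w) i) (last-map (λ a → ℝ→ℂ (fromℚ a)) (Vec.map ι (coefficients p (suc m)))))
    (last-coefficients ι p m)))
  (≈0⇒Null {re (last as +ᶜ Σᶜ zs)} (proj₁ (toᶜ (sum-of-zeros as zs z d))))
  where as = complexify (Vec.map ι (coefficients p (suc m)))

opaque
  roots-of-H : ∀ e → Roots (ev (H e)) 0ℚ (degH e)
  roots-of-H e = chain-roots (subst (Chain (Root (ev (H e))) 0ℚ (proj₁ base-chain)) (ℕₚ.*-comm 30 (3^ e))
    (map-chain (H-root e) (chain (proj₂ base-chain) e)))

e<3^ : ∀ e → e ℕ.< 3^ e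
e<3^ zero    = s≤s z≤n
e<3^ (suc e) = ℕₚ.≤-trans (s≤s (e<3^ e)) (ℕₚ.≤-trans (ℕₚ.+-monoˡ-≤ (3^ e) (1≤3^ e))
  (ℕₚ.≤-trans (ℕₚ.+-monoʳ-≤ (3^ e) (ℕₚ.m≤m+n (3^ e) (3^ e))) (ℕₚ.≤-reflexive
    (trans (cong (λ m → 3^ e ℕ.+ (3^ e ℕ.+ m)) (sym (ℕₚ.+-identityʳ (3^ e)))) (ℕₚ.*-comm 3 (3^ e))))))

module Construction (e : ℕ) where

  open Roots (roots-of-H (suc e))

  n = degH (suc e)
  k = 3^ suc e

  h : Monic ℤ n
  h = coefficients (H (suc e)) n

  hℚ : Monic ℚ n
  hℚ = Vec.map ι h

  hℚ-zeros : ∀ {m} {ws : Vec ℂ m} → All Real ws → All (λ z → Null λ i → ev (H (suc e)) (seq (re z) i)) ws →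
    Zeros (complexify hℚ) ws
  hℚ-zeros []       []       = []
  hℚ-zeros {ws = z ∷ _} (r ∷ rs) (ν ∷ νs) = h-zero e z r ν ∷ hℚ-zeros rs νs

  t : ℝ
  t = re (Σᶜ zs)

  t-Σ : ℝ→ℂ t ≈ᶜ Σᶜ zs
  t-Σ = ≈-refl {t} , pointwise 0ℝ (im (Σᶜ zs)) (λ i → sym (Σ-real zs real i))

  hℚ-factors : AreZerosOf zs hℚ
  hℚ-factors x = toᶜ (factorisation (complexify hℚ) zs (hℚ-zeros real zeros) distinct x)

  positive-zeros : ∀ {m} {ws : Vec ℂ m} → All Real ws → All (λ z → Eventually λ i → 0ℚ ℚ.+ γ ℚ.≤ seq (re z) i) ws → All (PositiveReal γ) ws
  positive-zeros []       []       = []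
  positive-zeros (r ∷ rs) (a ∷ as) = (r , eventually-map (ℚₚ.≤-trans (ℚₚ.≤-reflexive (sym (ℚₚ.+-identityˡ γ)))) a) ∷ positive-zeros rs as

  0<n : 0 ℕ.< n
  0<n = ℕₚ.*-mono-≤ (1≤3^ (suc e)) (s≤s (z≤n {29}))

  -- As a sum of computed zeros the trace agrees with the integer 59k only in the limit; the slack
  -- 1/4 is affordable later.
  trace-bound : Eventually λ i → seq t i ℚ.≤ ι (+ (k ℕ.* 59)) ℚ.+ + 1 ℚ./ 4
  trace-bound = eventually-map (λ {i} → step (seq t i)) (sum-of-zeros-Null (H (suc e)) n zs 0<n (hℚ-zeros real zeros) distinct (+ 1 ℚ./ 4) (ℚₚ.positive⁻¹ (+ 1 ℚ./ 4)))
    where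
    T = ι (+ (k ℕ.* 59))
    M = ι ((0ℤ ∷ H (suc e)) ! n)
    M+T : M ℚ.+ T ≡ 0ℚ
    M+T = trans (cong (λ m → ι m ℚ.+ T) (subleading (H-Top e)))
      (trans (sym (ι-+ (ℤ.- (+ (k ℕ.* 59))) (+ (k ℕ.* 59)))) (cong ι (ℤₚ.+-inverseˡ (+ (k ℕ.* 59)))))
    step : ∀ t → ℚ.∣ M ℚ.+ t ∣ ℚ.≤ + 1 ℚ./ 4 → t ℚ.≤ T ℚ.+ + 1 ℚ./ 4
    step t b = ≤-by (+ 1 ℚ./ 4 ℚ.- (M ℚ.+ t) ℚ.+ (M ℚ.+ T))
      (solve 4 (λ T q t M → T :+ q :- t := q :- (M :+ t) :+ (M :+ T)) refl T (+ 1 ℚ./ 4) t M)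
      (0≤+ (≤⇒0≤- (ℚₚ.≤-trans (≤∣∣ (M ℚ.+ t)) b)) (ℚₚ.≤-reflexive (sym M+T)))

  -- The first zero serves as the algebraic integer; all the zeros are its conjugates.
  module Generator (v : ℝ) (v-zero : Null λ i → ev (H (suc e)) (seq v i)) where
    open MinimalPolynomial e v v-zero using (minimal; unique)

    α : ℂ
    α = ℝ→ℂ v

    α-zero : evalℚ hℚ α ≅ 0ᶜ
    α-zero = h-zero e α (λ _ → refl) v-zero

    hℚ-minimal : IsMinimalPolynomial α hℚ
    hℚ-minimal = toᶜ α-zero , λ q z → minimal q ⟪ z ⟫

    algebraic-integer : IsAlgebraicInteger α
    algebraic-integer = n , h , subst (λ as → eval as α ≈ᶜ 0ᶜ) (sym (map-∘ (λ a → ℝ→ℂ (fromℚ a)) ι h)) (toᶜ α-zero)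

    -- Minimality in both directions gives p the degree n, and uniqueness gives p = hℚ. A zero β of
    -- it therefore makes the product of the β - z over the positive zeros z vanish.
    totally-positive : IsTotallyPositive α
    totally-positive β (m , p , (p-zero , p-min) , pβ≈0) =
      zero-is-real zs γ>0 pos β product , zero-is-positive zs γ>0 pos β product
      where
      pos = positive-zeros real above
      hℚ-zero : ∀ {m} (p : Monic ℚ m) → n ≡ m → evalℚ p α ≅ 0ᶜ → evalℚ p β ≅ 0ᶜ → evalℚ hℚ β ≅ 0ᶜ
      hℚ-zero p refl z w = subst (λ q → evalℚ q β ≅ 0ᶜ) (unique p hℚ z α-zero) w
      product : Πᶜ (Vec.map (β -ᶜ_) zs) ≅ 0ᶜ
      product = C.trans (C.sym ⟪ hℚ-factors β ⟫)
        (hℚ-zero p (ℕₚ.≤-antisym (minimal p ⟪ p-zero ⟫) (p-min hℚ (toᶜ α-zero))) ⟪ p-zero ⟫ ⟪ pβ≈0 ⟫)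

    has-trace : HasTrace α t
    has-trace = n , hℚ , zs , hℚ-minimal , hℚ-factors , t-Σ

  first-zero : ∃[ v ] Null λ i → ev (H (suc e)) (seq v i)
  first-zero = from-zeros 0<n zeros
    where
    from-zeros : ∀ {m} {ws : Vec ℂ m} → 0 ℕ.< m → All (λ z → Null λ i → ev (H (suc e)) (seq (re z) i)) ws → ∃[ v ] Null λ i → ev (H (suc e)) (seq v i)
    from-zeros {ws = z ∷ _} _ (ν ∷ _) = re z , ν

-- The final inequality

exp-bound≥1 : ∀ m → 1ℚ ℚ.≤ ι (+ proj₁ (exp-bound m))
exp-bound≥1 m = ℚₚ.≤-trans (from-yes (1ℚ ℚ.≤? 0ℚ ℚ.+ ι (+ 2))) (proj₂ (exp-bound m) 0)

module Bound (e : ℕ) (large : proj₁ (exp-bound (proj₁ (exp-bound (proj₁ (exp-bound 4))))) ℕ.≤ degH (suc e)) where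
  open Construction e

  b₁ = proj₁ (exp-bound 4)
  b₂ = proj₁ (exp-bound b₁)
  b₃ = proj₁ (exp-bound b₂)

  b₃≤n : ι (+ b₃) ℚ.≤ ι (+ n)
  b₃≤n = ι-mono (ℤ.+≤+ large)

  module L₁ = Logarithm (fromℕ n) (λ _ → ℚₚ.≤-trans (exp-bound≥1 b₂) b₃≤n)
  b₂≤L₁ = L₁.≤y b₂ λ _ → b₃≤n
  module L₂ = Logarithm L₁.log (λ i → ℚₚ.≤-trans (exp-bound≥1 b₁) (b₂≤L₁ i))
  b₁≤L₂ = L₂.≤y b₁ b₂≤L₁
  module L₃ = Logarithm L₂.log (λ i → ℚₚ.≤-trans (exp-bound≥1 4) (b₁≤L₂ i))
  4≤L₃ : ∀ i → ι (+ 4) ℚ.≤ L₃.y i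
  4≤L₃ = L₃.≤y 4 b₁≤L₂

  pos : 0ℝ < L₃.log
  pos = ι (+ 4) , ℚₚ.positive⁻¹ (ι (+ 4)) , always λ i → ℚₚ.≤-trans (ℚₚ.≤-reflexive (ℚₚ.+-identityˡ (ι (+ 4)))) (4≤L₃ i)

  inverse≤ : ∀ i → seq (inv L₃.log pos) i ℚ.≤ + 1 ℚ./ 4
  inverse≤ i = ℚₚ.*-cancelˡ-≤-pos a {{a-pos}} (ℚₚ.≤-trans (ℚₚ.≤-reflexive (Lemmas.*-÷⁺ 1ℚ a {{a-pos}}))
    (ℚₚ.*-monoʳ-≤-nonNeg (+ 1 ℚ./ 4) 4≤a))
    where
    -- `pos` carries the lower bound 4, so the terms of the inverse are 1 / max(4, yᵢ), at most 1/4
    -- at every index.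
    a = ι (+ 4) ℚ.⊔ L₃.y i
    4≤a = ℚₚ.p≤p⊔q (ι (+ 4)) (L₃.y i)
    a-pos : ℚ.Positive a
    a-pos = positive (ℚₚ.<-≤-trans (ℚₚ.positive⁻¹ (ι (+ 4))) 4≤a)

  3≤k : ι (+ 3) ℚ.≤ ι (+ k)
  3≤k = ι-mono (ℤ.+≤+ (ℕₚ.*-monoˡ-≤ 3 (1≤3^ e)))

  -- With log log log n ≥ 4 and log x ≤ (x + 1) / 2 used twice, the subtracted term is at most (log
  -- log n) / 16 ≤ (log n + 1) / 32 ≤ (n + 3) / 64, where n = 30k. The slack 1/4 in the trace and
  -- the strictness margin 1/4 leave k - 1/2 - (30k + 3) / 64 = (34 (k - 3) + 67) / 64, positive as
  -- k ≥ 3.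
  trace-small : t < fromℕ (2 ℕ.* n) - fromℚ (+ 1 ℚ./ 4) * (L₂.log * inv L₃.log pos)
  trace-small = + 1 ℚ./ 4 , ℚₚ.positive⁻¹ (+ 1 ℚ./ 4) , eventually-map step trace-bound
    where
    κ = ι (+ k)
    ι59 : ι (+ (k ℕ.* 59)) ≡ κ ℚ.* ι (+ 59)
    ι59 = trans (cong ι (ℤₚ.pos-* k 59)) (ι-* (+ k) (+ 59))
    ιn : ι (+ n) ≡ κ ℚ.* ι (+ 30)
    ιn = trans (cong ι (ℤₚ.pos-* k 30)) (ι-* (+ k) (+ 30))
    ι2n : ι (+ (2 ℕ.* n)) ≡ ι (+ 2) ℚ.* (κ ℚ.* ι (+ 30))
    ι2n = trans (cong ι (ℤₚ.pos-* 2 n)) (trans (ι-* (+ 2) (+ n)) (cong (ι (+ 2) ℚ.*_) ιn))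
    step : ∀ {i} → seq t i ℚ.≤ ι (+ (k ℕ.* 59)) ℚ.+ + 1 ℚ./ 4 →
      seq t i ℚ.+ + 1 ℚ./ 4 ℚ.≤ ι (+ (2 ℕ.* n)) ℚ.+ ℚ.- (+ 1 ℚ./ 4 ℚ.* (L₂.y i ℚ.* seq (inv L₃.log pos) i))
    step {i} b = ≤-by
      ((κ ℚ.* ι (+ 59) ℚ.+ + 1 ℚ./ 4 ℚ.- seq t i)
        ℚ.+ + 1 ℚ./ 4 ℚ.* (y₂ ℚ.* (+ 1 ℚ./ 4) ℚ.- y₂ ℚ.* r)
        ℚ.+ + 1 ℚ./ 32 ℚ.* (y₁ ℚ.+ 1ℚ ℚ.- (y₂ ℚ.+ y₂))
        ℚ.+ + 1 ℚ./ 64 ℚ.* (κ ℚ.* ι (+ 30) ℚ.+ 1ℚ ℚ.- (y₁ ℚ.+ y₁))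
        ℚ.+ (+ 34 ℚ./ 64 ℚ.* (κ ℚ.- ι (+ 3)) ℚ.+ + 67 ℚ./ 64))
      (trans (cong (λ z → z ℚ.+ ℚ.- (+ 1 ℚ./ 4 ℚ.* (y₂ ℚ.* r)) ℚ.- (seq t i ℚ.+ + 1 ℚ./ 4)) ι2n)
        (solve 5 (λ k t a b r → con (ι (+ 2)) :* (k :* con (ι (+ 30))) :+ :- (con (+ 1 ℚ./ 4) :* (b :* r)) :- (t :+ con (+ 1 ℚ./ 4)) :=
          (k :* con (ι (+ 59)) :+ con (+ 1 ℚ./ 4) :- t)
          :+ con (+ 1 ℚ./ 4) :* (b :* con (+ 1 ℚ./ 4) :- b :* r)
          :+ con (+ 1 ℚ./ 32) :* (a :+ con 1ℚ :- (b :+ b))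
          :+ con (+ 1 ℚ./ 64) :* (k :* con (ι (+ 30)) :+ con 1ℚ :- (a :+ a))
          :+ (con (+ 34 ℚ./ 64) :* (k :- con (ι (+ 3))) :+ con (+ 67 ℚ./ 64))) refl κ (seq t i) y₁ y₂ r))
      (0≤+ (0≤+ (0≤+ (0≤+
        (≤⇒0≤- (ℚₚ.≤-trans b (ℚₚ.≤-reflexive (cong (ℚ._+ + 1 ℚ./ 4) ι59))))
        (0≤* (nn (+ 1 ℚ./ 4)) (≤⇒0≤- (ℚₚ.*-monoˡ-≤-nonNeg y₂ {{nonNegative (L₂.0≤y i)}} (inverse≤ i)))))
        (0≤* (nn (+ 1 ℚ./ 32)) (≤⇒0≤- (L₂.2y≤ i))))
        (0≤* (nn (+ 1 ℚ./ 64)) (≤⇒0≤- (ℚₚ.≤-trans (L₁.2y≤ i) (ℚₚ.≤-reflexive (cong (ℚ._+ 1ℚ) ιn))))))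
        (0≤+ (0≤* (nn (+ 34 ℚ./ 64)) (≤⇒0≤- 3≤k)) (nn (+ 67 ℚ./ 64))))
      where
      y₁ = L₁.y i
      y₂ = L₂.y i
      r  = seq (inv L₃.log pos) i
      nn : ∀ q .{{_ : ℚ.Positive q}} → 0ℚ ℚ.≤ q
      nn q = ℚₚ.<⇒≤ (ℚₚ.positive⁻¹ q)

corollary3 :
  InfinitelyMany λ n → 0 ℕ.< n ×
    ∃[ α ] IsAlgebraicInteger α × IsTotallyPositive α × HasDegree α n ×
    ∃[ t ] HasTrace α t ×
    ∃[ log-n ] ∃[ loglog-n ] ∃[ logloglog-n ]
      IsLog (fromℕ n) log-n ×
      IsLog log-n loglog-n ×
      IsLog loglog-n logloglog-n ×
      ∃[ pos ]
        t < fromℕ (2 ℕ.* n)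
              - fromℚ (ℤ.+ 1 ℚ./ 4) * (loglog-n * inv logloglog-n pos)
corollary3 N = n , e<n (ℕₚ.m≤m+n N b) , ℕₚ.≤-<-trans z≤n (e<n (ℕₚ.m≤m+n N b)) ,
  α , algebraic-integer , totally-positive , (hℚ , hℚ-minimal) ,
  t , has-trace , L₁.log , L₂.log , L₃.log , L₁.isLog , L₂.isLog , L₃.isLog , pos , trace-small
  where
  b = proj₁ (exp-bound (proj₁ (exp-bound (proj₁ (exp-bound 4)))))
  -- The degree 30 · 3^(e + 1) exceeds e, hence both the given N and the threshold b, a natural
  -- number above exp exp exp 4.
  e = N ℕ.+ b
  e<n : ∀ {m} → m ℕ.≤ e → m ℕ.< degH (suc e)
  e<n m≤e = ℕₚ.≤-<-trans m≤e (ℕₚ.<-≤-trans (ℕₚ.<-trans (ℕₚ.n<1+n e) (e<3^ (suc e))) (ℕₚ.m≤m*n (3^ suc e) 30))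
  open Construction e
  open Generator (proj₁ first-zero) (proj₂ first-zero)
  open Bound e (ℕₚ.<⇒≤ (e<n (ℕₚ.m≤n+m b N)))
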